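{- Let $q$ be a prime power and let $m>1$ be an integer, written as $m=2^k l$ with $k,l$ nonnegative integers and $l$ odd. Let $N_q(m,2)$ be the number of polynomials $f(X)\in\mathbb{F}_{q^m}[X]$ that are irreducible in $\mathbb{F}_{q^m}[X]$ and are of the form $X^2-\lambda g(X)$ with $\lambda\in\mathbb{F}_{q^m}$ satisfying $\mathbb{F}_{q^m}=\mathbb{F}_q(\lambda)$ and $g(X)\in\mathbb{F}_q[X]$ with $g(0)=1$ and $\deg g\le 1$. Then: (1) If $l=1$, then $N_q(m,2)=\frac{(q-1)q^m}{2}$ if $q$ is even, and $N_q(m,2)=\frac{q(q^m-1)}{2}$ if $q$ is odd. (2) If $l>1$, then $N_q(m,2)=\frac{l\,|\mathcal{I}(l;q^{2^k})|}{2}(q-1)$ if $q$ is even, and $N_q(m,2)=\frac{l\,|\mathcal{I}(l;q^{2^k})|}{2}\,q$ if $q$ is odd.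
   Context: For a prime power $Q$ and positive integer $r$, $\mathcal{I}(r;Q)$ denotes the set of monic irreducible polynomials of degree $r$ in $\mathbb{F}_Q[X]$. -}

module Defs where

open import Level using (Level; _⊔_) renaming (suc to lsuc; zero to lzero)
open import Data.Nat using (ℕ; zero; suc; _≤_; _<_)
open import Data.Fin using (Fin)
open import Data.List using (List; []; _∷_; length; map)
open import Data.List.Relation.Unary.All using (All)
open import Data.List.Relation.Unary.Any using (Any)
open import Data.List.Relation.Unary.AllPairs using (AllPairs)
open import Data.Product using (Σ; ∃; _×_; _,_)
open import Data.Sum using (_⊎_)
open import Relation.Nullary using (¬_)
open import Relation.Binary.PropositionalEquality using (_≡_)
open import Algebra.Structures using (IsCommutativeRing)
open import Function.Bundles using (_↔_)

HasSize : ∀ {a r p} {A : Set a} (_≈_ : A → A → Set r) (P : A → Set p) → ℕ → Set (a ⊔ r ⊔ p)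
HasSize {A = A} _≈_ P n =
  Σ (List A) λ xs →
    (length xs ≡ n) × AllPairs (λ x y → ¬ (x ≈ y)) xs × All P xs
    × (∀ x → P x → Any (x ≈_) xs)

record FiniteField : Set₁ where
  infixl 7 _*_
  infixl 6 _+_
  field
    Carrier : Set
    _+_ _*_ : Carrier → Carrier → Carrier
    -_      : Carrier → Carrier
    0# 1#   : Carrier
    isCommutativeRing : IsCommutativeRing _≡_ _+_ _*_ -_ 0# 1#
    0≢1     : ¬ (0# ≡ 1#)
    inverse : ∀ x → ¬ (x ≡ 0#) → Σ Carrier λ y → x * y ≡ 1#
    card    : ℕ
    enum    : Fin card ↔ Carrier

module FieldDefs (F : FiniteField) where
  open FiniteField F

  _^ᶠ_ : Carrier → ℕ → Carrier
  x ^ᶠ zero = 1#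
  x ^ᶠ suc n = x * (x ^ᶠ n)

  record IsSubfield (S : Carrier → Set) : Set where
    field
      has0 : S 0#
      has1 : S 1#
      +-closed : ∀ {x y} → S x → S y → S (x + y)
      *-closed : ∀ {x y} → S x → S y → S (x * y)
      neg-closed : ∀ {x} → S x → S (- x)
      inv-closed : ∀ {x y} → S x → x * y ≡ 1# → S y

  -- Polynomials in F[X]: coefficient lists, lowest degree first.
  -- Two lists denote the same polynomial iff all coefficients agree.

  Poly : Set
  Poly = List Carrier

  coeff : Poly → ℕ → Carrier
  coeff [] _ = 0#
  coeff (a ∷ p) zero = a
  coeff (a ∷ p) (suc i) = coeff p i

  _≈ₚ_ : Poly → Poly → Set
  p ≈ₚ q = ∀ i → coeff p i ≡ coeff q i

  _+ₚ_ : Poly → Poly → Poly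
  [] +ₚ q = q
  (a ∷ p) +ₚ [] = a ∷ p
  (a ∷ p) +ₚ (b ∷ q) = (a + b) ∷ (p +ₚ q)

  _·ₚ_ : Carrier → Poly → Poly
  c ·ₚ p = map (c *_) p

  _*ₚ_ : Poly → Poly → Poly
  [] *ₚ q = []
  (a ∷ p) *ₚ q = (a ·ₚ q) +ₚ (0# ∷ (p *ₚ q))

  -ₚ_ : Poly → Poly
  -ₚ p = map -_ p

  IsConstant : Poly → Set
  IsConstant p = ∀ i → 1 ≤ i → coeff p i ≡ 0#

  -- irreducible in F[X]: non-constant, and every factorisation has a
  -- constant (= unit, since the product is nonzero) factor
  Irreducible : Poly → Set
  Irreducible f = ¬ IsConstant f × (∀ g h → f ≈ₚ (g *ₚ h) → IsConstant g ⊎ IsConstant h)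

  MonicOfDegree : ℕ → Poly → Set
  MonicOfDegree r f = coeff f r ≡ 1# × (∀ i → r < i → coeff f i ≡ 0#)

  MonicIrreducible : ℕ → Poly → Set
  MonicIrreducible r f = MonicOfDegree r f × Irreducible f

  NumIrred : ℕ → ℕ → Set
  NumIrred r n = HasSize _≈ₚ_ (MonicIrreducible r) n

  -- Setting of Theorem 5.2: F = 𝔽_{q^m}; its subfield 𝔽_q is
  -- { x | x^q = x } (the unique subfield of order q).

  module OverFq (q : ℕ) where

    InFq : Carrier → Set
    InFq x = x ^ᶠ q ≡ x

    Generates : Carrier → Set₁
    Generates λ′ = ∀ (S : Carrier → Set) → IsSubfield S → (∀ x → InFq x → S x)
                   → S λ′ → ∀ x → S x

    Admissible-g : Poly → Set
    Admissible-g g = All InFq g × coeff g 0 ≡ 1# × (∀ i → 1 < i → coeff g i ≡ 0#)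

    X² : Poly
    X² = 0# ∷ 0# ∷ 1# ∷ []

    InNSet : Poly → Set₁
    InNSet f = Irreducible f ×
      Σ Carrier λ λ′ → Σ Poly λ g →
        Generates λ′ × Admissible-g g × f ≈ₚ (X² +ₚ (-ₚ (λ′ ·ₚ g)))

    NqEquals : ℕ → Set₁
    NqEquals n = HasSize _≈ₚ_ InNSet n

{-# OPTIONS --safe #-}

-- Let m = 2^k l with l odd, Q = q^(2^k), K = 𝔽_{q^m}. Writing g = 1 + bX, one counts pairs (λ , b) with λ of
-- degree m over 𝔽_q, b ∈ 𝔽_q and X² - λ(1 + bX) without a root in K.
--
-- q odd: there is no root iff ν = 4/λ + b² is a nonsquare, and (λ , b) ↦ (ν , b) is a bijection, so N = q n where n
-- counts the nonsquares of degree m over 𝔽_q. A nonsquare has degree m over 𝔽_q iff it has degree l over 𝔽_Q: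
-- otherwise it lies in 𝔽_{q^(m/2)}, all of whose elements are squares in K. Multiplication by a nonsquare of 𝔽_Q
-- (still a nonsquare in K, as l is odd) shows that half of the nonzero elements of degree l over 𝔽_Q are nonsquares.
--
-- q even: there is a root iff b = 0 or the absolute trace of 1/(λb²) vanishes. With T the trace from K to 𝔽_q, this
-- gives N = (q/2) n where n counts the μ = 1/λ of degree m over 𝔽_q with T μ ≠ 0. Elements of 𝔽_{q^(m/2)} have
-- T = 0, so again degree m over 𝔽_q may be replaced by degree l over 𝔽_Q. Translation by multiples of an element
-- of 𝔽_Q with T = 1 shows that T is equidistributed on the elements of degree l over 𝔽_Q.
--
-- Elements of degree d in K and d·|I(d; Q)| for d ∣ l satisfy the same recursion Σ_{d ∣ n} = Q^n. For the
-- polynomials it is obtained without constructing extensions of F: Σ deg P over the pairs (P , j) with P^j ∣ f is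
-- deg f by unique factorisation, and summing over all monic f of degree n gives n Q^n = Σ deg P · Q^(n - j deg P).
-- Subtracting Q times the identity for n - 1 leaves Q^n = Σ_{j deg P = n} deg P.

module Submission where

open import Defs
open import Level using (Level; 0ℓ)
open import Algebra.Bundles using (CommutativeRing; CommutativeMonoid)
import Algebra.Properties.AbelianGroup as AbelianGroupProperties
import Algebra.Properties.CommutativeMonoid.Mult as MonoidMult
import Algebra.Properties.CommutativeSemigroup as CommutativeSemigroupProperties
import Algebra.Properties.CommutativeSemiring.Binomial as Binomial
import Algebra.Properties.Monoid.Sum as MonoidSum
import Algebra.Properties.Ring as RingProperties
import Algebra.Properties.Semiring.Exp as SemiringExp
import Algebra.Properties.Semiring.Mult as SemiringMult
import Algebra.Properties.Semiring.Mult.TCOptimised as OptimisedMult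
import Algebra.Solver.Ring as RingSolver
import Algebra.Solver.Ring.AlmostCommutativeRing as ACR
open import Data.Bool.Base using (if_then_else_)
open import Data.Empty using (⊥-elim)
open import Data.Fin.Base as Fin using (Fin; zero; suc; toℕ; fromℕ; inject₁)
import Data.Fin.Properties as Finₚ
open import Data.Integer.Base as ℤ using (ℤ; 0ℤ; 1ℤ)
import Data.Integer.Properties as ℤₚ
open import Data.List.Base using (List; []; _∷_; _++_; map; length; concatMap)
open import Data.List.Relation.Unary.All using (All; []; _∷_)
open import Data.List.Relation.Unary.AllPairs using (AllPairs; []; _∷_)
open import Data.List.Relation.Unary.Any using (Any; here; there)
open import Data.Maybe.Base using (Maybe; just; nothing)
open import Data.Nat.Base as ℕ using (ℕ; zero; suc; NonZero; _!)
open import Data.Nat.Combinatorics using (nCk≡n!/k![n-k]!; k![n∸k]!∣n!; nCn≡1) renaming (_C_ to _choose_)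
open import Data.Nat.Divisibility
  using (_∣_; _∤_; _∣?_; divides; ∣-refl; ∣-trans; ∣⇒≤; m∣m*n; m%n≡0⇒n∣m)
open import Data.Nat.DivMod using (_/_; _%_; m≡m%n+[m/n]*n; m%n<n; m/n*n≡m)
open import Data.Nat.Induction using (<-rec)
open import Data.Nat.Primality using (Prime; euclidsLemma; prime[2]; ¬prime[0]; prime⇒irreducible; prime⇒nonTrivial)
import Data.Nat.Properties as ℕₚ
import Data.Nat.Solver as ℕSolver
open import Data.Product using (Σ; ∃; _×_; _,_; proj₁; proj₂)
import Data.Product.Properties as ×ₚ
open import Data.Sum.Base using (_⊎_; inj₁; inj₂; [_,_]′)
open import Data.Vec.Base using (Vec; []; _∷_; zipWith)
open import Data.Vec.Relation.Unary.All as VecAll using ([]; _∷_) renaming (All to VecAll)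
open import Function.Base using (_∘_)
open import Function.Bundles using (_↔_; Inverse)
open import Relation.Binary.Definitions using (DecidableEquality; tri<; tri≈; tri>)
open import Relation.Binary.PropositionalEquality hiding (setoid)
import Relation.Binary.Reasoning.Setoid as SetoidReasoning
open import Relation.Nullary using (Dec; does; yes; no; ¬_; contradiction)
open import Relation.Nullary.Decidable using (_×-dec_; _→-dec_; ¬?; map′)
open import Relation.Unary using (Decidable)

-- `F` and `K` are given by their cardinalities, with no map between them. All structure is
-- therefore found inside `K` by counting: a subfield is the fixed set of a power of Frobenius, root
-- bounds limit its size from above, and pigeonhole turns such bounds into equalities. `F` meets `K`
-- only in the equality of two numerical recursions. Both substitutions serve to decouple λ from b.
-- For q odd, 4/λ + b^2 arises from 1/λ by a scaling and a translation over F_q, which preserve the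
-- degree over F_q. For q even, b^2 lies in F_q and leaves the trace to F_q as a factor; since
-- squaring permutes F_q, w = T μ / b^2 can replace b. Averaging is the reason for passing to F_Q.
-- When m is even, every element of F_q is a square in K, or has T = 0, so multiplying or
-- translating by it changes nothing. F_Q does contain a nonsquare of K, or an element with T = 1,
-- because the degree l of K over F_Q is odd.

module IntegerSolver {c ℓ} (R : CommutativeRing c ℓ) where
  open CommutativeRing R renaming (refl to ≈-refl; sym to ≈-sym; trans to ≈-trans)
  open import Data.Integer.Base using (+_; -[1+_]; _⊖_)
  open OptimisedMult semiring using (1+×; ×-homo-+; ×1-homo-*) renaming (_×_ to _·_)
  open RingProperties ring using (-0#≈0#; -‿distribˡ-*; -‿distribʳ-*; -‿involutive)
  open AbelianGroupProperties +-abelianGroup using (⁻¹-∙-comm)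
  open SetoidReasoning setoid

  -- The optimised multiple makes `⟦ 1ℤ ⟧ℤ` reduce to `1#` itself, so that `con 1ℤ` can stand for
  -- `1#` in a solved equation.
  ⟦_⟧ℤ : ℤ → Carrier
  ⟦ + n ⟧ℤ      = n · 1#
  ⟦ -[1+ n ] ⟧ℤ = - (suc n · 1#)

  private
    ⟦⟧-⊖ : ∀ m n → ⟦ m ⊖ n ⟧ℤ ≈ m · 1# + - (n · 1#)
    ⟦⟧-⊖ m zero = begin
      m · 1#          ≈⟨ +-identityʳ _ ⟨
      m · 1# + 0#     ≈⟨ +-congˡ -0#≈0# ⟨
      m · 1# + - 0#   ∎
    ⟦⟧-⊖ zero (suc n) = ≈-sym (+-identityˡ _)
    ⟦⟧-⊖ (suc m) (suc n) = begin
      ⟦ suc m ⊖ suc n ⟧ℤ                     ≡⟨ cong ⟦_⟧ℤ (ℤₚ.[1+m]⊖[1+n]≡m⊖n m n) ⟩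
      ⟦ m ⊖ n ⟧ℤ                             ≈⟨ ⟦⟧-⊖ m n ⟩
      m · 1# + - (n · 1#)                    ≈⟨ +-identityˡ _ ⟨
      0# + (m · 1# + - (n · 1#))             ≈⟨ +-congʳ (-‿inverseʳ 1#) ⟨
      (1# + - 1#) + (m · 1# + - (n · 1#))    ≈⟨ +-assoc _ _ _ ⟩
      1# + (- 1# + (m · 1# + - (n · 1#)))    ≈⟨ +-congˡ (+-assoc _ _ _) ⟨
      1# + ((- 1# + m · 1#) + - (n · 1#))    ≈⟨ +-congˡ (+-congʳ (+-comm _ _)) ⟩
      1# + ((m · 1# + - 1#) + - (n · 1#))    ≈⟨ +-congˡ (+-assoc _ _ _) ⟩
      1# + (m · 1# + (- 1# + - (n · 1#)))    ≈⟨ +-assoc _ _ _ ⟨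
      1# + m · 1# + (- 1# + - (n · 1#))      ≈⟨ +-cong (≈-sym (1+× m 1#)) (⁻¹-∙-comm _ _) ⟩
      suc m · 1# + - (1# + n · 1#)           ≈⟨ +-congˡ (-‿cong (1+× n 1#)) ⟨
      suc m · 1# + - (suc n · 1#)            ∎

    ⟦⟧-neg : ∀ i → ⟦ ℤ.- i ⟧ℤ ≈ - ⟦ i ⟧ℤ
    ⟦⟧-neg (+ zero)    = ≈-sym -0#≈0#
    ⟦⟧-neg (+ suc n)   = ≈-refl
    ⟦⟧-neg -[1+ n ]    = ≈-sym (-‿involutive _)

    ⟦⟧-+ : ∀ i j → ⟦ i ℤ.+ j ⟧ℤ ≈ ⟦ i ⟧ℤ + ⟦ j ⟧ℤ
    ⟦⟧-+ (+ m)    (+ n)    = ×-homo-+ 1# m n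
    ⟦⟧-+ (+ m)    -[1+ n ] = ⟦⟧-⊖ m (suc n)
    ⟦⟧-+ -[1+ m ] (+ n)    = ≈-trans (⟦⟧-⊖ n (suc m)) (+-comm _ _)
    ⟦⟧-+ -[1+ m ] -[1+ n ] = begin
      - (suc (suc (m ℕ.+ n)) · 1#)         ≡⟨ cong (λ k → - (suc k · 1#)) (ℕₚ.+-suc m n) ⟨
      - ((suc m ℕ.+ suc n) · 1#)           ≈⟨ -‿cong (×-homo-+ 1# (suc m) (suc n)) ⟩
      - (suc m · 1# + suc n · 1#)          ≈⟨ ⁻¹-∙-comm _ _ ⟨
      - (suc m · 1#) + - (suc n · 1#)      ∎

    ⟦⟧-* : ∀ i j → ⟦ i ℤ.* j ⟧ℤ ≈ ⟦ i ⟧ℤ * ⟦ j ⟧ℤ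
    ⟦⟧-*⁺ : ∀ m j → ⟦ + m ℤ.* j ⟧ℤ ≈ ⟦ + m ⟧ℤ * ⟦ j ⟧ℤ
    ⟦⟧-*⁺ m (+ n) = ≈-trans (reflexive (cong ⟦_⟧ℤ (sym (ℤₚ.pos-* m n)))) (×1-homo-* m n)
    ⟦⟧-*⁺ m -[1+ n ] = begin
      ⟦ + m ℤ.* (ℤ.- (+ suc n)) ⟧ℤ       ≡⟨ cong ⟦_⟧ℤ (ℤₚ.neg-distribʳ-* (+ m) (+ suc n)) ⟨
      ⟦ ℤ.- (+ m ℤ.* (+ suc n)) ⟧ℤ       ≈⟨ ⟦⟧-neg (+ m ℤ.* + suc n) ⟩
      - ⟦ + m ℤ.* (+ suc n) ⟧ℤ           ≈⟨ -‿cong (⟦⟧-*⁺ m (+ suc n)) ⟩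
      - (m · 1# * suc n · 1#)            ≈⟨ -‿distribʳ-* _ _ ⟩
      m · 1# * - (suc n · 1#)            ∎
    ⟦⟧-* (+ m) j = ⟦⟧-*⁺ m j
    ⟦⟧-* -[1+ m ] j = begin
      ⟦ (ℤ.- (+ suc m)) ℤ.* j ⟧ℤ         ≡⟨ cong ⟦_⟧ℤ (ℤₚ.neg-distribˡ-* (+ suc m) j) ⟨
      ⟦ ℤ.- (+ suc m ℤ.* j) ⟧ℤ           ≈⟨ ⟦⟧-neg (+ suc m ℤ.* j) ⟩
      - ⟦ + suc m ℤ.* j ⟧ℤ               ≈⟨ -‿cong (⟦⟧-*⁺ (suc m) j) ⟩
      - (suc m · 1# * ⟦ j ⟧ℤ)            ≈⟨ -‿distribˡ-* _ _ ⟩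
      - (suc m · 1#) * ⟦ j ⟧ℤ            ∎

    -- The integers map to every commutative ring and have decidable equality, so coefficients taken
    -- from ℤ cancel by computation, in the field and in its polynomial ring alike.
    homomorphism : ℤ.+-*-rawRing ACR.-Raw-AlmostCommutative⟶ ACR.fromCommutativeRing R
    homomorphism = record
      { ⟦_⟧ = ⟦_⟧ℤ ; +-homo = ⟦⟧-+ ; *-homo = ⟦⟧-* ; -‿homo = ⟦⟧-neg
      ; 0-homo = ≈-refl ; 1-homo = ≈-refl }

    ⟦⟧-≟ : ∀ i j → Maybe (⟦ i ⟧ℤ ≈ ⟦ j ⟧ℤ)
    ⟦⟧-≟ i j with i ℤₚ.≟ j
    ... | yes i≡j = just (reflexive (cong ⟦_⟧ℤ i≡j))
    ... | no _    = nothing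

  open RingSolver ℤ.+-*-rawRing (ACR.fromCommutativeRing R) homomorphism ⟦⟧-≟ public
    using (Polynomial; solve; con; _:+_; _:*_; _:-_; :-_; _:=_; _:^_)

-- Counting in finite types: indicators, fibres, pigeonhole

module FiniteCounting where
  open import Data.Nat.Base using (_+_; _*_; _^_; _≤_; _<_; z≤n; s≤s)
  open ℕₚ hiding (_≟_)
  open CommutativeSemigroupProperties +-commutativeSemigroup using () renaming (interchange to +-interchange)

  private variable
    ℓ ℓ′ : Level
    A B : Set

  ∑ : List A → (A → ℕ) → ℕ
  ∑ [] f       = 0
  ∑ (x ∷ xs) f = f x + ∑ xs f

  ∑-cong : ∀ (xs : List A) {f g} → (∀ x → f x ≡ g x) → ∑ xs f ≡ ∑ xs g
  ∑-cong [] eq       = refl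
  ∑-cong (x ∷ xs) eq = cong₂ _+_ (eq x) (∑-cong xs eq)

  ∑-mono : ∀ (xs : List A) {f g} → (∀ x → f x ≤ g x) → ∑ xs f ≤ ∑ xs g
  ∑-mono [] le       = z≤n
  ∑-mono (x ∷ xs) le = +-mono-≤ (le x) (∑-mono xs le)

  ∑-+ : ∀ (xs : List A) f g → ∑ xs (λ x → f x + g x) ≡ ∑ xs f + ∑ xs g
  ∑-+ [] f g       = refl
  ∑-+ (x ∷ xs) f g = trans (cong (f x + g x +_) (∑-+ xs f g)) (+-interchange (f x) (g x) (∑ xs f) (∑ xs g))

  ∑-*ˡ : ∀ (xs : List A) c f → ∑ xs (λ x → c * f x) ≡ c * ∑ xs f
  ∑-*ˡ [] c f       = sym (*-zeroʳ c)
  ∑-*ˡ (x ∷ xs) c f = trans (cong (c * f x +_) (∑-*ˡ xs c f)) (sym (*-distribˡ-+ c (f x) (∑ xs f)))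

  ∑-*ʳ : ∀ (xs : List A) c f → ∑ xs (λ x → f x * c) ≡ ∑ xs f * c
  ∑-*ʳ xs c f = trans (∑-cong xs (λ x → *-comm (f x) c)) (trans (∑-*ˡ xs c f) (*-comm c (∑ xs f)))

  ∑-zero : ∀ (xs : List A) → ∑ xs (λ _ → 0) ≡ 0
  ∑-zero []       = refl
  ∑-zero (x ∷ xs) = ∑-zero xs

  ∑-swap : ∀ (xs : List A) (ys : List B) (f : A → B → ℕ) →
           ∑ xs (λ x → ∑ ys (f x)) ≡ ∑ ys (λ y → ∑ xs (λ x → f x y))
  ∑-swap [] ys f       = sym (∑-zero ys)
  ∑-swap (x ∷ xs) ys f = trans (cong (∑ ys (f x) +_) (∑-swap xs ys f)) (sym (∑-+ ys (f x) _))

  ∑-++ : ∀ (xs ys : List A) f → ∑ (xs ++ ys) f ≡ ∑ xs f + ∑ ys f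
  ∑-++ [] ys f       = refl
  ∑-++ (x ∷ xs) ys f = trans (cong (f x +_) (∑-++ xs ys f)) (sym (+-assoc (f x) _ _))

  ∑-map : ∀ (h : A → B) xs f → ∑ (map h xs) f ≡ ∑ xs (λ x → f (h x))
  ∑-map h [] f       = refl
  ∑-map h (x ∷ xs) f = cong (f (h x) +_) (∑-map h xs f)

  ∑-concatMap : ∀ (h : A → List B) xs f → ∑ (concatMap h xs) f ≡ ∑ xs (λ x → ∑ (h x) f)
  ∑-concatMap h [] f       = refl
  ∑-concatMap h (x ∷ xs) f = trans (∑-++ (h x) (concatMap h xs) f) (cong (∑ (h x) f +_) (∑-concatMap h xs f))

  ∑-length : ∀ (xs : List A) → ∑ xs (λ _ → 1) ≡ length xs
  ∑-length []       = refl
  ∑-length (x ∷ xs) = cong suc (∑-length xs)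

  ∑-positive : ∀ (xs : List A) f → 0 < ∑ xs f → ∃ λ x → 0 < f x
  ∑-positive (x ∷ xs) f 0<s with f x in eq
  ... | zero  = ∑-positive xs f 0<s
  ... | suc n = x , subst (0 <_) (sym eq) (s≤s z≤n)

  𝟙 : {X : Set ℓ} → Dec X → ℕ
  𝟙 d = if does d then 1 else 0

  module _ {X : Set ℓ} where
    𝟙-yes : (d : Dec X) → X → 𝟙 d ≡ 1
    𝟙-yes (yes _) x = refl
    𝟙-yes (no ¬x) x = contradiction x ¬x

    𝟙-no : (d : Dec X) → ¬ X → 𝟙 d ≡ 0
    𝟙-no (yes x) ¬x = contradiction x ¬x
    𝟙-no (no _)  ¬x = refl

    𝟙-≤1 : (d : Dec X) → 𝟙 d ≤ 1
    𝟙-≤1 (yes _) = s≤s z≤n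
    𝟙-≤1 (no _)  = z≤n

    𝟙-positive : (d : Dec X) → 0 < 𝟙 d → X
    𝟙-positive (yes x) _ = x

  module _ {X : Set ℓ} {Y : Set ℓ′} where
    𝟙-mono : (d : Dec X) (e : Dec Y) → (X → Y) → 𝟙 d ≤ 𝟙 e
    𝟙-mono (no _)  e       f = z≤n
    𝟙-mono (yes x) (yes _) f = s≤s z≤n
    𝟙-mono (yes x) (no ¬y) f = contradiction (f x) ¬y

    𝟙-× : (d : Dec X) (e : Dec Y) → 𝟙 (d ×-dec e) ≡ 𝟙 d * 𝟙 e
    𝟙-× (yes _) (yes _) = refl
    𝟙-× (yes _) (no _)  = refl
    𝟙-× (no _)  e       = refl

  𝟙-cong : {X : Set ℓ} {Y : Set ℓ′} (d : Dec X) (e : Dec Y) → (X → Y) → (Y → X) → 𝟙 d ≡ 𝟙 e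
  𝟙-cong d e f g = ≤-antisym (𝟙-mono d e f) (𝟙-mono e d g)

  -- Completeness and absence of repetitions are one equation, `once`, in the form in which double
  -- counting uses it.
  record Finite (A : Set) : Set where
    infix 4 _≟_
    field
      elements : List A
      _≟_      : DecidableEquality A
      once     : ∀ y → ∑ elements (λ x → 𝟙 (x ≟ y)) ≡ 1

    # : {P : A → Set} → Decidable P → ℕ
    # P? = ∑ elements (λ x → 𝟙 (P? x))

    size : ℕ
    size = ∑ elements (λ _ → 1)

    pick : ∀ f y → ∑ elements (λ x → 𝟙 (x ≟ y) * f x) ≡ f y
    pick f y = begin
      ∑ elements (λ x → 𝟙 (x ≟ y) * f x)  ≡⟨ ∑-cong elements (λ x → at x (x ≟ y)) ⟩
      ∑ elements (λ x → 𝟙 (x ≟ y) * f y)  ≡⟨ ∑-*ʳ elements (f y) _ ⟩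
      ∑ elements (λ x → 𝟙 (x ≟ y)) * f y  ≡⟨ cong (_* f y) (once y) ⟩
      1 * f y                              ≡⟨ *-identityˡ (f y) ⟩
      f y                                  ∎
      where
      open ≡-Reasoning
      at : ∀ x (d : Dec (x ≡ y)) → 𝟙 d * f x ≡ 𝟙 d * f y
      at x (yes refl) = refl
      at x (no _)     = refl

    term≤∑ : ∀ f y → f y ≤ ∑ elements f
    term≤∑ f y = subst (_≤ ∑ elements f) (pick f y)
      (∑-mono elements (λ x → subst (𝟙 (x ≟ y) * f x ≤_) (*-identityˡ (f x)) (*-monoˡ-≤ (f x) (𝟙-≤1 (x ≟ y)))))

    #-cong : {P Q : A → Set} (P? : Decidable P) (Q? : Decidable Q) → (∀ x → P x → Q x) →
        (∀ x → Q x → P x) → # P? ≡ # Q?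
    #-cong P? Q? f g = ∑-cong elements (λ x → 𝟙-cong (P? x) (Q? x) (f x) (g x))

    #-mono : {P Q : A → Set} (P? : Decidable P) (Q? : Decidable Q) → (∀ x → P x → Q x) → # P? ≤ # Q?
    #-mono P? Q? f = ∑-mono elements (λ x → 𝟙-mono (P? x) (Q? x) (f x))

    #-all : {P : A → Set} (P? : Decidable P) → (∀ x → P x) → # P? ≡ size
    #-all P? p = ∑-cong elements (λ x → 𝟙-yes (P? x) (p x))

    #-none : {P : A → Set} (P? : Decidable P) → (∀ x → ¬ P x) → # P? ≡ 0
    #-none P? ¬p = trans (∑-cong elements (λ x → 𝟙-no (P? x) (¬p x))) (∑-zero elements)

    #-positive : {P : A → Set} (P? : Decidable P) → ∃ P → 0 < # P?
    #-positive P? (x , px) = subst (_≤ # P?) (𝟙-yes (P? x) px) (term≤∑ (λ x → 𝟙 (P? x)) x)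

    witness : {P : A → Set} (P? : Decidable P) → 0 < # P? → ∃ P
    witness P? pos with ∑-positive elements (λ x → 𝟙 (P? x)) pos
    ... | x , 0<𝟙 = x , 𝟙-positive (P? x) 0<𝟙

    ∃? : {P : A → Set} → Decidable P → Dec (∃ P)
    ∃? P? = map′ (witness P?) (#-positive P?) (0 <? # P?)

    #-split : {P Q : A → Set} (P? : Decidable P) (Q? : Decidable Q) →
              # P? ≡ # (λ x → P? x ×-dec Q? x) + # (λ x → P? x ×-dec ¬? (Q? x))
    #-split P? Q? = trans (∑-cong elements at) (∑-+ elements _ _)
      where
      at : ∀ x → 𝟙 (P? x) ≡ 𝟙 (P? x ×-dec Q? x) + 𝟙 (P? x ×-dec ¬? (Q? x))
      at x with P? x | Q? x
      ... | yes _ | yes _ = refl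
      ... | yes _ | no _  = refl
      ... | no _  | yes _ = refl
      ... | no _  | no _  = refl

    #-remove : {P : A → Set} (P? : Decidable P) {y : A} → P y → # P? ≡ suc (# (λ x → P? x ×-dec ¬? (x ≟ y)))
    #-remove P? {y} py = trans (#-split P? (_≟ y)) (cong (_+ # (λ x → P? x ×-dec ¬? (x ≟ y))) (trans
      (#-cong (λ x → P? x ×-dec (x ≟ y)) (_≟ y) (λ _ → proj₂) (λ { _ refl → py , refl })) (once y)))

    #-unique : {P : A → Set} (P? : Decidable P) → (∀ x y → P x → P y → x ≡ y) → # P? ≤ 1
    #-unique P? uniq with ∃? P?
    ... | yes (x , px) = subst (# P? ≤_) (once x) (#-mono P? (_≟ x) (λ y py → uniq y x py px))
    ... | no ¬∃ = subst (_≤ 1) (sym (#-none P? (λ x px → ¬∃ (x , px)))) z≤n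

  open Finite

  module _ (FA : Finite A) (FB : Finite B) where
    private
      module A = Finite FA
      module B = Finite FB

    fibre? : {P : A → Set} → Decidable P → (φ : A → B) (b : B) → Decidable (λ a → P a × φ a ≡ b)
    fibre? P? φ b a = P? a ×-dec (φ a B.≟ b)

    ∑-fibres : {P : A → Set} (P? : Decidable P) (φ : A → B) →
               A.# P? ≡ ∑ B.elements (λ b → A.# (fibre? P? φ b))
    ∑-fibres P? φ = begin
      ∑ A.elements (λ a → 𝟙 (P? a))
        ≡⟨ ∑-cong A.elements (λ a → B.pick (λ _ → 𝟙 (P? a)) (φ a)) ⟨
      ∑ A.elements (λ a → ∑ B.elements (λ b → 𝟙 (b B.≟ φ a) * 𝟙 (P? a)))
        ≡⟨ ∑-swap A.elements B.elements _ ⟩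
      ∑ B.elements (λ b → ∑ A.elements (λ a → 𝟙 (b B.≟ φ a) * 𝟙 (P? a)))
        ≡⟨ ∑-cong B.elements (λ b → ∑-cong A.elements (λ a → trans (*-comm (𝟙 (b B.≟ φ a)) _)
             (trans (cong (𝟙 (P? a) *_) (𝟙-cong (b B.≟ φ a) (φ a B.≟ b) sym sym)) (sym (𝟙-× (P? a) (φ a B.≟ b)))))) ⟩
      ∑ B.elements (λ b → A.# (fibre? P? φ b)) ∎
      where open ≡-Reasoning

    module _ {P : A → Set} {R : B → Set} (P? : Decidable P) (R? : Decidable R)
             (φ : A → B) (into : ∀ a → P a → R (φ a)) where

      #-fibres-≤ : ∀ c → (∀ b → R b → A.# (fibre? P? φ b) ≤ c) → A.# P? ≤ B.# R? * c
      #-fibres-≤ c bound = ≤-trans (≤-reflexive (∑-fibres P? φ))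
          (≤-trans (∑-mono B.elements at) (≤-reflexive (∑-*ʳ B.elements c _)))
        where
        at : ∀ b → A.# (fibre? P? φ b) ≤ 𝟙 (R? b) * c
        at b with R? b
        ... | yes rb = ≤-trans (bound b rb) (≤-reflexive (sym (*-identityˡ c)))
        ... | no ¬rb = ≤-reflexive (A.#-none (fibre? P? φ b) (λ { a (pa , refl) → ¬rb (into a pa) }))

      #-injection : (∀ a a′ → P a → P a′ → φ a ≡ φ a′ → a ≡ a′) → A.# P? ≤ B.# R?
      #-injection inj = ≤-trans
        (#-fibres-≤ 1 (λ b _ → A.#-unique (fibre? P? φ b)
          (λ { a a′ (pa , e) (pa′ , e′) → inj a a′ pa pa′ (trans e (sym e′)) })))
        (≤-reflexive (*-identityʳ _))

  -- Pigeonhole: P is too large to miss a point of R.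
  module _ (FA : Finite A) (FB : Finite B) {P : A → Set} {R : B → Set}
           (P? : Decidable P) (R? : Decidable R) (φ : A → B) (into : ∀ a → P a → R (φ a)) where
    private
      module A = Finite FA
      module B = Finite FB

    #-surjective : ∀ c → 0 < c → (∀ b → R b → A.# (fibre? FA FB P? φ b) ≤ c) → B.# R? * c ≤ A.# P? →
                   ∀ b → R b → ∃ λ a → P a × φ a ≡ b
    #-surjective c 0<c bound large b rb with A.∃? (fibre? FA FB P? φ b)
    ... | yes found = found
    ... | no missed = ⊥-elim (<-irrefl refl (≤-trans (≤-trans
        (≤-trans strict (≤-reflexive (cong (_* c) (sym (B.#-remove R? rb))))) large) small))
      where
      R′? = λ x → R? x ×-dec ¬? (x B.≟ b)
      small : A.# P? ≤ B.# R′? * c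
      small = #-fibres-≤ FA FB P? R′? φ (λ a pa → into a pa , λ eq → missed (a , pa , eq)) c
          (λ b′ r → bound b′ (proj₁ r))
      strict : suc (B.# R′? * c) ≤ suc (B.# R′?) * c
      strict = +-monoˡ-≤ (B.# R′? * c) 0<c

  module _ (FA : Finite A) (FB : Finite B) {P : A → Set} {R : B → Set}
           (P? : Decidable P) (R? : Decidable R) where
    private
      module A = Finite FA
      module B = Finite FB

    #-bijection : (φ : A → B) (ψ : B → A) → (∀ a → P a → R (φ a)) → (∀ b → R b → P (ψ b)) →
                  (∀ a → P a → ψ (φ a) ≡ a) → (∀ b → R b → φ (ψ b) ≡ b) → A.# P? ≡ B.# R?
    #-bijection φ ψ into back ψφ φψ = ≤-antisym
      (#-injection FA FB P? R? φ into (λ a a′ pa pa′ eq → trans (sym (ψφ a pa)) (trans (cong ψ eq) (ψφ a′ pa′))))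
      (#-injection FB FA R? P? ψ back (λ b b′ rb rb′ eq → trans (sym (φψ b rb)) (trans (cong φ eq) (φψ b′ rb′))))

  Fin-finite : ∀ n → Finite (Fin n)
  Fin-finite n = record { elements = go n ; _≟_ = Finₚ._≟_ ; once = go-once n }
    where
    go : ∀ n → List (Fin n)
    go zero    = []
    go (suc n) = zero ∷ map suc (go n)
    go-once : ∀ n y → ∑ (go n) (λ x → 𝟙 (x Finₚ.≟ y)) ≡ 1
    go-once (suc n) zero    = cong suc (trans (∑-map suc (go n) _) (∑-zero (go n)))
    go-once (suc n) (suc y) = trans (∑-map suc (go n) _)
      (trans (∑-cong (go n) (λ x → 𝟙-cong (suc x Finₚ.≟ suc y) (x Finₚ.≟ y) Finₚ.suc-injective (cong suc)))
          (go-once n y))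

  Fin-size : ∀ n → size (Fin-finite n) ≡ n
  Fin-size zero    = refl
  Fin-size (suc n) = cong suc (trans (∑-map suc (elements (Fin-finite n)) _) (Fin-size n))

  ↔-finite : Finite A → A ↔ B → Finite B
  ↔-finite {A} {B} FA A↔B = record { elements = map to (elements FA) ; _≟_ = _≟ᴮ_ ; once = onceᴮ }
    where
    open Inverse A↔B
    _≟ᴮ_ : DecidableEquality B
    x ≟ᴮ y = map′ (λ eq → trans (sym (strictlyInverseˡ x)) (trans (cong to eq) (strictlyInverseˡ y))) (cong from)
                  (_≟_ FA (from x) (from y))
    onceᴮ : ∀ y → ∑ (map to (elements FA)) (λ x → 𝟙 (x ≟ᴮ y)) ≡ 1
    onceᴮ y = trans (∑-map to (elements FA) _) (trans
      (∑-cong (elements FA) (λ x → 𝟙-cong (to x ≟ᴮ y) (_≟_ FA x (from y))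
         (λ eq → trans (sym (strictlyInverseʳ x)) (cong from eq)) (λ eq → trans (cong to eq) (strictlyInverseˡ y))))
      (once FA (from y)))

  ↔-size : (FA : Finite A) (A↔B : A ↔ B) → size (↔-finite FA A↔B) ≡ size FA
  ↔-size FA A↔B = ∑-map (Inverse.to A↔B) (elements FA) _

  ×-finite : Finite A → Finite B → Finite (A × B)
  ×-finite {A} {B} FA FB = record
    { elements = concatMap (λ a → map (a ,_) (elements FB)) (elements FA)
    ; _≟_      = _≟ˣ_
    ; once     = onceˣ }
    where
    _≟ˣ_ : DecidableEquality (A × B)
    _≟ˣ_ = ×ₚ.≡-dec (_≟_ FA) (_≟_ FB)
    onceˣ : ∀ y → ∑ (concatMap (λ a → map (a ,_) (elements FB)) (elements FA)) (λ x → 𝟙 (x ≟ˣ y)) ≡ 1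
    onceˣ y@(a₀ , b₀) = begin
      _ ≡⟨ ∑-concatMap _ (elements FA) _ ⟩
      _ ≡⟨ ∑-cong (elements FA) (λ a → ∑-map (a ,_) (elements FB) _) ⟩
      ∑ (elements FA) (λ a → ∑ (elements FB) (λ b → 𝟙 ((a , b) ≟ˣ y)))
        ≡⟨ ∑-cong (elements FA) (λ a → trans (∑-cong (elements FB) (λ b →
             trans (𝟙-cong ((a , b) ≟ˣ y) (_≟_ FA a a₀ ×-dec _≟_ FB b b₀) (λ { refl → refl , refl })
                 (λ { (refl , refl) → refl }))
                   (𝟙-× (_≟_ FA a a₀) (_≟_ FB b b₀)))) (trans
                       (∑-*ˡ (elements FB) (𝟙 (_≟_ FA a a₀)) (λ b → 𝟙 (_≟_ FB b b₀)))
                       (trans (cong (𝟙 (_≟_ FA a a₀) *_) (once FB b₀)) (*-identityʳ _)))) ⟩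
      ∑ (elements FA) (λ a → 𝟙 (_≟_ FA a a₀)) ≡⟨ once FA a₀ ⟩
      1 ∎
      where open ≡-Reasoning

  ∑-× : (FA : Finite A) (FB : Finite B) (f : A × B → ℕ) →
        ∑ (elements (×-finite FA FB)) f ≡ ∑ (elements FA) (λ a → ∑ (elements FB) (λ b → f (a , b)))
  ∑-× FA FB f = trans (∑-concatMap _ (elements FA) _) (∑-cong (elements FA) (λ a → ∑-map (a ,_) (elements FB) _))

  #-× : (FA : Finite A) (FB : Finite B) {P : A → Set} {R : B → Set} (P? : Decidable P) (R? : Decidable R) →
        # (×-finite FA FB) (λ x → P? (proj₁ x) ×-dec R? (proj₂ x)) ≡ # FA P? * # FB R?
  #-× FA FB P? R? = trans (∑-× FA FB _) (trans
    (∑-cong (elements FA) (λ a → trans (∑-cong (elements FB) (λ b → 𝟙-× (P? a) (R? b)))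
        (∑-*ˡ (elements FB) (𝟙 (P? a)) (λ b → 𝟙 (R? b)))))
    (∑-*ʳ (elements FA) (# FB R?) (λ a → 𝟙 (P? a))))

  Vec-finite : Finite A → ∀ n → Finite (Vec A n)
  Vec-finite FA zero = record
    { elements = [] ∷ [] ; _≟_ = λ { [] [] → yes refl } ; once = λ { [] → refl } }
  Vec-finite {A} FA (suc n) = ↔-finite (×-finite FA (Vec-finite FA n)) (record
    { to = λ { (a , v) → a ∷ v } ; from = λ { (a ∷ v) → a , v }
    ; to-cong = cong _ ; from-cong = cong _
    ; inverse = (λ { {_ ∷ _} refl → refl }) , λ { {_} refl → refl } })

  ∑-Vec : (FA : Finite A) → ∀ n (f : Vec A (suc n) → ℕ) →
          ∑ (elements (Vec-finite FA (suc n))) f ≡ ∑ (elements FA)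
              (λ a → ∑ (elements (Vec-finite FA n)) (λ v → f (a ∷ v)))
  ∑-Vec FA n f = trans (∑-map _ (elements (×-finite FA (Vec-finite FA n))) f) (∑-× FA (Vec-finite FA n) _)

  Vec-size : (FA : Finite A) → ∀ n → size (Vec-finite FA n) ≡ size FA ^ n
  Vec-size FA zero    = refl
  Vec-size FA (suc n) = trans (∑-Vec FA n _) (trans
    (∑-cong (elements FA) (λ _ → trans (Vec-size FA n) (sym (*-identityˡ _))))
    (∑-*ʳ (elements FA) (size FA ^ n) (λ _ → 1)))

  module _ {x p r} {X : Set x} {_≈_ : X → X → Set r} {P : X → Set p} (FA : Finite A) {R : A → Set} (R? : Decidable R)
           (code : ∀ x → P x → A) (code-R : ∀ x px → R (code x px))
           (code-inj : ∀ x y px py → code x px ≡ code y py → x ≈ y)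
           (code-surj : ∀ a → R a → ∃ λ x → P x × (∀ y py → x ≈ y → code y py ≡ a)) where
    private
      module A = Finite FA

      codes : ∀ xs → All P xs → List A
      codes [] []             = []
      codes (x ∷ xs) (px ∷ pxs) = code x px ∷ codes xs pxs

      occ : A → ∀ xs → All P xs → ℕ
      occ a xs pxs = ∑ (codes xs pxs) (λ c → 𝟙 (a A.≟ c))

      occ-none : ∀ a x px → code x px ≡ a → ∀ xs pxs → All (λ y → ¬ (x ≈ y)) xs → occ a xs pxs ≡ 0
      occ-none a x px eq [] [] [] = refl
      occ-none a x px eq (y ∷ ys) (py ∷ pys) (x≉y ∷ x≉ys) = cong₂ _+_
        (𝟙-no (a A.≟ code y py) (λ eq′ → x≉y (code-inj x y px py (trans eq eq′))))
        (occ-none a x px eq ys pys x≉ys)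

      occ≤1 : ∀ a xs pxs → AllPairs (λ x y → ¬ (x ≈ y)) xs → occ a xs pxs ≤ 1
      occ≤1 a [] [] [] = z≤n
      occ≤1 a (x ∷ xs) (px ∷ pxs) (x≉xs ∷ u) with a A.≟ code x px
      ... | yes eq = s≤s (≤-reflexive (occ-none a x px (sym eq) xs pxs x≉xs))
      ... | no _   = occ≤1 a xs pxs u

      occ≥1 : ∀ a x → (∀ y py → x ≈ y → code y py ≡ a) → ∀ xs pxs → Any (x ≈_) xs → 1 ≤ occ a xs pxs
      occ≥1 a x h (y ∷ ys) (py ∷ pys) (here x≈y) = ≤-trans (≤-reflexive
          (sym (𝟙-yes (a A.≟ code y py) (sym (h y py x≈y))))) (m≤m+n _ _)
      occ≥1 a x h (y ∷ ys) (py ∷ pys) (there any) = ≤-trans (occ≥1 a x h ys pys any) (m≤n+m _ _)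

      occ-outside : ∀ a → ¬ R a → ∀ xs pxs → occ a xs pxs ≡ 0
      occ-outside a ¬ra [] [] = refl
      occ-outside a ¬ra (x ∷ xs) (px ∷ pxs) = cong₂ _+_
        (𝟙-no (a A.≟ code x px) (λ eq → ¬ra (subst R (sym eq) (code-R x px)))) (occ-outside a ¬ra xs pxs)

      length-codes : ∀ xs pxs → length (codes xs pxs) ≡ length xs
      length-codes [] []               = refl
      length-codes (x ∷ xs) (px ∷ pxs) = cong suc (length-codes xs pxs)

    -- Double counting of the pairs of a list entry and an element of `A` equal to its code:
    -- `code-inj` and the distinctness of the entries allow at most one entry for each `a`,
    -- completeness of the list supplies one when `R a` holds. Only codes are ever compared, since
    -- `P` and `_≈_` need not be decidable. A code may depend on the proof of `P`, hence the
    -- uniformity demanded by `code-surj`.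
    HasSize-# : ∀ {n} → HasSize _≈_ P n → n ≡ A.# R?
    HasSize-# {n} (xs , len , u , pxs , complete) = begin
      n                                         ≡⟨ len ⟨
      length xs                                 ≡⟨ length-codes xs pxs ⟨
      length cs                                 ≡⟨ ∑-length cs ⟨
      ∑ cs (λ _ → 1)                            ≡⟨ ∑-cong cs (λ c → once FA c) ⟨
      ∑ cs (λ c → ∑ A.elements (λ a → 𝟙 (a A.≟ c)))  ≡⟨ ∑-swap cs A.elements _ ⟩
      ∑ A.elements (λ a → occ a xs pxs)         ≡⟨ ∑-cong A.elements at ⟩
      A.# R?                                    ∎
      where
      open ≡-Reasoning
      cs = codes xs pxs
      at : ∀ a → occ a xs pxs ≡ 𝟙 (R? a)
      at a with R? a
      ... | no ¬ra = occ-outside a ¬ra xs pxs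
      ... | yes ra with code-surj a ra
      ...   | x , px , h = ≤-antisym (occ≤1 a xs pxs u) (occ≥1 a x h xs pxs (complete x px))

open FiniteCounting

-- Sums over a finite type in a commutative monoid

module BigOperator {c} (M : CommutativeMonoid c 0ℓ) {A : Set} (FA : Finite A) where
  open CommutativeMonoid M renaming (Carrier to X; refl to ≈-refl; sym to ≈-sym; trans to ≈-trans)
  open MonoidMult M using (×-homo-+; ×-congˡ) renaming (_×_ to _·_)
  open CommutativeSemigroupProperties commutativeSemigroup using (interchange)
  open Finite FA
  open import Relation.Binary.Reasoning.Setoid setoid

  ⨁ : List A → (A → X) → X
  ⨁ [] f       = ε
  ⨁ (x ∷ xs) f = f x ∙ ⨁ xs f

  ⨁-cong : ∀ xs {f g} → (∀ x → f x ≈ g x) → ⨁ xs f ≈ ⨁ xs g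
  ⨁-cong [] eq       = ≈-refl
  ⨁-cong (x ∷ xs) eq = ∙-cong (eq x) (⨁-cong xs eq)

  ⨁-ε : ∀ xs → ⨁ xs (λ _ → ε) ≈ ε
  ⨁-ε []       = ≈-refl
  ⨁-ε (x ∷ xs) = ≈-trans (identityˡ _) (⨁-ε xs)

  ⨁-∙ : ∀ xs f g → ⨁ xs (λ x → f x ∙ g x) ≈ ⨁ xs f ∙ ⨁ xs g
  ⨁-∙ [] f g       = ≈-sym (identityˡ ε)
  ⨁-∙ (x ∷ xs) f g = ≈-trans (∙-congˡ (⨁-∙ xs f g)) (interchange _ _ _ _)

  ⨁-swap : ∀ xs ys (f : A → A → X) → ⨁ xs (λ x → ⨁ ys (f x)) ≈ ⨁ ys (λ y → ⨁ xs (λ x → f x y))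
  ⨁-swap [] ys f       = ≈-sym (⨁-ε ys)
  ⨁-swap (x ∷ xs) ys f = ≈-trans (∙-congˡ (⨁-swap xs ys f)) (≈-sym (⨁-∙ ys _ _))

  ⨁-multiple : ∀ xs (h : A → ℕ) a → ⨁ xs (λ x → h x · a) ≈ ∑ xs h · a
  ⨁-multiple [] h a       = ≈-refl
  ⨁-multiple (x ∷ xs) h a = ≈-trans (∙-congˡ (⨁-multiple xs h a)) (≈-sym (×-homo-+ a (h x) (∑ xs h)))

  ⨁-pick : ∀ (f : A → X) y → ⨁ elements (λ x → 𝟙 (x ≟ y) · f x) ≈ f y
  ⨁-pick f y = begin
    ⨁ elements (λ x → 𝟙 (x ≟ y) · f x)  ≈⟨ ⨁-cong elements (λ x → at x (x ≟ y)) ⟩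
    ⨁ elements (λ x → 𝟙 (x ≟ y) · f y)  ≈⟨ ⨁-multiple elements _ (f y) ⟩
    ∑ elements (λ x → 𝟙 (x ≟ y)) · f y  ≡⟨ cong (_· f y) (once y) ⟩
    f y ∙ ε                              ≈⟨ identityʳ (f y) ⟩
    f y                                  ∎
    where
    at : ∀ x (d : Dec (x ≡ y)) → 𝟙 d · f x ≈ 𝟙 d · f y
    at x (yes refl) = ≈-refl
    at x (no _)     = ≈-refl

  -- Each `f (φ x)` is expanded as a sum over all y of `f y` weighted by the indicator of y = φ x.
  -- After exchanging the sums the same indicator reads x = ψ y and picks out one x for each y.
  ⨁-reindex : (φ ψ : A → A) → (∀ x → ψ (φ x) ≡ x) → (∀ x → φ (ψ x) ≡ x) →
              ∀ (f : A → X) → ⨁ elements (f ∘ φ) ≈ ⨁ elements f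
  ⨁-reindex φ ψ ψφ φψ f = begin
    ⨁ elements (f ∘ φ)
      ≈⟨ ⨁-cong elements (λ x → ≈-sym (⨁-pick f (φ x))) ⟩
    ⨁ elements (λ x → ⨁ elements (λ y → 𝟙 (y ≟ φ x) · f y))
      ≈⟨ ⨁-swap elements elements _ ⟩
    ⨁ elements (λ y → ⨁ elements (λ x → 𝟙 (y ≟ φ x) · f y))
      ≈⟨ ⨁-cong elements (λ y → ⨁-cong elements (λ x → ×-congˡ (𝟙-cong (y ≟ φ x) (x ≟ ψ y)
           (λ { refl → sym (ψφ x) }) (λ { refl → sym (φψ y) })))) ⟩
    ⨁ elements (λ y → ⨁ elements (λ x → 𝟙 (x ≟ ψ y) · f y))
      ≈⟨ ⨁-cong elements (λ y → ⨁-pick (λ _ → f y) (ψ y)) ⟩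
    ⨁ elements f ∎

-- Binomial coefficients modulo a prime

prime∤! : ∀ {p} → Prime p → ∀ k → k ℕ.< p → p ∤ k !
prime∤! pp zero k<p p∣1 = ℕₚ.<⇒≱ (ℕ.nonTrivial⇒n>1 _ {{prime⇒nonTrivial pp}}) (∣⇒≤ p∣1)
prime∤! pp (suc k) k<p p∣k! with euclidsLemma (suc k) (k !) pp p∣k!
... | inj₁ p∣1+k = ℕₚ.<⇒≱ k<p (∣⇒≤ p∣1+k)
... | inj₂ p∣k!′ = prime∤! pp k (ℕₚ.<-trans (ℕₚ.n<1+n k) k<p) p∣k!′

-- The prime divides `p !` but neither `k !` nor `(p ∸ k) !`.
prime∣C : ∀ {p} → Prime p → ∀ k → 0 ℕ.< k → k ℕ.< p → p ∣ (p choose k)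
prime∣C {p} pp k 0<k k<p with euclidsLemma (p choose k) (k ! ℕ.* (p ℕ.∸ k) !) pp p∣product
  where
  instance _ = k ℕₚ.!* (p ℕ.∸ k) !≢0
  product≡p! : (p choose k) ℕ.* (k ! ℕ.* (p ℕ.∸ k) !) ≡ p !
  product≡p! = trans (cong (ℕ._* (k ! ℕ.* (p ℕ.∸ k) !)) (nCk≡n!/k![n-k]! (ℕₚ.<⇒≤ k<p)))
      (m/n*n≡m (k![n∸k]!∣n! (ℕₚ.<⇒≤ k<p)))
  p∣p! : p ∣ p !
  p∣p! = n∣n! (ℕₚ.<-trans 0<k k<p)
    where
    n∣n! : ∀ {n} → 0 ℕ.< n → n ∣ n !
    n∣n! {suc n} _ = m∣m*n (n !)
  p∣product : p ∣ (p choose k) ℕ.* (k ! ℕ.* (p ℕ.∸ k) !)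
  p∣product = subst (p ∣_) (sym product≡p!) p∣p!
... | inj₁ p∣C = p∣C
... | inj₂ p∣k!j! with euclidsLemma (k !) ((p ℕ.∸ k) !) pp p∣k!j!
...   | inj₁ p∣k! = contradiction p∣k! (prime∤! pp k k<p)
...   | inj₂ p∣j! = contradiction p∣j! (prime∤! pp (p ℕ.∸ k) (ℕₚ.∸-monoʳ-< 0<k (ℕₚ.<⇒≤ k<p)))

-- Finite fields: root bounds, Fermat, characteristic, Frobenius

module Field (K : FiniteField) where
  open FiniteField K public
  open FieldDefs K public

  ring : CommutativeRing 0ℓ 0ℓ
  ring = record { isCommutativeRing = isCommutativeRing }

  open CommutativeRing ring public using
    (_-_; +-assoc; +-comm; +-identityˡ; +-identityʳ; *-assoc; *-comm; *-identityˡ; *-identityʳ;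
     zeroˡ; zeroʳ; distribˡ; distribʳ; -‿inverseˡ; -‿inverseʳ)
  open IntegerSolver ring public

  abstract
    finite : Finite Carrier
    finite = ↔-finite (Fin-finite card) enum

    size≡card : Finite.size finite ≡ card
    size≡card = trans (↔-size (Fin-finite card) enum) (Fin-size card)

  open Finite finite public

  -- Made total by the value 0 at 0, so that inverses can be written before nonvanishing is known;
  -- the laws below assume it.
  _⁻¹ : Carrier → Carrier
  x ⁻¹ with x ≟ 0#
  ... | yes _  = 0#
  ... | no x≢0 = proj₁ (inverse x x≢0)

  *-inverseʳ : ∀ {x} → ¬ x ≡ 0# → x * x ⁻¹ ≡ 1#
  *-inverseʳ {x} x≢0 with x ≟ 0#
  ... | yes x≡0 = contradiction x≡0 x≢0
  ... | no x≢0′ = proj₂ (inverse x x≢0′)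

  *-inverseˡ : ∀ {x} → ¬ x ≡ 0# → x ⁻¹ * x ≡ 1#
  *-inverseˡ x≢0 = trans (*-comm _ _) (*-inverseʳ x≢0)

  inverse-cancelˡ : ∀ {x} y → ¬ x ≡ 0# → x ⁻¹ * (x * y) ≡ y
  inverse-cancelˡ y x≢0 = trans (sym (*-assoc _ _ y)) (trans (cong (_* y) (*-inverseˡ x≢0)) (*-identityˡ y))

  *-cancelˡ : ∀ {x y z} → ¬ x ≡ 0# → x * y ≡ x * z → y ≡ z
  *-cancelˡ {x} {y} {z} x≢0 eq =
    trans (sym (inverse-cancelˡ y x≢0)) (trans (cong (x ⁻¹ *_) eq) (inverse-cancelˡ z x≢0))

  integral : ∀ {x y} → x * y ≡ 0# → x ≡ 0# ⊎ y ≡ 0#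
  integral {x} {y} xy≡0 with x ≟ 0#
  ... | yes x≡0 = inj₁ x≡0
  ... | no x≢0  = inj₂ (*-cancelˡ x≢0 (trans xy≡0 (sym (zeroʳ x))))

  *-nonzero : ∀ {x y} → ¬ x ≡ 0# → ¬ y ≡ 0# → ¬ x * y ≡ 0#
  *-nonzero x≢0 y≢0 xy≡0 = [ x≢0 , y≢0 ]′ (integral xy≡0)

  ⁻¹-nonzero : ∀ {x} → ¬ x ≡ 0# → ¬ x ⁻¹ ≡ 0#
  ⁻¹-nonzero {x} x≢0 eq = 0≢1 (trans (sym (zeroʳ x)) (trans (cong (x *_) (sym eq)) (*-inverseʳ x≢0)))

  ⁻¹-involutive : ∀ {x} → ¬ x ≡ 0# → (x ⁻¹) ⁻¹ ≡ x
  ⁻¹-involutive x≢0 = *-cancelˡ (⁻¹-nonzero x≢0) (trans (*-inverseʳ (⁻¹-nonzero x≢0)) (sym (*-inverseˡ x≢0)))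

  x-y≡0⇒x≡y : ∀ {x y} → x - y ≡ 0# → x ≡ y
  x-y≡0⇒x≡y {x} {y} eq = trans (solve 2 (λ x y → x := (x :- y) :+ y) refl x y)
      (trans (cong (_+ y) eq) (+-identityˡ y))

  x≡y⇒x-y≡0 : ∀ {x y} → x ≡ y → x - y ≡ 0#
  x≡y⇒x-y≡0 refl = -‿inverseʳ _

  +-cancelʳ : ∀ {x y} z → x + z ≡ y + z → x ≡ y
  +-cancelʳ {x} {y} z eq = trans (solve 2 (λ x z → x := (x :+ z) :- z) refl x z)
    (trans (cong (_- z) eq) (solve 2 (λ y z → (y :+ z) :- z := y) refl y z))

  ^-+ : ∀ x m n → x ^ᶠ (m ℕ.+ n) ≡ x ^ᶠ m * x ^ᶠ n
  ^-+ x zero n    = sym (*-identityˡ _)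
  ^-+ x (suc m) n = trans (cong (x *_) (^-+ x m n)) (sym (*-assoc _ _ _))

  1^ : ∀ n → 1# ^ᶠ n ≡ 1#
  1^ zero    = refl
  1^ (suc n) = trans (*-identityˡ _) (1^ n)

  0^ : ∀ n → 0 ℕ.< n → 0# ^ᶠ n ≡ 0#
  0^ (suc n) _ = zeroˡ _

  ^-distrib-* : ∀ x y n → (x * y) ^ᶠ n ≡ x ^ᶠ n * y ^ᶠ n
  ^-distrib-* x y zero    = sym (*-identityˡ _)
  ^-distrib-* x y (suc n) = trans (cong ((x * y) *_) (^-distrib-* x y n))
    (solve 4 (λ x y a b → x :* y :* (a :* b) := (x :* a) :* (y :* b)) refl x y (x ^ᶠ n) (y ^ᶠ n))

  ^-* : ∀ x m n → x ^ᶠ (m ℕ.* n) ≡ (x ^ᶠ m) ^ᶠ n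
  ^-* x zero n    = sym (1^ n)
  ^-* x (suc m) n = trans (^-+ x n (m ℕ.* n)) (trans (cong (x ^ᶠ n *_) (^-* x m n)) (sym (^-distrib-* x (x ^ᶠ m) n)))

  ^-nonzero : ∀ {x} n → ¬ x ≡ 0# → ¬ x ^ᶠ n ≡ 0#
  ^-nonzero zero x≢0 eq = 0≢1 (sym eq)
  ^-nonzero (suc n) x≢0 = *-nonzero x≢0 (^-nonzero n x≢0)

  -- Functions given by a monic polynomial of degree n in Horner form.
  data Monic : ℕ → (Carrier → Carrier) → Set where
    one  : ∀ {f} → (∀ x → f x ≡ 1#) → Monic 0 f
    step : ∀ {n f g} c → Monic n g → (∀ x → f x ≡ x * g x + c) → Monic (suc n) f

  Monic-cong : ∀ {n f g} → Monic n f → (∀ x → g x ≡ f x) → Monic n g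
  Monic-cong (one eq) eq′        = one (λ x → trans (eq′ x) (eq x))
  Monic-cong (step c m eq) eq′   = step c m (λ x → trans (eq′ x) (eq x))

  Monic-^ : ∀ n → Monic n (_^ᶠ n)
  Monic-^ zero    = one (λ _ → refl)
  Monic-^ (suc n) = step 0# (Monic-^ n) (λ x → sym (+-identityʳ _))

  Monic-+ : ∀ {n k f g} → Monic n f → Monic k g → k ℕ.< n → Monic n (λ x → f x + g x)
  Monic-+ (step c m eq) (one eq′) k<n = step (c + 1#) m (λ x → trans (cong₂ _+_ (eq x) (eq′ x)) (+-assoc _ _ _))
  Monic-+ (step {g = g} c m eq) (step {g = h} d m′ eq′) (ℕ.s≤s k<n) = step (c + d) (Monic-+ m m′ k<n) (λ x →
    trans (cong₂ _+_ (eq x) (eq′ x))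
      (solve 5 (λ x a c b d → (x :* a :+ c) :+ (x :* b :+ d) := x :* (a :+ b) :+ (c :+ d)) refl x (g x) c (h x) d))

  Monic-+c : ∀ {n f} c → Monic (suc n) f → Monic (suc n) (λ x → f x + c)
  Monic-+c c (step d m eq) = step (d + c) m (λ x → trans (cong (_+ c) (eq x)) (+-assoc _ _ _))

  Monic-^-x : ∀ n → 1 ℕ.< n → Monic n (λ x → x ^ᶠ n - x)
  Monic-^-x (suc zero) (ℕ.s≤s ())
  Monic-^-x (suc (suc n)) _ = step 0# (Monic-+c (- 1#) (Monic-^ (suc n)))
    (λ x → solve 2 (λ x a → x :* a :- x := x :* (a :+ :- con 1ℤ) :+ con 0ℤ) refl x (x ^ᶠ suc n))

  -- Synthetic division: the value `g a` of the inner Horner polynomial becomes the constant term of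
  -- the new quotient.
  factor : ∀ {n f} → Monic (suc n) f → ∀ a → ∃ λ h → Monic n h × (∀ x → f x ≡ (x - a) * h x + f a)
  factor {f = f} (step {g = g} c (one eq) eq′) a = (λ _ → 1#) , one (λ _ → refl) , λ x →
    trans (expand x) (trans (solve 3 (λ x a c → x :* con 1ℤ :+ c := (x :- a) :* con 1ℤ :+ (a :* con 1ℤ :+ c)) refl x a
        c)
                   (cong (((x - a) * 1#) +_) (sym (expand a))))
    where
    expand : ∀ x → f x ≡ x * 1# + c
    expand x = trans (eq′ x) (cong (λ y → x * y + c) (eq x))
  factor {suc n} {f} (step {g = g} c m@(step _ _ _) eq) a with factor m a
  ... | h , mh , eqh = (λ x → x * h x + g a) , step (g a) mh (λ _ → refl) , λ x →
    trans (eq x) (trans (cong (λ y → x * y + c) (eqh x))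
      (trans (solve 5 (λ x a h ga c → x :* ((x :- a) :* h :+ ga) :+ c := (x :- a) :* (x :* h :+ ga) :+ (a :* ga :+ c))
          refl x a (h x) (g a) c)
        (cong (((x - a) * (x * h x + g a)) +_) (sym (eq a)))))

  roots-≤ : ∀ {n f} → Monic n f → # (λ x → f x ≟ 0#) ℕ.≤ n
  roots-≤ {zero} {f} (one eq) = ℕₚ.≤-reflexive (#-none (λ x → f x ≟ 0#) (λ x fx≡0 → 0≢1 (trans (sym fx≡0) (eq x))))
  roots-≤ {suc n} {f} m with ∃? (λ x → f x ≟ 0#)
  ... | no none = ℕₚ.≤-trans (ℕₚ.≤-reflexive (#-none (λ x → f x ≟ 0#) (λ x fx≡0 → none (x , fx≡0)))) ℕ.z≤n
  ... | yes (a , fa≡0) with factor m a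
  ...   | h , mh , eqh = subst (ℕ._≤ suc n) (sym (#-remove (λ x → f x ≟ 0#) fa≡0)) (ℕ.s≤s
    (ℕₚ.≤-trans (#-mono (λ x → (f x ≟ 0#) ×-dec ¬? (x ≟ a)) (λ x → h x ≟ 0#) root-h) (roots-≤ mh)))
    where
    root-h : ∀ x → f x ≡ 0# × ¬ x ≡ a → h x ≡ 0#
    root-h x (fx≡0 , x≢a) with integral {x - a} {h x} (trans
        (sym (trans (eqh x) (trans (cong (((x - a) * h x) +_) fa≡0) (+-identityʳ _)))) fx≡0)
    ... | inj₁ x-a≡0 = contradiction (x-y≡0⇒x≡y x-a≡0) x≢a
    ... | inj₂ hx≡0  = hx≡0

  private
    module × = BigOperator (CommutativeRing.*-commutativeMonoid ring) finite
    module ＋ = BigOperator (CommutativeRing.+-commutativeMonoid ring) finite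
    open SemiringMult (CommutativeRing.semiring ring) using (×1-homo-*; ×-assoc-*; ×-assocˡ; ×-idem; ×-homo-1)
        renaming (_×_ to _·_)

    -- The factor that `x` contributes to the product of all nonzero elements, with 1 in place of 0,
    -- so that the product can run over the whole field.
    nonzeroPart : Carrier → Carrier
    nonzeroPart x with x ≟ 0#
    ... | yes _ = 1#
    ... | no _  = x

    nonzeroPart-nonzero : ∀ x → ¬ nonzeroPart x ≡ 0#
    nonzeroPart-nonzero x with x ≟ 0#
    ... | yes _  = λ eq → 0≢1 (sym eq)
    ... | no x≢0 = x≢0

    pow≡· : ∀ x n → MonoidMult._×_ (CommutativeRing.*-commutativeMonoid ring) n x ≡ x ^ᶠ n
    pow≡· x zero    = refl
    pow≡· x (suc n) = cong (x *_) (pow≡· x n)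

    ⨁-nonzero : ∀ xs f → (∀ x → ¬ f x ≡ 0#) → ¬ ×.⨁ xs f ≡ 0#
    ⨁-nonzero [] f f≢0       = λ eq → 0≢1 (sym eq)
    ⨁-nonzero (x ∷ xs) f f≢0 = *-nonzero (f≢0 x) (⨁-nonzero xs f f≢0)

  card≡1+nonzero : card ≡ suc (# (λ x → ¬? (x ≟ 0#)))
  card≡1+nonzero = trans (sym size≡card) (trans (sym (#-all (λ x → x ≟ x) (λ _ → refl)))
    (trans (#-remove (λ x → x ≟ x) {0#} refl) (cong suc (#-cong (λ x → (x ≟ x) ×-dec ¬? (x ≟ 0#)) (λ x → ¬? (x ≟ 0#))
        (λ _ → proj₂) (λ _ x≢0 → refl , x≢0)))))

  -- Multiplication by a nonzero `a` permutes the nonzero elements, so their product `P` satisfies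
  -- `P` = a^n `P` with n = card - 1, and `P` cancels because it is nonzero.
  fermat : ∀ x → x ^ᶠ card ≡ x
  fermat a with a ≟ 0#
  ... | yes refl = 0^ card (subst (0 ℕ.<_) (sym card≡1+nonzero) (ℕ.s≤s ℕ.z≤n))
  ... | no a≢0 = trans (cong (a ^ᶠ_) card≡1+nonzero) (trans (cong (a *_) a^n≡1) (*-identityʳ a))
    where
    n = # (λ x → ¬? (x ≟ 0#))
    scale : ∀ x → nonzeroPart (a * x) ≡ MonoidMult._×_ (CommutativeRing.*-commutativeMonoid ring)
        (𝟙 (¬? (x ≟ 0#))) a * nonzeroPart x
    scale x with x ≟ 0# | a * x ≟ 0#
    ... | yes _    | yes _    = sym (*-identityˡ 1#)
    ... | yes refl | no ax≢0  = contradiction (zeroʳ a) ax≢0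
    ... | no x≢0   | yes ax≡0 = contradiction ax≡0 (*-nonzero a≢0 x≢0)
    ... | no _     | no _     = cong (_* x) (sym (*-identityʳ a))
    P = ×.⨁ elements nonzeroPart
    a^nP≡P : a ^ᶠ n * P ≡ P
    a^nP≡P = trans (cong (_* P) (sym (trans (×.⨁-multiple elements (λ x → 𝟙 (¬? (x ≟ 0#))) a) (pow≡· a n))))
      (trans (sym (×.⨁-∙ elements _ nonzeroPart)) (trans (sym (×.⨁-cong elements scale))
        (×.⨁-reindex (a *_) (a ⁻¹ *_) (λ x → inverse-cancelˡ x a≢0)
          (λ x → trans (sym (*-assoc _ _ x)) (trans (cong (_* x) (*-inverseʳ a≢0)) (*-identityˡ x))) nonzeroPart)))
    a^n≡1 : a ^ᶠ n ≡ 1#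
    a^n≡1 = *-cancelˡ (⨁-nonzero elements nonzeroPart nonzeroPart-nonzero)
      (trans (*-comm P _) (trans a^nP≡P (sym (*-identityʳ P))))

  private
    -- Translation by 1 permutes the field, so the sum `S` of all elements equals `card · 1#` plus
    -- `S`.
    card·1≡0 : card · 1# ≡ 0#
    card·1≡0 = trans (cong (_· 1#) (sym size≡card)) (+-cancelʳ S (trans size·1+S≡S (sym (+-identityˡ S))))
      where
      S = ＋.⨁ elements (λ x → x)
      size·1+S≡S : size · 1# + S ≡ S
      size·1+S≡S = trans (cong (_+ S) (sym (＋.⨁-multiple elements (λ _ → 1) 1#)))
        (trans (sym (＋.⨁-∙ elements _ (λ x → x))) (trans (＋.⨁-cong elements (λ x → cong (_+ x) (×-homo-1 1#)))
          (＋.⨁-reindex (λ x → 1# + x) (λ x → x - 1#)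
            (λ x → solve 1 (λ x → con 1ℤ :+ x :- con 1ℤ := x) refl x)
            (λ x → solve 1 (λ x → con 1ℤ :+ (x :- con 1ℤ) := x) refl x) (λ x → x))))

    p^n·1 : ∀ p n → (p ℕ.^ n) · 1# ≡ 0# → p · 1# ≡ 0#
    p^n·1 p zero eq = contradiction (trans (sym eq) (×-homo-1 1#)) 0≢1
    p^n·1 p (suc n) eq with integral {p · 1#} {(p ℕ.^ n) · 1#} (trans (sym (×1-homo-* p (p ℕ.^ n))) eq)
    ... | inj₁ p1≡0 = p1≡0
    ... | inj₂ p^n1≡0 = p^n·1 p n p^n1≡0

  module Characteristic {p n} (pp : Prime p) (card≡p^n : card ≡ p ℕ.^ n) where
    private
      p·1≡0 : p · 1# ≡ 0#
      p·1≡0 = p^n·1 p n (trans (cong (_· 1#) (sym card≡p^n)) card·1≡0)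

      p·x≡0 : ∀ x → p · x ≡ 0#
      p·x≡0 x = trans (cong (p ·_) (sym (*-identityˡ x))) (trans (sym (×-assoc-* p 1# x))
          (trans (cong (_* x) p·1≡0) (zeroˡ x)))

      p∣⇒·≡0 : ∀ {c} x → p ∣ c → c · x ≡ 0#
      p∣⇒·≡0 x (divides k refl) = trans (cong (_· x) (ℕₚ.*-comm k p)) (trans (sym (×-assocˡ x p k)) (p·x≡0 _))

    2∣p⇒1+1≡0 : 2 ∣ p → 1# + 1# ≡ 0#
    2∣p⇒1+1≡0 2∣p with prime⇒irreducible pp 2∣p
    ... | inj₁ ()
    ... | inj₂ refl = trans (cong (1# +_) (sym (+-identityʳ 1#))) p·1≡0

    -- If 1 + 1 vanished, `p · 1#` would reduce in steps of two to 1, as `p` is odd.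
    2∤p⇒1+1≢0 : ¬ 2 ∣ p → ¬ 1# + 1# ≡ 0#
    2∤p⇒1+1≢0 2∤p 1+1≡0 = odd p 2∤p p·1≡0
      where
      odd : ∀ m → ¬ 2 ∣ m → ¬ m · 1# ≡ 0#
      odd zero 2∤m _ = 2∤m (divides 0 refl)
      odd (suc zero) _ eq = 0≢1 (sym (trans (sym (+-identityʳ 1#)) eq))
      odd (suc (suc m)) 2∤m eq = odd m (λ { (divides j refl) → 2∤m (divides (suc j) refl) })
        (trans (sym (trans (sym (+-assoc _ _ _)) (trans (cong (_+ m · 1#) 1+1≡0) (+-identityˡ _)))) eq)

    -- Only the two outer terms of the binomial expansion survive, the inner coefficients being
    -- divisible by `p`. The copy `r` of `p` can be matched as a successor, which splitting off the
    -- last term requires.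
    frobenius : ∀ x y → (x + y) ^ᶠ p ≡ x ^ᶠ p + y ^ᶠ p
    frobenius x y = go p refl
      where
      go : ∀ r → p ≡ r → (x + y) ^ᶠ r ≡ x ^ᶠ r + y ^ᶠ r
      go zero p≡ = contradiction (subst Prime p≡ pp) ¬prime[0]
      go (suc p′) p≡ = trans (sym (^≡ _ (suc p′))) (trans (Bin.theorem (suc p′) x y)
          (trans (cong₂ _+_ first (trans (MS.sum-init-last (tail (Bin.binomialTerm x y (suc p′))))
              (trans (cong₂ _+_ middle final) (+-identityˡ _)))) (+-comm _ _)))
        where
        open import Data.Vec.Functional using (tail; init; last)
        open SemiringExp (CommutativeRing.semiring ring) using () renaming (_^_ to _^ˢ_)
        module Bin = Binomial (CommutativeRing.commutativeSemiring ring)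
        module MS = MonoidSum (CommutativeRing.+-monoid ring)
        ^≡ : ∀ z m → z ^ˢ m ≡ z ^ᶠ m
        ^≡ z zero    = refl
        ^≡ z (suc m) = cong (z *_) (^≡ z m)
        first : 1 · (1# * y ^ˢ suc p′) ≡ y ^ᶠ suc p′
        first = trans (×-homo-1 _) (trans (*-identityˡ _) (^≡ y (suc p′)))
        final : Bin.binomialTerm x y (suc p′) (Fin.suc (fromℕ p′)) ≡ x ^ᶠ suc p′
        final = trans (cong₂ (λ c k → (suc p′ choose suc c) · ((x ^ˢ suc c) * (y ^ˢ k))) (Finₚ.toℕ-fromℕ p′)
                        (trans (cong (p′ ℕ.∸_) (Finₚ.toℕ-fromℕ p′)) (ℕₚ.n∸n≡0 p′)))
          (trans (cong (_· ((x ^ˢ suc p′) * 1#)) (nCn≡1 (suc p′)))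
              (trans (×-homo-1 _) (trans (*-identityʳ _) (^≡ x (suc p′)))))
        zero-sum : ∀ {m} (t : Fin m → Carrier) → (∀ i → t i ≡ 0#) → MS.sum t ≡ 0#
        zero-sum {zero} t eq  = refl
        zero-sum {suc m} t eq = trans (cong₂ _+_ (eq Fin.zero) (zero-sum (tail t) (λ i → eq (Fin.suc i))))
            (+-identityˡ _)
        middle : MS.sum (init (tail (Bin.binomialTerm x y (suc p′)))) ≡ 0#
        middle = zero-sum _ (λ i → p∣⇒·≡0 _ (
          (subst (λ z → p ∣ (z choose suc (toℕ (inject₁ i)))) p≡ (prime∣C pp _ (ℕ.s≤s ℕ.z≤n)
            (subst₂ ℕ._<_ (cong suc (sym (Finₚ.toℕ-inject₁ i))) (sym p≡) (ℕ.s≤s (Finₚ.toℕ<n i)))))))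

    frobenius^ : ∀ e x y → (x + y) ^ᶠ (p ℕ.^ e) ≡ x ^ᶠ (p ℕ.^ e) + y ^ᶠ (p ℕ.^ e)
    frobenius^ zero x y    = trans (*-identityʳ _) (sym (cong₂ _+_ (*-identityʳ _) (*-identityʳ _)))
    frobenius^ (suc e) x y = trans (^-* _ p (p ℕ.^ e)) (trans (cong (_^ᶠ (p ℕ.^ e)) (frobenius x y))
      (trans (frobenius^ e _ _) (cong₂ _+_ (sym (^-* x p _)) (sym (^-* y p _)))))

-- Powers of Frobenius: fixed fields, periods, traces

module _ {P : ℕ → Set} (P? : Decidable P) where

  least : ∀ n → P n → ∃ λ d → P d × (∀ i → i ℕ.< d → ¬ P i)
  least n pn = search 0 n (ℕₚ.+-identityʳ n) (λ _ ())
    where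
    search : ∀ d k → k ℕ.+ d ≡ n → (∀ i → i ℕ.< d → ¬ P i) → ∃ λ d → P d × (∀ i → i ℕ.< d → ¬ P i)
    search d k eq below with P? d
    ... | yes pd = d , pd , below
    search d zero refl below | no ¬pd = contradiction pn ¬pd
    search d (suc k) eq below | no ¬pd = search (suc d) k (trans (ℕₚ.+-suc k d) eq) below′
      where
      below′ : ∀ i → i ℕ.< suc d → ¬ P i
      below′ i i<1+d with ℕₚ.m≤n⇒m<n∨m≡n (ℕₚ.≤-pred i<1+d)
      ... | inj₁ i<d  = below i i<d
      ... | inj₂ refl = ¬pd

-- Stands in for "q is a power of the characteristic". One theory then serves for q, for Q, for 2
-- and for the powers of Q.
AdditivePower : FiniteField → ℕ → Set
AdditivePower K q = ∀ x y → (x + y) ^ᶠ q ≡ x ^ᶠ q + y ^ᶠ q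
  where open Field K

module FrobeniusPower (K : FiniteField) (q : ℕ) (1<q : 1 ℕ.< q) (^q-+ : AdditivePower K q) where
  open Field K

  instance
    q-nonZero : NonZero q
    q-nonZero = ℕ.>-nonZero (ℕₚ.<-trans (ℕ.s≤s ℕ.z≤n) 1<q)

  0<q^ : ∀ n → 0 ℕ.< q ℕ.^ n
  0<q^ n = ℕ.>-nonZero⁻¹ _ {{ℕₚ.m^n≢0 q n}}

  σ : ℕ → Carrier → Carrier
  σ n x = x ^ᶠ (q ℕ.^ n)

  σ-0 : ∀ x → σ 0 x ≡ x
  σ-0 x = *-identityʳ x

  σ-1 : ∀ x → σ 1 x ≡ x ^ᶠ q
  σ-1 x = cong (x ^ᶠ_) (ℕₚ.*-identityʳ q)

  σ-∘ : ∀ m n x → σ (m ℕ.+ n) x ≡ σ n (σ m x)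
  σ-∘ m n x = trans (cong (x ^ᶠ_) (ℕₚ.^-distribˡ-+-* q m n)) (^-* x (q ℕ.^ m) (q ℕ.^ n))

  σ-+ : ∀ n x y → σ n (x + y) ≡ σ n x + σ n y
  σ-+ zero x y    = trans (σ-0 _) (sym (cong₂ _+_ (σ-0 x) (σ-0 y)))
  σ-+ (suc n) x y = trans (^-* _ q (q ℕ.^ n)) (trans (cong (σ n) (^q-+ x y))
    (trans (σ-+ n _ _) (cong₂ _+_ (sym (^-* x q (q ℕ.^ n))) (sym (^-* y q (q ℕ.^ n))))))

  σ-* : ∀ n x y → σ n (x * y) ≡ σ n x * σ n y
  σ-* n x y = ^-distrib-* x y (q ℕ.^ n)

  σ-of-0 : ∀ n → σ n 0# ≡ 0#
  σ-of-0 n = 0^ (q ℕ.^ n) (0<q^ n)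

  σ-of-1 : ∀ n → σ n 1# ≡ 1#
  σ-of-1 n = 1^ (q ℕ.^ n)

  σ-neg : ∀ n x → σ n (- x) ≡ - σ n x
  σ-neg n x = +-cancelʳ (σ n x) (trans (sym (σ-+ n (- x) x))
    (trans (cong (σ n) (-‿inverseˡ x)) (trans (σ-of-0 n) (sym (-‿inverseˡ (σ n x))))))

  σ-sub : ∀ n x y → σ n (x - y) ≡ σ n x - σ n y
  σ-sub n x y = trans (σ-+ n x (- y)) (cong (σ n x +_) (σ-neg n y))

  σ-injective : ∀ n {x y} → σ n x ≡ σ n y → x ≡ y
  σ-injective n {x} {y} eq with (x - y) ≟ 0#
  ... | yes x-y≡0 = x-y≡0⇒x≡y x-y≡0
  ... | no x-y≢0  = contradiction (trans (σ-sub n x y) (x≡y⇒x-y≡0 eq)) (^-nonzero (q ℕ.^ n) x-y≢0)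

  -- Membership in the intersection of K with the field of q^n elements. Subfields appear only
  -- through these equations.
  Fixed : ℕ → Carrier → Set
  Fixed n x = σ n x ≡ x

  Fixed? : ∀ n → Decidable (Fixed n)
  Fixed? n x = σ n x ≟ x

  module _ (n : ℕ) where
    Fixed-0# : Fixed n 0#
    Fixed-0# = σ-of-0 n

    Fixed-1# : Fixed n 1#
    Fixed-1# = σ-of-1 n

    Fixed-+ : ∀ {x y} → Fixed n x → Fixed n y → Fixed n (x + y)
    Fixed-+ fx fy = trans (σ-+ n _ _) (cong₂ _+_ fx fy)

    Fixed-neg : ∀ {x} → Fixed n x → Fixed n (- x)
    Fixed-neg fx = trans (σ-neg n _) (cong -_ fx)

    Fixed-sub : ∀ {x y} → Fixed n x → Fixed n y → Fixed n (x - y)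
    Fixed-sub fx fy = Fixed-+ fx (Fixed-neg fy)

    Fixed-* : ∀ {x y} → Fixed n x → Fixed n y → Fixed n (x * y)
    Fixed-* fx fy = trans (σ-* n _ _) (cong₂ _*_ fx fy)

    Fixed-inv : ∀ {x y} → Fixed n x → x * y ≡ 1# → Fixed n y
    Fixed-inv {x} {y} fx xy≡1 = *-cancelˡ x≢0 (trans (cong (_* σ n y) (sym fx))
      (trans (sym (σ-* n x y)) (trans (cong (σ n) xy≡1) (trans Fixed-1# (sym xy≡1)))))
      where
      x≢0 : ¬ x ≡ 0#
      x≢0 refl = 0≢1 (trans (sym (zeroˡ y)) xy≡1)

    Fixed-⁻¹ : ∀ {x} → ¬ x ≡ 0# → Fixed n x → Fixed n (x ⁻¹)
    Fixed-⁻¹ x≢0 fx = Fixed-inv fx (*-inverseʳ x≢0)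

    Fixed-subfield : IsSubfield (Fixed n)
    Fixed-subfield = record
      { has0 = Fixed-0# ; has1 = Fixed-1# ; +-closed = Fixed-+ ; *-closed = Fixed-*
      ; neg-closed = Fixed-neg ; inv-closed = Fixed-inv }

  Fixed-sum : ∀ m n {x} → Fixed m x → Fixed n x → Fixed (m ℕ.+ n) x
  Fixed-sum m n fm fn = trans (σ-∘ m n _) (trans (cong (σ n) fm) fn)

  Fixed-diff : ∀ m n {x} → Fixed m x → Fixed (m ℕ.+ n) x → Fixed n x
  Fixed-diff m n fm fmn = trans (cong (σ n) (sym fm)) (trans (sym (σ-∘ m n _)) fmn)

  Fixed-multiple : ∀ j n {x} → Fixed n x → Fixed (j ℕ.* n) x
  Fixed-multiple zero n {x} fx = σ-0 x
  Fixed-multiple (suc j) n fx  = Fixed-sum n (j ℕ.* n) fx (Fixed-multiple j n fx)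

  Fixed-∣ : ∀ {m n x} → m ∣ n → Fixed m x → Fixed n x
  Fixed-∣ {m} (divides j refl) = Fixed-multiple j m

  record Period (x : Carrier) (d : ℕ) : Set where
    field
      positive : 0 ℕ.< d
      fixed    : Fixed d x
      minimal  : ∀ i → 0 ℕ.< i → i ℕ.< d → ¬ Fixed i x

    -- The remainder of `n` modulo `d` is again an exponent whose Frobenius power fixes `x`, and it
    -- is smaller than `d`, hence 0.
    divides-all : ∀ n → Fixed n x → d ∣ n
    divides-all n fn = m%n≡0⇒n∣m n d (zero-remainder (n % d) (m%n<n n d) remainder-fixed)
      where
      instance _ = ℕ.>-nonZero positive
      remainder-fixed : Fixed (n % d) x
      remainder-fixed = Fixed-diff (n / d ℕ.* d) (n % d) (Fixed-multiple (n / d) d fixed)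
        (subst (λ k → Fixed k x) (trans (m≡m%n+[m/n]*n n d) (ℕₚ.+-comm (n % d) _)) fn)
      zero-remainder : ∀ r → r ℕ.< d → Fixed r x → r ≡ 0
      zero-remainder zero r<d fr    = refl
      zero-remainder (suc r) r<d fr = contradiction fr (minimal (suc r) (ℕ.s≤s ℕ.z≤n) r<d)

  open Period public

  period : ∀ m x → 0 ℕ.< m → Fixed m x → ∃ (Period x)
  period m x 0<m fm with least (λ d → (0 ℕₚ.<? d) ×-dec Fixed? d x) m (0<m , fm)
  ... | d , (0<d , fd) , min = d , record
    { positive = 0<d ; fixed = fd ; minimal = λ i 0<i i<d fi → min i i<d (0<i , fi) }

  -- Degree over the field of q elements: the number of conjugates of x.
  DegreeAtLeast : ℕ → Carrier → Set
  DegreeAtLeast d x = ∀ i → i ℕ.< d → 0 ℕ.< i → ¬ Fixed i x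

  DegreeAtLeast? : ∀ d → Decidable (DegreeAtLeast d)
  DegreeAtLeast? d x with ℕₚ.allUpTo? (λ i → (0 ℕₚ.<? i) →-dec ¬? (Fixed? i x)) d
  ... | yes deg = yes λ i → deg {i}
  ... | no ¬deg = no λ deg → ¬deg λ {i} → deg i

  Fixed-1⇒Fixed : ∀ {x} i → Fixed 1 x → Fixed i x
  Fixed-1⇒Fixed {x} i fx = subst (λ k → Fixed k x) (ℕₚ.*-identityʳ i) (Fixed-multiple i 1 fx)

  DegreeAtLeast-+ : ∀ {d x c} → Fixed 1 c → DegreeAtLeast d x → DegreeAtLeast d (x + c)
  DegreeAtLeast-+ {x = x} {c} fc deg i i<d 0<i fxc = deg i i<d 0<i
    (subst (Fixed i) (solve 2 (λ x c → (x :+ c) :- c := x) refl x c) (Fixed-sub i fxc (Fixed-1⇒Fixed i fc)))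

  DegreeAtLeast-* : ∀ {d x c} → ¬ c ≡ 0# → Fixed 1 c → DegreeAtLeast d x → DegreeAtLeast d (c * x)
  DegreeAtLeast-* {x = x} c≢0 fc deg i i<d 0<i fcx = deg i i<d 0<i
    (subst (Fixed i) (inverse-cancelˡ x c≢0) (Fixed-* i (Fixed-⁻¹ i c≢0 (Fixed-1⇒Fixed i fc)) fcx))

  DegreeAtLeast-⁻¹ : ∀ {d x} → ¬ x ≡ 0# → DegreeAtLeast d x → DegreeAtLeast d (x ⁻¹)
  DegreeAtLeast-⁻¹ {x = x} x≢0 deg i i<d 0<i fx⁻¹ = deg i i<d 0<i (Fixed-inv i fx⁻¹ (*-inverseˡ x≢0))

  DegreeAtLeast⇒nonzero : ∀ {d x} → 1 ℕ.< d → DegreeAtLeast d x → ¬ x ≡ 0#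
  DegreeAtLeast⇒nonzero 1<d deg refl = deg 1 1<d (ℕ.s≤s ℕ.z≤n) (Fixed-0# 1)

  -- The sum of the first r conjugates x + x^q + ... + x^(q^(r-1)), which is the trace to F_q when
  -- `x` lies in the field of q^r elements. For r > 0 it is a monic polynomial of degree q^(r-1) on
  -- all of K, and this bounds its fibres.
  Tr : ℕ → Carrier → Carrier
  Tr zero x    = 0#
  Tr (suc r) x = Tr r x + σ r x

  Tr-+ : ∀ r x y → Tr r (x + y) ≡ Tr r x + Tr r y
  Tr-+ zero x y    = sym (+-identityˡ 0#)
  Tr-+ (suc r) x y = trans (cong₂ _+_ (Tr-+ r x y) (σ-+ r x y))
    (solve 4 (λ a b c d → (a :+ b) :+ (c :+ d) := (a :+ c) :+ (b :+ d)) refl _ _ _ _)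

  Tr-* : ∀ r {c} x → Fixed 1 c → Tr r (c * x) ≡ c * Tr r x
  Tr-* zero {c} x fc    = sym (zeroʳ c)
  Tr-* (suc r) {c} x fc = trans (cong₂ _+_ (Tr-* r x fc) (trans (σ-* r c x) (cong (_* σ r x) (Fixed-1⇒Fixed r fc))))
      (sym (distribˡ c _ _))

  Tr-neg : ∀ r x → Tr r (- x) ≡ - Tr r x
  Tr-neg r x = trans (cong (Tr r) (solve 1 (λ x → :- x := (:- con 1ℤ) :* x) refl x))
    (trans (Tr-* r x (Fixed-neg 1 (Fixed-1# 1))) (solve 1 (λ x → (:- con 1ℤ) :* x := :- x) refl _))

  Tr-sum : ∀ m n x → Tr (m ℕ.+ n) x ≡ Tr m x + Tr n (σ m x)
  Tr-sum m zero x    = trans (cong (λ k → Tr k x) (ℕₚ.+-identityʳ m)) (sym (+-identityʳ _))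
  Tr-sum m (suc n) x = trans (cong (λ k → Tr k x) (ℕₚ.+-suc m n))
    (trans (cong₂ _+_ (Tr-sum m n x) (σ-∘ m n x)) (+-assoc _ _ _))

  σ-Tr : ∀ n r x → σ n (Tr r x) ≡ Tr r (σ n x)
  σ-Tr n zero x    = σ-of-0 n
  σ-Tr n (suc r) x = trans (σ-+ n _ _) (cong₂ _+_ (σ-Tr n r x)
    (trans (sym (σ-∘ r n x)) (trans (cong (λ k → σ k x) (ℕₚ.+-comm r n)) (σ-∘ n r x))))

  Tr-telescope : ∀ r x → Tr r (σ 1 x) - Tr r x ≡ σ r x - x
  Tr-telescope zero x    = trans (-‿inverseʳ 0#) (sym (x≡y⇒x-y≡0 (σ-0 x)))
  Tr-telescope (suc r) x = trans
    (solve 4 (λ a b c d → (a :+ b) :- (c :+ d) := (a :- c) :+ (b :- d)) refl _ _ _ _)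
    (trans (cong₂ (λ u v → u + (v - σ r x)) (Tr-telescope r x) (sym (σ-∘ 1 r x)))
      (solve 3 (λ s x t → (s :- x) :+ (t :- s) := t :- x) refl (σ r x) x (σ (suc r) x)))

  Tr-fixed : ∀ r x → Fixed r x → Fixed 1 (Tr r x)
  Tr-fixed r x fr = x-y≡0⇒x≡y (trans (cong (_- Tr r x) (σ-Tr 1 r x)) (trans (Tr-telescope r x) (x≡y⇒x-y≡0 fr)))

  q^-mono : ∀ {m n} → m ℕ.< n → q ℕ.^ m ℕ.< q ℕ.^ n
  q^-mono = ℕₚ.^-monoʳ-< q 1<q

  Monic-Tr : ∀ r → Monic (q ℕ.^ r) (Tr (suc r))
  Monic-Tr zero    = Monic-cong (Monic-^ 1) (λ x → +-identityˡ _)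
  Monic-Tr (suc r) = Monic-cong (Monic-+ (Monic-^ (q ℕ.^ suc r)) (Monic-Tr r) (q^-mono (ℕₚ.n<1+n r)))
      (λ x → +-comm _ _)

  #-fibre-Tr : ∀ r c → # (λ x → Tr (suc r) x ≟ c) ℕ.≤ q ℕ.^ r
  #-fibre-Tr r c = ℕₚ.≤-trans (#-mono (λ x → Tr (suc r) x ≟ c) (λ x → (Tr (suc r) x - c) ≟ 0#) (λ x → x≡y⇒x-y≡0))
      (roots-≤ shifted)
    where
    shifted : Monic (q ℕ.^ r) (λ x → Tr (suc r) x - c)
    shifted with q ℕ.^ r | 0<q^ r | Monic-Tr r
    ... | suc d | _ | m = Monic-+c (- c) m

  #-Fixed-≤ : ∀ n → 0 ℕ.< n → # (Fixed? n) ℕ.≤ q ℕ.^ n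
  #-Fixed-≤ n 0<n = ℕₚ.≤-trans (#-mono (Fixed? n) (λ x → (σ n x - x) ≟ 0#) (λ x → x≡y⇒x-y≡0))
    (roots-≤ (Monic-^-x (q ℕ.^ n) (q^-mono 0<n)))

  -- The sizes of the fixed field and of the kernel of the trace, and Hilbert 90, all come from counting: ∂ = σ 1 - id
  -- maps K to the kernel of the trace with fibres of at most q points, and that kernel has at most q^r points.
  module Whole (r : ℕ) (card≡ : card ≡ q ℕ.^ suc r) where

    Fixed-all : ∀ x → Fixed (suc r) x
    Fixed-all x = trans (cong (x ^ᶠ_) (sym card≡)) (fermat x)

    trace : Carrier → Carrier
    trace = Tr (suc r)

    private
      ker? : Decidable (λ x → trace x ≡ 0#)
      ker? x = trace x ≟ 0#

      all? : Decidable (λ (x : Carrier) → x ≡ x)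
      all? x = x ≟ x

      ∂ : Carrier → Carrier
      ∂ x = σ 1 x - x

      ∂-in-ker : ∀ x → x ≡ x → trace (∂ x) ≡ 0#
      ∂-in-ker x _ = trans (Tr-+ (suc r) (σ 1 x) (- x)) (trans (cong (trace (σ 1 x) +_) (Tr-neg (suc r) x))
        (trans (Tr-telescope (suc r) x) (x≡y⇒x-y≡0 (Fixed-all x))))

      fibre-≤ : ∀ y → trace y ≡ 0# → # (fibre? finite finite all? ∂ y) ℕ.≤ # (Fixed? 1)
      fibre-≤ y _ with ∃? (fibre? finite finite all? ∂ y)
      ... | no none = ℕₚ.≤-trans (ℕₚ.≤-reflexive (#-none (fibre? finite finite all? ∂ y) (λ x px → none (x , px))))
          ℕ.z≤n
      -- A nonempty fibre is a translate of the fixed field: subtracting one of its points lands in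
      -- the kernel of `∂`.
      ... | yes (x₀ , _ , ∂x₀≡y) = #-injection finite finite (fibre? finite finite all? ∂ y) (Fixed? 1) (_- x₀)
        (λ { x (_ , ∂x≡y) → x-y≡0⇒x≡y (trans (cong (_- (x - x₀)) (σ-sub 1 x x₀))
          (trans (solve 4 (λ a b c d → (a :- b) :- (c :- d) := (a :- c) :- (b :- d)) refl _ _ _ _)
              (x≡y⇒x-y≡0 (trans ∂x≡y (sym ∂x₀≡y))))) })
        (λ x x′ _ _ eq → +-cancelʳ (- x₀) eq)

      q^1≡q : q ℕ.^ 1 ≡ q
      q^1≡q = ℕₚ.*-identityʳ q

      Fixed≤q : # (Fixed? 1) ℕ.≤ q
      Fixed≤q = subst (# (Fixed? 1) ℕ.≤_) q^1≡q (#-Fixed-≤ 1 (ℕ.s≤s ℕ.z≤n))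

      ker≤ : # ker? ℕ.≤ q ℕ.^ r
      ker≤ = #-fibre-Tr r 0#

      all≡ : # all? ≡ q ℕ.* q ℕ.^ r
      all≡ = trans (#-all all? (λ _ → refl)) (trans size≡card card≡)

      -- The factors on the right are at most q^r and q, so this inequality forces both of them to
      -- attain their bounds.
      all≤ : q ℕ.* q ℕ.^ r ℕ.≤ # ker? ℕ.* # (Fixed? 1)
      all≤ = subst (ℕ._≤ # ker? ℕ.* # (Fixed? 1)) all≡ (#-fibres-≤ finite finite all? ker? ∂ ∂-in-ker
          (# (Fixed? 1)) fibre-≤)

    #-Fixed : # (Fixed? 1) ≡ q
    #-Fixed = ℕₚ.≤-antisym Fixed≤q (ℕₚ.*-cancelʳ-≤ q _ (q ℕ.^ r) {{ℕₚ.m^n≢0 q r}}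
      (ℕₚ.≤-trans all≤ (ℕₚ.≤-trans (ℕₚ.*-monoˡ-≤ (# (Fixed? 1)) ker≤) (ℕₚ.≤-reflexive (ℕₚ.*-comm _ (# (Fixed? 1)))))))

    #-ker-trace : # (λ x → trace x ≟ 0#) ≡ q ℕ.^ r
    #-ker-trace = ℕₚ.≤-antisym ker≤ (ℕₚ.*-cancelˡ-≤ q
      (ℕₚ.≤-trans all≤ (ℕₚ.≤-reflexive (trans (cong (# ker? ℕ.*_) #-Fixed) (ℕₚ.*-comm _ q)))))

    hilbert90 : ∀ y → trace y ≡ 0# → ∃ λ x → σ 1 x - x ≡ y
    hilbert90 y ty≡0 = proj₁ preimage , proj₂ (proj₂ preimage)
      where
      preimage : ∃ λ x → x ≡ x × ∂ x ≡ y
      preimage = #-surjective finite finite all? ker? ∂ ∂-in-ker q (ℕₚ.<-trans (ℕ.s≤s ℕ.z≤n) 1<q)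
        (λ y ty → ℕₚ.≤-trans (fibre-≤ y ty) Fixed≤q)
        (ℕₚ.≤-reflexive (trans (cong (ℕ._* q) #-ker-trace) (trans (ℕₚ.*-comm _ q) (sym all≡)))) y ty≡0

#-VecAll : ∀ {A : Set} (FA : Finite A) {P : A → Set} (P? : Decidable P) n →
           Finite.# (Vec-finite FA n) (VecAll.all? P?) ≡ Finite.# FA P? ℕ.^ n
#-VecAll FA P? zero    = refl
#-VecAll {A} FA P? (suc n) = trans (∑-Vec FA n _) (trans
  (∑-cong (Finite.elements FA) (λ a → trans
    (∑-cong (Finite.elements (Vec-finite FA n)) (λ v → trans
        (𝟙-cong (VecAll.all? P? (a ∷ v)) (P? a ×-dec VecAll.all? P? v)
       (λ { (pa ∷ pv) → pa , pv }) (λ { (pa , pv) → pa ∷ pv })) (𝟙-× (P? a) (VecAll.all? P? v))))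
    (∑-*ˡ (Finite.elements (Vec-finite FA n)) (𝟙 (P? a)) (λ v → 𝟙 (VecAll.all? P? v)))))
  (trans (∑-*ʳ (Finite.elements FA) (Finite.# (Vec-finite FA n) (VecAll.all? P?)) (λ a → 𝟙 (P? a)))
      (cong (Finite.# FA P? ℕ.*_) (#-VecAll FA P? n))))

-- Elements of degree m are the generators of K over F_q

module Generation (K : FiniteField) (q : ℕ) (1<q : 1 ℕ.< q) (^q-+ : AdditivePower K q)
                  (r : ℕ) (card≡ : FiniteField.card K ≡ q ℕ.^ suc r) where
  open Field K
  open FrobeniusPower K q 1<q ^q-+
  open Whole r card≡
  open OverFq q

  eval : ∀ {n} → Vec Carrier n → Carrier → Carrier
  eval [] x      = 0#
  eval (a ∷ v) x = a + x * eval v x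

  -- Root bounds are stated for monic polynomials, so a combination whose coefficients are not all
  -- zero is divided by its last nonzero coefficient `c`.
  eval-shape : ∀ {n} (v : Vec Carrier n) → VecAll (_≡ 0#) v ⊎
               (Σ Carrier λ c → ∃ λ f → ∃ λ k → ¬ c ≡ 0# × k ℕ.< n × Monic k f × (∀ x → eval v x ≡ c * f x))
  eval-shape [] = inj₁ []
  eval-shape (a ∷ v) with eval-shape v | a ≟ 0#
  ... | inj₁ v≡0 | yes a≡0 = inj₁ (a≡0 ∷ v≡0)
  ... | inj₁ v≡0 | no a≢0 = inj₂ (a , (λ _ → 1#) , 0 , a≢0 , ℕ.s≤s ℕ.z≤n , one (λ _ → refl) , λ x →
    trans (cong (λ y → a + x * y) (eval-0 v≡0 x)) (solve 2 (λ a x → a :+ x :* con 0ℤ := a :* con 1ℤ) refl a x))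
    where
    eval-0 : ∀ {n} {v : Vec Carrier n} → VecAll (_≡ 0#) v → ∀ x → eval v x ≡ 0#
    eval-0 [] x            = refl
    eval-0 (refl ∷ v≡0) x = trans (+-identityˡ _) (trans (cong (x *_) (eval-0 v≡0 x)) (zeroʳ x))
  ... | inj₂ (c , f , k , c≢0 , k<n , mf , eq) | _ =
    inj₂ (c , (λ x → x * f x + c ⁻¹ * a) , suc k , c≢0 , ℕ.s≤s k<n , step (c ⁻¹ * a) mf (λ _ → refl) , λ x →
      trans (cong (λ y → a + x * y) (eq x)) (trans (cong (_+ x * (c * f x)) (sym (cancel a)))
        (solve 4 (λ c i x f → c :* i :+ x :* (c :* f) := c :* (x :* f :+ i)) refl c (c ⁻¹ * a) x (f x))))
    where
    cancel : ∀ a → c * (c ⁻¹ * a) ≡ a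
    cancel a = trans (sym (*-assoc _ _ a)) (trans (cong (_* a) (*-inverseʳ c≢0)) (*-identityˡ a))

  eval-sub : ∀ {n} (v w : Vec Carrier n) x → eval (zipWith _-_ v w) x ≡ eval v x - eval w x
  eval-sub [] [] x           = sym (-‿inverseʳ 0#)
  eval-sub (a ∷ v) (b ∷ w) x = trans (cong (λ y → (a - b) + x * y) (eval-sub v w x))
    (solve 5 (λ a b x v w → (a :- b) :+ x :* (v :- w) := (a :+ x :* v) :- (b :+ x :* w)) refl a b x (eval v x)
        (eval w x))

  zipWith-0 : ∀ {n} (v w : Vec Carrier n) → VecAll (_≡ 0#) (zipWith _-_ v w) → v ≡ w
  zipWith-0 [] [] []                       = refl
  zipWith-0 (a ∷ v) (b ∷ w) (a-b≡0 ∷ rest) = cong₂ _∷_ (x-y≡0⇒x≡y a-b≡0) (zipWith-0 v w rest)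

  σ-eval : ∀ {n} i {v : Vec Carrier n} → VecAll (Fixed 1) v → ∀ x → σ i (eval v x) ≡ eval v (σ i x)
  σ-eval i [] x = σ-of-0 i
  σ-eval i (fa ∷ fv) x = trans (σ-+ i _ _) (cong₂ _+_ (Fixed-1⇒Fixed i fa)
      (trans (σ-* i x _) (cong (σ i x *_) (σ-eval i fv x))))

  zipWith-fixed : ∀ {n} {v w : Vec Carrier n} → VecAll (Fixed 1) v → VecAll (Fixed 1) w → VecAll (Fixed 1)
      (zipWith _-_ v w)
  zipWith-fixed [] []               = []
  zipWith-fixed (fa ∷ fv) (fb ∷ fw) = Fixed-sub 1 fa fb ∷ zipWith-fixed fv fw

  module _ (x : Carrier) (deg : DegreeAtLeast (suc r) x) where

    conjugates-differ : ∀ i j → i ℕ.< j → j ℕ.< suc r → ¬ σ i x ≡ σ j x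
    conjugates-differ i j i<j j<n eq = deg (j ℕ.∸ i) (ℕₚ.≤-<-trans (ℕₚ.m∸n≤m j i) j<n) (ℕₚ.m<n⇒0<n∸m i<j)
      (σ-injective i (trans (sym (σ-∘ (j ℕ.∸ i) i x)) (trans (cong (λ k → σ k x) (ℕₚ.m∸n+n≡m (ℕₚ.<⇒≤ i<j)))
          (sym eq))))

    conjugates-distinct : ∀ (i j : Fin (suc r)) → σ (toℕ i) x ≡ σ (toℕ j) x → i ≡ j
    conjugates-distinct i j eq with ℕₚ.<-cmp (toℕ i) (toℕ j)
    ... | tri< i<j _ _ = contradiction eq (conjugates-differ (toℕ i) (toℕ j) i<j (Finₚ.toℕ<n j))
    ... | tri≈ _ i≡j _ = Finₚ.toℕ-injective i≡j
    ... | tri> _ _ j<i = contradiction (sym eq) (conjugates-differ (toℕ j) (toℕ i) j<i (Finₚ.toℕ<n i))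

    -- A nontrivial relation of degree < m between the powers of x would have the m conjugates of x as roots. So the q^m
    -- combinations of the powers of x are distinct and fill K; no membership in the subfield S of Generates, an
    -- arbitrary predicate, has to be decided.
    independent : (v : Vec Carrier (suc r)) → VecAll (Fixed 1) v → eval v x ≡ 0# → VecAll (_≡ 0#) v
    independent v fv ev≡0 with eval-shape v
    ... | inj₁ v≡0 = v≡0
    ... | inj₂ (c , f , k , c≢0 , k<n , mf , eq) = contradiction (ℕₚ.≤-trans many (roots-≤ mf)) (ℕₚ.<⇒≱ k<n)
      where
      conjugate-root : ∀ i → f (σ i x) ≡ 0#
      conjugate-root i = *-cancelˡ c≢0 (trans (sym (eq (σ i x))) (trans (sym (σ-eval i fv x))
        (trans (cong (σ i) ev≡0) (trans (σ-of-0 i) (sym (zeroʳ c))))))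
      many : suc r ℕ.≤ # (λ y → f y ≟ 0#)
      many = subst (ℕ._≤ # (λ y → f y ≟ 0#)) (trans (Finite.#-all (Fin-finite (suc r)) (λ i → i Finₚ.≟ i)
          (λ _ → refl)) (Fin-size (suc r)))
        (#-injection (Fin-finite (suc r)) finite (λ i → i Finₚ.≟ i) (λ y → f y ≟ 0#) (λ i → σ (toℕ i) x)
          (λ i _ → conjugate-root (toℕ i)) (λ i j _ _ → conjugates-distinct i j))

    spanned : ∀ y → ∃ λ (v : Vec Carrier (suc r)) → VecAll (Fixed 1) v × eval v x ≡ y
    spanned y = #-surjective vectors finite (VecAll.all? (Fixed? 1)) (λ z → z ≟ z) (λ v → eval v x) (λ _ _ → refl)
      1 (ℕ.s≤s ℕ.z≤n) (λ b _ → Finite.#-unique vectors (fibre? vectors finite (VecAll.all? (Fixed? 1))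
          (λ v → eval v x) b) at-most-one)
      (ℕₚ.≤-reflexive enough) y refl
      where
      vectors = Vec-finite finite (suc r)
      at-most-one : ∀ {b} v w → VecAll (Fixed 1) v × eval v x ≡ b → VecAll (Fixed 1) w × eval w x ≡ b → v ≡ w
      at-most-one v w (fv , ev) (fw , ew) = zipWith-0 v w (independent _ (zipWith-fixed fv fw)
        (trans (eval-sub v w x) (x≡y⇒x-y≡0 (trans ev (sym ew)))))
      enough : # (λ z → z ≟ z) ℕ.* 1 ≡ Finite.# vectors (VecAll.all? (Fixed? 1))
      enough = trans (ℕₚ.*-identityʳ _) (trans (#-all (λ z → z ≟ z) (λ _ → refl)) (trans size≡card (trans card≡
        (sym (trans (#-VecAll finite (Fixed? 1) (suc r)) (cong (ℕ._^ suc r) #-Fixed))))))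

    degree⇒generates : Generates x
    degree⇒generates S sub base Sx y with spanned y
    ... | v , fv , refl = combination fv
      where
      open IsSubfield sub
      combination : ∀ {n} {v : Vec Carrier n} → VecAll (Fixed 1) v → S (eval v x)
      combination []        = has0
      combination {v = a ∷ _} (fa ∷ fv) = +-closed (base a (trans (sym (σ-1 a)) fa)) (*-closed Sx (combination fv))

  -- Otherwise the fixed set of `σ i` would be a subfield containing F_q and `x`, hence all of K,
  -- although it has at most q^i elements.
  generates⇒degree : ∀ x → Generates x → DegreeAtLeast (suc r) x
  generates⇒degree x gen i i<n 0<i fx = ℕₚ.<⇒≱ (q^-mono i<n)
    (subst (ℕ._≤ q ℕ.^ i) (trans (#-all (Fixed? i) everything) (trans size≡card card≡)) (#-Fixed-≤ i 0<i))
    where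
    everything : ∀ y → Fixed i y
    everything = gen (Fixed i) (Fixed-subfield i) (λ y yFq → Fixed-1⇒Fixed i (trans (σ-1 y) yFq)) fx

-- Parity of factors and powers

factor-of-2^ : ∀ k r c → r ℕ.* c ≡ 2 ℕ.^ k → r ≡ 1 ⊎ 2 ∣ r
factor-of-2^ zero r c eq = inj₁ (ℕₚ.m*n≡1⇒m≡1 r c eq)
factor-of-2^ (suc k) r c eq with euclidsLemma r c prime[2] (divides (2 ℕ.^ k) (trans eq (ℕₚ.*-comm 2 (2 ℕ.^ k))))
... | inj₁ 2∣r = inj₂ 2∣r
... | inj₂ (divides c′ refl) = factor-of-2^ k r c′ (ℕₚ.*-cancelʳ-≡ (r ℕ.* c′) (2 ℕ.^ k) 2
        (trans (ℕₚ.*-assoc r c′ 2) (trans eq (ℕₚ.*-comm 2 (2 ℕ.^ k)))))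

odd⇒1+2h : ∀ n → ¬ 2 ∣ n → ∃ λ h → n ≡ suc (h ℕ.+ h)
odd⇒1+2h zero 2∤n = contradiction (divides 0 refl) 2∤n
odd⇒1+2h (suc zero) 2∤n = 0 , refl
odd⇒1+2h (suc (suc n)) 2∤n with odd⇒1+2h n (λ { (divides j refl) → 2∤n (divides (suc j) refl) })
... | h , refl = suc h , cong (λ z → suc (suc z)) (sym (ℕₚ.+-suc h h))

odd-^ : ∀ n j → ¬ 2 ∣ n → ¬ 2 ∣ n ℕ.^ j
odd-^ n zero 2∤n (divides zero ())
odd-^ n zero 2∤n (divides (suc _) ())
odd-^ n (suc j) 2∤n 2∣ with euclidsLemma n (n ℕ.^ j) prime[2] 2∣
... | inj₁ 2∣n  = 2∤n 2∣n
... | inj₂ 2∣n^ = odd-^ n j 2∤n 2∣n^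

even-^⇒even : ∀ p e → 2 ∣ p ℕ.^ e → 2 ∣ p
even-^⇒even p e 2∣q with 2 ∣? p
... | yes 2∣p = 2∣p
... | no 2∤p  = contradiction 2∣q (odd-^ p e 2∤p)

-- With o = 1 + 2h, the quotient of o^(2t+1) - 1 by o - 1 is a geometric sum of 2t + 1 odd terms and
-- thus odd. Applied to o = Q it shows that (Q^l - 1)/2 is an odd multiple of (Q - 1)/2.
odd-geometric : ∀ h t → ∃ λ u → suc (h ℕ.+ h) ℕ.^ suc (t ℕ.+ t) ≡ suc ((h ℕ.+ h) ℕ.* suc (u ℕ.+ u))
odd-geometric h zero    = 0 , solve 1 (λ h → (con 1 :+ (h :+ h)) :* con 1 := con 1 :+ (h :+ h) :* con 1) refl h
  where open ℕSolver.+-*-Solver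
odd-geometric h (suc t) with odd-geometric h t
... | u , eq = next h u , (begin
    o ℕ.* (o ℕ.* o ℕ.^ (t ℕ.+ suc t))               ≡⟨ cong (λ z → o ℕ.* (o ℕ.* o ℕ.^ z)) (ℕₚ.+-suc t t) ⟩
    o ℕ.* (o ℕ.* o ℕ.^ suc (t ℕ.+ t))               ≡⟨ cong (λ z → o ℕ.* (o ℕ.* z)) eq ⟩
    o ℕ.* (o ℕ.* suc ((h ℕ.+ h) ℕ.* suc (u ℕ.+ u))) ≡⟨ identity h u ⟩
    suc ((h ℕ.+ h) ℕ.* suc (next h u ℕ.+ next h u)) ∎)
  where
  open ≡-Reasoning
  open ℕSolver.+-*-Solver
  o : ℕ
  o = suc (h ℕ.+ h)
  -- If s = 1 + 2u is the old odd factor, the new one is s o^2 + o + 1, because o^2 - 1 = 2h (o +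
  -- 1); `next` is half of it, rounded down.
  next : ℕ → ℕ → ℕ
  next h u = u ℕ.+ suc (u ℕ.+ u) ℕ.* (h ℕ.+ h ℕ.+ (h ℕ.* h ℕ.+ h ℕ.* h)) ℕ.+ suc h
  identity : ∀ h u → suc (h ℕ.+ h) ℕ.* (suc (h ℕ.+ h) ℕ.* suc ((h ℕ.+ h) ℕ.* suc (u ℕ.+ u))) ≡
                     suc ((h ℕ.+ h) ℕ.* suc (next h u ℕ.+ next h u))
  identity = solve 2 (λ h u →
    let o = con 1 :+ (h :+ h)
        s = con 1 :+ (u :+ u)
        v = u :+ s :* (h :+ h :+ (h :* h :+ h :* h)) :+ (con 1 :+ h)
    in o :* (o :* (con 1 :+ (h :+ h) :* s)) := con 1 :+ (h :+ h) :* (con 1 :+ (v :+ v))) refl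

module _ where
  open ℕSolver.+-*-Solver

  double-* : ∀ r d → r ℕ.* d ℕ.+ r ℕ.* d ≡ r ℕ.* 2 ℕ.* d
  double-* = solve 2 (λ r d → r :* d :+ r :* d := r :* con 2 :* d) refl

  square-1+2g : ∀ g → suc (g ℕ.+ g) ℕ.* suc (g ℕ.+ g) ≡ suc (2 ℕ.* ((g ℕ.+ g) ℕ.* suc g))
  square-1+2g = solve 1 (λ g → (con 1 :+ (g :+ g)) :* (con 1 :+ (g :+ g)) :=
    con 1 :+ con 2 :* ((g :+ g) :* (con 1 :+ g))) refl

  double-*′ : ∀ h u → (h ℕ.+ h) ℕ.* u ≡ 2 ℕ.* (h ℕ.* u)
  double-*′ = solve 2 (λ h u → (h :+ h) :* u := con 2 :* (h :* u)) refl

-- The tower F_q, F_Q, K and the pairs (λ , b)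

module Tower (p e k l : ℕ) (pp : Prime p) (1≤e : 1 ℕ.≤ e) (2∤l : ¬ 2 ∣ l) (1<m : 1 ℕ.< 2 ℕ.^ k ℕ.* l)
             (K : FiniteField) (card≡ : FiniteField.card K ≡ (p ℕ.^ e) ℕ.^ (2 ℕ.^ k ℕ.* l)) where
  open Field K public

  q n m Q : ℕ
  q = p ℕ.^ e
  n = 2 ℕ.^ k
  m = n ℕ.* l
  Q = q ℕ.^ n

  1<p : 1 ℕ.< p
  1<p = ℕ.nonTrivial⇒n>1 p {{prime⇒nonTrivial pp}}

  1<q : 1 ℕ.< q
  1<q = ℕₚ.^-monoʳ-< p 1<p 1≤e

  0<n : 0 ℕ.< n
  0<n = ℕ.>-nonZero⁻¹ n {{ℕₚ.m^n≢0 2 k}}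

  0<l : 0 ℕ.< l
  0<l = ℕₚ.n≢0⇒n>0 (λ l≡0 → 2∤l (divides 0 l≡0))

  0<m : 0 ℕ.< m
  0<m = ℕₚ.<-trans (ℕ.s≤s ℕ.z≤n) 1<m

  1<Q : 1 ℕ.< Q
  1<Q = ℕₚ.^-monoʳ-< q 1<q 0<n

  suc-pred-l : suc (ℕ.pred l) ≡ l
  suc-pred-l = ℕₚ.suc-pred l {{ℕ.>-nonZero 0<l}}

  suc-pred-m : suc (ℕ.pred m) ≡ m
  suc-pred-m = ℕₚ.suc-pred m {{ℕ.>-nonZero 0<m}}

  open Characteristic {p} {e ℕ.* m} pp (trans card≡ (ℕₚ.^-*-assoc p e m)) public

  module φ = FrobeniusPower K q 1<q (frobenius^ e)
  module Φ = FrobeniusPower K Q 1<Q (φ.σ-+ n)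

  card≡q^ : card ≡ q ℕ.^ suc (ℕ.pred m)
  card≡q^ = trans card≡ (cong (q ℕ.^_) (sym suc-pred-m))

  card≡Q^l : card ≡ Q ℕ.^ l
  card≡Q^l = trans card≡ (sym (ℕₚ.^-*-assoc q n l))

  card≡Q^ : card ≡ Q ℕ.^ suc (ℕ.pred l)
  card≡Q^ = trans card≡Q^l (cong (Q ℕ.^_) (sym suc-pred-l))

  module φW = φ.Whole (ℕ.pred m) card≡q^
  module ΦW = Φ.Whole (ℕ.pred l) card≡Q^

  Φσ≡φσ : ∀ j x → Φ.σ j x ≡ φ.σ (n ℕ.* j) x
  Φσ≡φσ j x = cong (x ^ᶠ_) (ℕₚ.^-*-assoc q n j)

  φ-Fixed-m : ∀ x → φ.Fixed m x
  φ-Fixed-m x = subst (λ j → φ.Fixed j x) suc-pred-m (φW.Fixed-all x)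

  Φ-Fixed-l : ∀ x → Φ.Fixed l x
  Φ-Fixed-l x = subst (λ j → Φ.Fixed j x) suc-pred-l (ΦW.Fixed-all x)

  φ-Fixed-1⇒Φ-Fixed : ∀ {x} i → φ.Fixed 1 x → Φ.Fixed i x
  φ-Fixed-1⇒Φ-Fixed i fx = trans (Φσ≡φσ i _) (φ.Fixed-1⇒Fixed (n ℕ.* i) fx)

  degree-m⇒degree-l : ∀ {x} → φ.DegreeAtLeast m x → Φ.DegreeAtLeast l x
  degree-m⇒degree-l deg i i<l 0<i fx = deg (n ℕ.* i) (ℕₚ.*-monoʳ-< n {{ℕ.>-nonZero 0<n}} i<l)
    (ℕₚ.*-mono-≤ 0<n 0<i) (trans (sym (Φσ≡φσ i _)) fx)

  -- An element of degree l over F_Q has degree m/r over F_q with r dividing 2^k;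
  -- if r ≠ 1 then r is even.
  degree-l⇒degree-m : ∀ {x} → Φ.DegreeAtLeast l x → φ.DegreeAtLeast m x ⊎ (∃ λ h → h ℕ.+ h ≡ m × φ.Fixed h x)
  degree-l⇒degree-m {x} deg = split
    where
    per = φ.period m x 0<m (φ-Fixed-m x)
    d = proj₁ per
    open φ.Period (proj₂ per) using (divides-all; minimal; fixed)
    Φ-period : Φ.Period x l
    Φ-period = record { positive = 0<l ; fixed = Φ-Fixed-l x ; minimal = λ i 0<i i<l → deg i i<l 0<i }
    l∣d : l ∣ d
    l∣d = Φ.divides-all Φ-period d (trans (Φσ≡φσ d x) (φ.Fixed-multiple n d fixed))
    split : φ.DegreeAtLeast m x ⊎ (∃ λ h → h ℕ.+ h ≡ m × φ.Fixed h x)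
    split with divides-all m (φ-Fixed-m x) | l∣d
    ... | divides r m≡rd | divides c d≡cl with factor-of-2^ k r c (ℕₚ.*-cancelʳ-≡ (r ℕ.* c) n l {{ℕ.>-nonZero 0<l}}
            (trans (ℕₚ.*-assoc r c l) (sym (trans m≡rd (cong (r ℕ.*_) d≡cl)))))
    ...   | inj₁ refl = inj₁ (λ i i<m 0<i → minimal i 0<i (subst (i ℕ.<_) (trans m≡rd (ℕₚ.*-identityˡ d)) i<m))
    ...   | inj₂ (divides r′ refl) = inj₂ (r′ ℕ.* d , trans (double-* r′ d) (sym m≡rd) , φ.Fixed-multiple r′ d fixed)

  -- X² - λg(X) with g = 1 + bX has a root in K.
  HasRoot : Carrier → Carrier → Set
  HasRoot λ′ b = ∃ λ x → x * x ≡ λ′ * (1# + b * x)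

  HasRoot? : ∀ λ′ b → Dec (HasRoot λ′ b)
  HasRoot? λ′ b = ∃? (λ x → (x * x) ≟ (λ′ * (1# + b * x)))

  pairs : Finite (Carrier × Carrier)
  pairs = ×-finite finite finite

  Good : Carrier × Carrier → Set
  Good (λ′ , b) = φ.DegreeAtLeast m λ′ × φ.Fixed 1 b × ¬ HasRoot λ′ b

  Good? : Decidable Good
  Good? (λ′ , b) = φ.DegreeAtLeast? m λ′ ×-dec (φ.Fixed? 1 b ×-dec ¬? (HasRoot? λ′ b))

  -- The last two numbers differ only for l = 1, where the degree condition is vacuous and 0
  -- satisfies it. Nonsquares are compared with nonzero elements, traces with all elements; this is
  -- the origin of q^m - 1 for q odd against q^m for q even.
  #Good #Degree-l #Degree-l* : ℕ
  #Good = Finite.# pairs Good?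
  #Degree-l = # (Φ.DegreeAtLeast? l)
  #Degree-l* = # (λ x → Φ.DegreeAtLeast? l x ×-dec ¬? (x ≟ 0#))

  -- Odd q: nonsquares

  module Odd (2∤q : ¬ 2 ∣ q) where

    2∤p : ¬ 2 ∣ p
    2∤p 2∣p = 2∤q (∣-^ e 1≤e)
      where
      ∣-^ : ∀ e → 1 ℕ.≤ e → 2 ∣ p ℕ.^ e
      ∣-^ (suc e) _ = ∣-trans 2∣p (m∣m*n (p ℕ.^ e))

    two : Carrier
    two = 1# + 1#

    two≢0 : ¬ two ≡ 0#
    two≢0 = 2∤p⇒1+1≢0 2∤p

    -1≢1 : ¬ - 1# ≡ 1#
    -1≢1 eq = two≢0 (trans (cong (_+ 1#) (sym eq)) (-‿inverseˡ 1#))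

    abstract
      half : ∃ λ h → card ≡ suc (h ℕ.+ h)
      half = odd⇒1+2h card (λ 2∣card → odd-^ q m 2∤q (subst (2 ∣_) card≡ 2∣card))

    H : ℕ
    H = proj₁ half

    card≡1+2H : card ≡ suc (H ℕ.+ H)
    card≡1+2H = proj₂ half

    0<H : 0 ℕ.< H
    0<H = ℕₚ.n≢0⇒n>0 (λ H≡0 → ℕₚ.n≮n 1 (subst (1 ℕ.<_) (trans (sym card≡q^)
        (trans card≡1+2H (cong (λ h → suc (h ℕ.+ h)) H≡0)))
      (ℕₚ.^-monoʳ-< q 1<q {0} {suc (ℕ.pred m)} (ℕ.s≤s ℕ.z≤n))))

    -- The hypothesis has the form in which both `fermat` and membership in F_Q supply it.
    x^2h≡1⇒±1 : ∀ {x} h → ¬ x ≡ 0# → x * x ^ᶠ (h ℕ.+ h) ≡ x → x ^ᶠ h ≡ 1# ⊎ x ^ᶠ h ≡ - 1#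
    x^2h≡1⇒±1 {x} h x≢0 eq with integral {x ^ᶠ h - 1#} {x ^ᶠ h + 1#} (trans
        (solve 1 (λ y → (y :- con 1ℤ) :* (y :+ con 1ℤ) := y :* y :- con 1ℤ) refl (x ^ᶠ h))
        (x≡y⇒x-y≡0 (trans (sym (^-+ x h h)) (*-cancelˡ x≢0 (trans eq (sym (*-identityʳ x)))))))
    ... | inj₁ y-1≡0 = inj₁ (x-y≡0⇒x≡y y-1≡0)
    ... | inj₂ y+1≡0 = inj₂ (+-cancelʳ 1# (trans y+1≡0 (sym (-‿inverseˡ 1#))))

    ±1 : ∀ x → ¬ x ≡ 0# → x ^ᶠ H ≡ 1# ⊎ x ^ᶠ H ≡ - 1#
    ±1 x x≢0 = x^2h≡1⇒±1 H x≢0 (trans (cong (x ^ᶠ_) (sym card≡1+2H)) (fermat x))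

    #-^≡1 : ∀ h → 0 ℕ.< h → # (λ x → (x ^ᶠ h) ≟ 1#) ℕ.≤ h
    #-^≡1 (suc h) _ = ℕₚ.≤-trans (#-mono (λ x → (x ^ᶠ suc h) ≟ 1#) (λ x → (x ^ᶠ suc h + - 1#) ≟ 0#) (λ x → x≡y⇒x-y≡0))
      (roots-≤ (Monic-+c (- 1#) (Monic-^ (suc h))))

    -- Squaring sends the 2H nonzero elements into the roots of x^H = 1, at most two to each point.
    -- There are at most H such roots, so each of them is hit.
    ^H≡1⇒square : ∀ x → x ^ᶠ H ≡ 1# → ∃ λ y → y * y ≡ x
    ^H≡1⇒square x x^H≡1 = proj₁ preimage , proj₂ (proj₂ preimage)
      where
      nonzero? = λ (y : Carrier) → ¬? (y ≟ 0#)
      S? = λ (y : Carrier) → (y ^ᶠ H) ≟ 1#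
      sq : Carrier → Carrier
      sq y = y * y
      into : ∀ y → ¬ y ≡ 0# → sq y ^ᶠ H ≡ 1#
      into y y≢0 = *-cancelˡ y≢0 (trans (cong (y *_) (trans (^-distrib-* y y H) (sym (^-+ y H H))))
        (trans (cong (y ^ᶠ_) (sym card≡1+2H)) (trans (fermat y) (sym (*-identityʳ y)))))
      monic : ∀ b → Monic 2 (λ y → y * y + - b)
      monic b = step (- b) (step 0# (one (λ _ → refl)) (λ y → sym (trans (+-identityʳ _) (*-identityʳ y))))
          (λ _ → refl)
      bound : ∀ b → b ^ᶠ H ≡ 1# → # (fibre? finite finite nonzero? sq b) ℕ.≤ 2
      bound b _ = ℕₚ.≤-trans (#-mono (fibre? finite finite nonzero? sq b) (λ y → (y * y + - b) ≟ 0#)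
          (λ y h → x≡y⇒x-y≡0 (proj₂ h))) (roots-≤ (monic b))
      large : # S? ℕ.* 2 ℕ.≤ # nonzero?
      large = ℕₚ.≤-trans (ℕₚ.*-monoˡ-≤ 2 (#-^≡1 H 0<H)) (ℕₚ.≤-reflexive
          (trans (trans (ℕₚ.*-comm H 2) (cong (H ℕ.+_) (ℕₚ.+-identityʳ H)))
        (ℕₚ.suc-injective (trans (sym card≡1+2H) card≡1+nonzero))))
      preimage : ∃ λ y → ¬ y ≡ 0# × sq y ≡ x
      preimage = #-surjective finite finite nonzero? S? sq into 2 (ℕ.s≤s ℕ.z≤n) bound large x x^H≡1

    square⇒^H≡1 : ∀ y x → ¬ x ≡ 0# → y * y ≡ x → x ^ᶠ H ≡ 1#
    square⇒^H≡1 y x x≢0 refl = *-cancelˡ y≢0 (trans (cong (y *_) (trans (^-distrib-* y y H) (sym (^-+ y H H))))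
        (trans (cong (y ^ᶠ_) (sym card≡1+2H)) (trans (fermat y) (sym (*-identityʳ y)))))
      where
      y≢0 : ¬ y ≡ 0#
      y≢0 refl = x≢0 (zeroˡ 0#)

    -- Euler's criterion taken as the definition: decidable, compatible with products, and false at
    -- 0.
    NonSquare : Carrier → Set
    NonSquare x = x ^ᶠ H ≡ - 1#

    NonSquare? : Decidable NonSquare
    NonSquare? x = (x ^ᶠ H) ≟ (- 1#)

    NonSquare⇒nonzero : ∀ {x} → NonSquare x → ¬ x ≡ 0#
    NonSquare⇒nonzero ns refl = 0≢1 (trans (solve 0 (con 0ℤ := :- con 0ℤ) refl)
      (trans (cong -_ (trans (sym (0^ H 0<H)) ns)) (solve 0 (:- (:- con 1ℤ) := con 1ℤ) refl)))

    -- With q^h = 1 + 2g and 2h = m, the exponent H = (q^m - 1)/2 equals 2g (g + 1), a multiple of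
    -- q^h - 1. Hence x^H = 1 for every nonzero `x` of the field of q^h elements.
    nonsquare-degree : ∀ {x} → NonSquare x → Φ.DegreeAtLeast l x → φ.DegreeAtLeast m x
    nonsquare-degree {x} ns deg with degree-l⇒degree-m deg
    ... | inj₁ deg′ = deg′
    ... | inj₂ (h , 2h≡m , fx) = contradiction (trans (sym ns) x^H≡1) -1≢1
      where
      x≢0 = NonSquare⇒nonzero ns
      odd-q^h = odd⇒1+2h (q ℕ.^ h) (odd-^ q h 2∤q)
      g = proj₁ odd-q^h
      g-eq : q ℕ.^ h ≡ suc (g ℕ.+ g)
      g-eq = proj₂ odd-q^h
      H≡ : H ≡ (g ℕ.+ g) ℕ.* suc g
      H≡ = ℕₚ.*-cancelˡ-≡ H _ 2 (ℕₚ.suc-injective (trans (cong suc (cong (H ℕ.+_) (ℕₚ.+-identityʳ H)))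
          (trans (sym card≡1+2H) (trans card≡
        (trans (cong (q ℕ.^_) (sym 2h≡m)) (trans (ℕₚ.^-distribˡ-+-* q h h) (trans (cong₂ ℕ._*_ g-eq g-eq)
          (square-1+2g g))))))))
      x^2g≡1 : x ^ᶠ (g ℕ.+ g) ≡ 1#
      x^2g≡1 = *-cancelˡ x≢0 (trans (trans (cong (x ^ᶠ_) (sym g-eq)) fx) (sym (*-identityʳ x)))
      x^H≡1 : x ^ᶠ H ≡ 1#
      x^H≡1 = trans (cong (x ^ᶠ_) H≡) (trans (^-* x (g ℕ.+ g) (suc g)) (trans (cong (_^ᶠ suc g) x^2g≡1) (1^ (suc g))))

    F*? : Decidable (λ x → Φ.Fixed 1 x × ¬ x ≡ 0#)
    F*? x = Φ.Fixed? 1 x ×-dec ¬? (x ≟ 0#)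

    #F* : # F*? ≡ ℕ.pred Q
    #F* = cong ℕ.pred (trans (sym (#-remove (Φ.Fixed? 1) (Φ.Fixed-0# 1))) ΦW.#-Fixed)

    -- The equation x^h = 1 has at most h solutions, too few for the 2h nonzero elements of F_Q.
    non-root : ∀ h → 0 ℕ.< h → Q ≡ suc (h ℕ.+ h) → ∃ λ c → (Φ.Fixed 1 c × ¬ c ≡ 0#) × ¬ (c ^ᶠ h ≡ 1#)
    non-root h 0<h Q≡ = witness (λ x → F*? x ×-dec ¬? (R? x)) (ℕₚ.n≢0⇒n>0 λ none → ℕₚ.<⇒≱ (ℕₚ.m<m+n h 0<h) (few none))
      where
      R? : Decidable (λ x → x ^ᶠ h ≡ 1#)
      R? x = (x ^ᶠ h) ≟ 1#
      few : # (λ x → F*? x ×-dec ¬? (R? x)) ≡ 0 → h ℕ.+ h ℕ.≤ h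
      few none = begin
        h ℕ.+ h ≡⟨ trans #F* (cong ℕ.pred Q≡) ⟨
        # F*? ≡⟨ #-split F*? R? ⟩
        # (λ x → F*? x ×-dec R? x) ℕ.+ # (λ x → F*? x ×-dec ¬? (R? x)) ≡⟨ cong (# (λ x → F*? x ×-dec R? x) ℕ.+_)
            none ⟩
        # (λ x → F*? x ×-dec R? x) ℕ.+ 0 ≡⟨ ℕₚ.+-identityʳ _ ⟩
        # (λ x → F*? x ×-dec R? x) ≤⟨ #-mono (λ x → F*? x ×-dec R? x) R? (λ _ → proj₂) ⟩
        # R? ≤⟨ #-^≡1 h 0<h ⟩
        h ∎
        where open ℕₚ.≤-Reasoning

    -1^even : ∀ u → (- 1#) ^ᶠ (u ℕ.+ u) ≡ 1#
    -1^even u = trans (^-+ (- 1#) u u) (trans (sym (^-distrib-* (- 1#) (- 1#) u))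
      (trans (cong (_^ᶠ u) (solve 0 ((:- con 1ℤ) :* (:- con 1ℤ) := con 1ℤ) refl)) (1^ u)))

    H≡odd-multiple : ∀ h t → Q ≡ suc (h ℕ.+ h) → l ≡ suc (t ℕ.+ t) → ∃ λ u → H ≡ h ℕ.* suc (u ℕ.+ u)
    H≡odd-multiple h t Q≡ l≡ with odd-geometric h t
    ... | u , eq = u , ℕₚ.*-cancelˡ-≡ H _ 2 (ℕₚ.suc-injective
        (trans (cong suc (cong (H ℕ.+_) (ℕₚ.+-identityʳ H))) (trans (sym card≡1+2H)
        (trans card≡Q^l (trans (cong₂ ℕ._^_ Q≡ l≡) (trans eq (cong suc (double-*′ h (suc (u ℕ.+ u))))))))))

    ^h≡-1⇒NonSquare : ∀ {c} h u → H ≡ h ℕ.* suc (u ℕ.+ u) → c ^ᶠ h ≡ - 1# → NonSquare c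
    ^h≡-1⇒NonSquare {c} h u H≡ eq = trans (cong (c ^ᶠ_) H≡) (trans (^-* c h (suc (u ℕ.+ u)))
        (trans (cong (_^ᶠ suc (u ℕ.+ u)) eq)
        (trans (cong ((- 1#) *_) (-1^even u)) (*-identityʳ _))))

    abstract
      -- Some `c` in F_Q has c^h = -1 for h = (Q - 1)/2. As l is odd, H is an odd multiple of h, and
      -- an odd power of -1 is -1.
      nonsquare-in-F_Q : ∃ λ c → Φ.Fixed 1 c × NonSquare c
      nonsquare-in-F_Q = from-halves (odd⇒1+2h Q (odd-^ q n 2∤q)) (odd⇒1+2h l 2∤l)
        where
        from-halves : (∃ λ h → Q ≡ suc (h ℕ.+ h)) → (∃ λ t → l ≡ suc (t ℕ.+ t)) → ∃ λ c → Φ.Fixed 1 c × NonSquare c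
        from-halves (h , Q≡) (t , l≡) = from-non-root (non-root h 0<h Q≡)
          where
          0<h : 0 ℕ.< h
          0<h = ℕₚ.n≢0⇒n>0 (λ h≡0 → ℕₚ.n≮n 1 (subst (1 ℕ.<_) (trans Q≡ (cong (λ h → suc (h ℕ.+ h)) h≡0)) 1<Q))
          from-non-root : (∃ λ c → (Φ.Fixed 1 c × ¬ c ≡ 0#) × ¬ (c ^ᶠ h ≡ 1#)) → ∃ λ c → Φ.Fixed 1 c × NonSquare c
          from-non-root (c , (Fc , c≢0) , c^h≢1) = c , Fc , [ (λ eq → contradiction eq c^h≢1) , ^h≡-1⇒NonSquare h
              (proj₁ multiple) (proj₂ multiple) ]′
            (x^2h≡1⇒±1 h c≢0 (trans (cong (c ^ᶠ_) (sym Q≡)) (trans (sym (Φ.σ-1 c)) Fc)))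
            where
            multiple : ∃ λ u → H ≡ h ℕ.* suc (u ℕ.+ u)
            multiple = H≡odd-multiple h t Q≡ l≡

    #NonSquare-degree-l : # (λ x → Φ.DegreeAtLeast? l x ×-dec NonSquare? x) ℕ.+ #
        (λ x → Φ.DegreeAtLeast? l x ×-dec NonSquare? x) ≡ #Degree-l*
    #NonSquare-degree-l = sym (trans (#-split D*? NonSquare?) (cong₂ ℕ._+_
      (#-cong (λ x → D*? x ×-dec NonSquare? x) N? (λ _ → λ { ((d , _) , ns) → d , ns })
          (λ _ → λ { (d , ns) → (d , NonSquare⇒nonzero ns) , ns }))
      (ℕₚ.≤-antisym
        (#-injection finite finite (λ x → D*? x ×-dec ¬? (NonSquare? x)) N? (c *_)
          (λ x → λ { ((d , x≢0) , ¬ns) → (scaled d) , trans (^-distrib-* c x H)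
              (trans (cong₂ _*_ ns (square x x≢0 ¬ns)) (*-identityʳ _)) })
          (λ x y _ _ → *-cancelˡ c≢0))
        (#-injection finite finite N? (λ x → D*? x ×-dec ¬? (NonSquare? x)) (c *_)
          (λ x → λ { (d , nsx) → ((scaled d) , *-nonzero c≢0 (NonSquare⇒nonzero nsx)) ,
             λ nscx → -1≢1 (trans (sym nscx) (trans (^-distrib-* c x H)
                 (trans (cong₂ _*_ ns nsx) (solve 0 ((:- con 1ℤ) :* (:- con 1ℤ) := con 1ℤ) refl)))) })
          (λ x y _ _ → *-cancelˡ c≢0)))))
      where
      D*? = λ x → Φ.DegreeAtLeast? l x ×-dec ¬? (x ≟ 0#)
      N? = λ x → Φ.DegreeAtLeast? l x ×-dec NonSquare? x
      c = proj₁ nonsquare-in-F_Q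
      ns = proj₂ (proj₂ nonsquare-in-F_Q)
      c≢0 = NonSquare⇒nonzero ns
      scaled : ∀ {x} → Φ.DegreeAtLeast l x → Φ.DegreeAtLeast l (c * x)
      scaled d = Φ.DegreeAtLeast-* c≢0 (proj₁ (proj₂ nonsquare-in-F_Q)) d
      square : ∀ x → ¬ x ≡ 0# → ¬ NonSquare x → x ^ᶠ H ≡ 1#
      square x x≢0 ¬ns = [ (λ eq → eq) , (λ eq → contradiction eq ¬ns) ]′ (±1 x x≢0)

    -- The discriminant λ^2 b^2 + 4λ of X^2 - λbX - λ, divided by the square λ^2.
    ν : Carrier → Carrier → Carrier
    ν λ′ b = two * two * λ′ ⁻¹ + b * b

    root⇒ν-square : ∀ λ′ b → ¬ λ′ ≡ 0# → HasRoot λ′ b → ∃ λ y → y * y ≡ ν λ′ b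
    -- The derivative 2x - λb of the quadratic at its root, divided by λ, is a square root of the
    -- scaled discriminant.
    root⇒ν-square λ′ b λ≢0 (x , eq) = (x + x) * i - b , (begin
      ((x + x) * i - b) * ((x + x) * i - b)
        ≡⟨ solve 3 (λ x i b → ((x :+ x) :* i :- b) :* ((x :+ x) :* i :- b) :=
             (t :* t :* i :* i) :* (x :* x) :- t :* t :* x :* i :* b :+ b :* b) refl x i b ⟩
      (two * two * i * i) * (x * x) - two * two * x * i * b + b * b
        ≡⟨ cong (λ z → (two * two * i * i) * z - two * two * x * i * b + b * b) eq ⟩
      (two * two * i * i) * (λ′ * (1# + b * x)) - two * two * x * i * b + b * b
        ≡⟨ solve 4 (λ x i b l → (t :* t :* i :* i) :* (l :* (con 1ℤ :+ b :* x)) :- t :* t :* x :* i :* b :+ b :* b :=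
             (t :* t :* i) :* (con 1ℤ :+ b :* x) :* (l :* i) :- t :* t :* x :* i :* b :+ b :* b) refl x i b λ′ ⟩
      (two * two * i) * (1# + b * x) * (λ′ * i) - two * two * x * i * b + b * b
        ≡⟨ cong (λ z → (two * two * i) * (1# + b * x) * z - two * two * x * i * b + b * b) (*-inverseʳ λ≢0) ⟩
      (two * two * i) * (1# + b * x) * 1# - two * two * x * i * b + b * b
        ≡⟨ solve 3 (λ x i b → (t :* t :* i) :* (con 1ℤ :+ b :* x) :* con 1ℤ :- t :* t :* x :* i :* b :+ b :* b := t :*
            t :* i :+ b :* b) refl x i b ⟩
      ν λ′ b ∎)
      where
      open ≡-Reasoning
      i = λ′ ⁻¹
      t : ∀ {n} → Polynomial n
      t = con 1ℤ :+ con 1ℤ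

    ν-square⇒root : ∀ λ′ b → ¬ λ′ ≡ 0# → ∀ y → y * y ≡ ν λ′ b → HasRoot λ′ b
    -- The quadratic formula: the root is (λb + λy)/2, where `s` is one half.
    ν-square⇒root λ′ b λ≢0 y eq = λ′ * (s * (b + y)) , (begin
      λ′ * (s * (b + y)) * (λ′ * (s * (b + y)))
        ≡⟨ solve 4 (λ l s b y → l :* (s :* (b :+ y)) :* (l :* (s :* (b :+ y))) := l :* l :* (s :* s) :*
            (b :* b :+ t :* b :* y :+ y :* y)) refl λ′ s b y ⟩
      λ′ * λ′ * (s * s) * (b * b + two * b * y + y * y)
        ≡⟨ cong (λ z → λ′ * λ′ * (s * s) * (b * b + two * b * y + z)) eq ⟩
      λ′ * λ′ * (s * s) * (b * b + two * b * y + (two * two * i + b * b))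
        ≡⟨ solve 5 (λ l s b y i → l :* l :* (s :* s) :* (b :* b :+ t :* b :* y :+ (t :* t :* i :+ b :* b)) :=
             l :* l :* s :* (t :* s) :* b :* (b :+ y) :+ l :* (l :* i) :* (t :* s) :* (t :* s)) refl λ′ s b y i ⟩
      λ′ * λ′ * s * (two * s) * b * (b + y) + λ′ * (λ′ * i) * (two * s) * (two * s)
        ≡⟨ cong₂ (λ z w → λ′ * λ′ * s * z * b * (b + y) + λ′ * w * z * z) (*-inverseʳ two≢0) (*-inverseʳ λ≢0) ⟩
      λ′ * λ′ * s * 1# * b * (b + y) + λ′ * 1# * 1# * 1#
        ≡⟨ solve 4 (λ l s b y → l :* l :* s :* con 1ℤ :* b :* (b :+ y) :+ l :* con 1ℤ :* con 1ℤ :* con 1ℤ :=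
             l :* (con 1ℤ :+ b :* (l :* (s :* (b :+ y))))) refl λ′ s b y ⟩
      λ′ * (1# + b * (λ′ * (s * (b + y)))) ∎)
      where
      open ≡-Reasoning
      i = λ′ ⁻¹
      s = two ⁻¹
      t : ∀ {n} → Polynomial n
      t = con 1ℤ :+ con 1ℤ


    #Good-odd : 2 ℕ.* #Good ≡ #Degree-l* ℕ.* q
    #Good-odd = begin
      2 ℕ.* #Good                              ≡⟨ cong (2 ℕ.*_) Good≡ ⟩
      2 ℕ.* (# N? ℕ.* # (φ.Fixed? 1))           ≡⟨ ℕₚ.*-assoc 2 (# N?) _ ⟨
      2 ℕ.* # N? ℕ.* # (φ.Fixed? 1)             ≡⟨ cong₂ ℕ._*_
          (trans (cong (# N? ℕ.+_) (ℕₚ.+-identityʳ _)) #NonSquare-degree-l) φW.#-Fixed ⟩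
      #Degree-l* ℕ.* q                         ∎
      where
      open ≡-Reasoning
      N? : Decidable (λ x → Φ.DegreeAtLeast l x × NonSquare x)
      N? x = Φ.DegreeAtLeast? l x ×-dec NonSquare? x
      four≢0 : ¬ two * two ≡ 0#
      four≢0 = *-nonzero two≢0 two≢0
      Fixed-two : φ.Fixed 1 two
      Fixed-two = φ.Fixed-+ 1 (φ.Fixed-1# 1) (φ.Fixed-1# 1)
      to from : Carrier × Carrier → Carrier × Carrier
      to (λ′ , b) = ν λ′ b , b
      -- Solves x = 4/λ + b^2 for λ.
      from (x , b) = ((two * two) ⁻¹ * (x - b * b)) ⁻¹ , b
      from-to : ∀ a → Good a → from (to a) ≡ a
      from-to (λ′ , b) (deg , _) = cong (_, b) (trans (cong _⁻¹ (trans (cong ((two * two) ⁻¹ *_)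
        (solve 2 (λ x y → (x :+ y) :- y := x) refl (two * two * λ′ ⁻¹) (b * b))) (inverse-cancelˡ (λ′ ⁻¹) four≢0)))
        (⁻¹-involutive (φ.DegreeAtLeast⇒nonzero 1<m deg)))
      unscaled : ∀ {x b} → φ.Fixed 1 b → φ.DegreeAtLeast m x → φ.DegreeAtLeast m ((two * two) ⁻¹ * (x - b * b))
      unscaled fb deg = φ.DegreeAtLeast-* (⁻¹-nonzero four≢0) (φ.Fixed-⁻¹ 1 four≢0 (φ.Fixed-* 1 Fixed-two Fixed-two))
        (φ.DegreeAtLeast-+ (φ.Fixed-neg 1 (φ.Fixed-* 1 fb fb)) deg)
      to-from : ∀ a → (Φ.DegreeAtLeast l (proj₁ a) × NonSquare (proj₁ a)) × φ.Fixed 1 (proj₂ a) → to (from a) ≡ a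
      to-from (x , b) ((deg , ns) , fb) = cong (_, b) (trans (cong (λ z → two * two * z + b * b)
          (⁻¹-involutive (φ.DegreeAtLeast⇒nonzero 1<m (unscaled fb (nonsquare-degree ns deg)))))
        (trans (cong (_+ b * b) (trans (sym (*-assoc _ _ _))
            (trans (cong (_* (x - b * b)) (*-inverseʳ four≢0)) (*-identityˡ _))))
          (solve 2 (λ x y → (x :- y) :+ y := x) refl x (b * b))))
      ν-degree : ∀ {λ′ b} → φ.Fixed 1 b → φ.DegreeAtLeast m λ′ → φ.DegreeAtLeast m (ν λ′ b)
      ν-degree fb deg = φ.DegreeAtLeast-+ (φ.Fixed-* 1 fb fb)
          (φ.DegreeAtLeast-* four≢0 (φ.Fixed-* 1 Fixed-two Fixed-two)
        (φ.DegreeAtLeast-⁻¹ (φ.DegreeAtLeast⇒nonzero 1<m deg) deg))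
      into : ∀ a → Good a → (Φ.DegreeAtLeast l (proj₁ (to a)) × NonSquare (proj₁ (to a))) × φ.Fixed 1 (proj₂ (to a))
      into (λ′ , b) (deg , fb , noRoot) = ((degree-m⇒degree-l (ν-degree fb deg)) , nonsquare) , fb
        where
        λ≢0 : ¬ λ′ ≡ 0#
        λ≢0 = φ.DegreeAtLeast⇒nonzero 1<m deg
        nonsquare : NonSquare (ν λ′ b)
        nonsquare = [ (λ eq → contradiction (λ-root (^H≡1⇒square _ eq)) noRoot) , (λ eq → eq) ]′
          (±1 (ν λ′ b) (φ.DegreeAtLeast⇒nonzero 1<m (ν-degree fb deg)))
          where
          λ-root : (∃ λ y → y * y ≡ ν λ′ b) → HasRoot λ′ b
          λ-root (y , eq) = ν-square⇒root λ′ b λ≢0 y eq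
      back : ∀ a → (Φ.DegreeAtLeast l (proj₁ a) × NonSquare (proj₁ a)) × φ.Fixed 1 (proj₂ a) → Good (from a)
      back (x , b) ((deg , ns) , fb) = deg′ , fb , noRoot
        where
        x′ = (two * two) ⁻¹ * (x - b * b)
        x′≢0 : ¬ x′ ≡ 0#
        x′≢0 = φ.DegreeAtLeast⇒nonzero 1<m (unscaled fb (nonsquare-degree ns deg))
        deg′ : φ.DegreeAtLeast m (x′ ⁻¹)
        deg′ = φ.DegreeAtLeast-⁻¹ x′≢0 (unscaled fb (nonsquare-degree ns deg))
        noRoot : ¬ HasRoot (x′ ⁻¹) b
        noRoot root = -1≢1 (trans (sym ns) (is-square (root⇒ν-square (x′ ⁻¹) b (⁻¹-nonzero x′≢0) root)))
          where
          is-square : (∃ λ y → y * y ≡ ν (x′ ⁻¹) b) → x ^ᶠ H ≡ 1#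
          is-square (y , eq) = square⇒^H≡1 y x (NonSquare⇒nonzero ns)
              (trans eq (cong proj₁ (to-from (x , b) ((deg , ns) , fb))))
      Good≡ : #Good ≡ # N? ℕ.* # (φ.Fixed? 1)
      Good≡ = trans (#-bijection pairs pairs Good? (λ a → N? (proj₁ a) ×-dec φ.Fixed? 1 (proj₂ a)) to from into back
          from-to to-from)
        (#-× finite finite N? (φ.Fixed? 1))

  -- Even q: traces and the Artin-Schreier equation

  module Even (2∣q : 2 ∣ q) where

    p≡2 : p ≡ 2
    p≡2 = [ (λ ()) , sym ]′ (prime⇒irreducible pp (even-^⇒even p e 2∣q))

    char-2 : ∀ x → x + x ≡ 0#
    char-2 x = trans (solve 1 (λ x → x :+ x := (con 1ℤ :+ con 1ℤ) :* x) refl x)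
      (trans (cong (_* x) (2∣p⇒1+1≡0 (even-^⇒even p e 2∣q))) (zeroˡ x))

    square-+ : ∀ x y → (x + y) ^ᶠ 2 ≡ x ^ᶠ 2 + y ^ᶠ 2
    square-+ x y = trans (solve 2 (λ x y → (x :+ y) :* ((x :+ y) :* con 1ℤ) :=
        (x :* (x :* con 1ℤ) :+ y :* (y :* con 1ℤ)) :+ (x :* y :+ x :* y)) refl x y)
      (trans (cong ((x ^ᶠ 2 + y ^ᶠ 2) +_) (char-2 (x * y))) (+-identityʳ _))

    -- A second Frobenius, over the prime field: solvability of y^2 - y = z in K is governed by the
    -- trace to F_2, while degrees refer to F_q.
    module ψ = FrobeniusPower K 2 (ℕ.s≤s (ℕ.s≤s ℕ.z≤n)) square-+

    q≡2^e : q ≡ 2 ℕ.^ e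
    q≡2^e = cong (ℕ._^ e) p≡2

    suc-pred-em : suc (ℕ.pred (e ℕ.* m)) ≡ e ℕ.* m
    suc-pred-em = ℕₚ.suc-pred (e ℕ.* m) {{ℕ.>-nonZero (ℕₚ.*-mono-≤ 1≤e 0<m)}}

    card≡2^ : card ≡ 2 ℕ.^ suc (ℕ.pred (e ℕ.* m))
    card≡2^ = trans card≡ (trans (cong (ℕ._^ m) q≡2^e) (trans (ℕₚ.^-*-assoc 2 e m) (cong (2 ℕ.^_) (sym suc-pred-em))))

    module ψW = ψ.Whole (ℕ.pred (e ℕ.* m)) card≡2^

    φσ≡ψσ : ∀ j x → φ.σ j x ≡ ψ.σ (e ℕ.* j) x
    φσ≡ψσ j x = cong (x ^ᶠ_) (trans (cong (ℕ._^ j) q≡2^e) (ℕₚ.^-*-assoc 2 e j))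

    φ-Fixed-1⇒ψ-Fixed-e : ∀ {x} → φ.Fixed 1 x → ψ.Fixed e x
    φ-Fixed-1⇒ψ-Fixed-e {x} fx = trans (trans (cong (λ j → ψ.σ j x) (sym (ℕₚ.*-identityʳ e))) (sym (φσ≡ψσ 1 x))) fx

    -- The traces from K to F_q, from K to F_2 and from F_q to F_2; the last is a trace only on
    -- elements of F_q.
    T t τ : Carrier → Carrier
    T = φ.Tr m
    t = ψ.Tr (e ℕ.* m)
    τ = ψ.Tr e

    τ-0 : τ 0# ≡ 0#
    τ-0 = trans (cong τ (sym (zeroˡ 0#))) (trans (ψ.Tr-* e 0# (ψ.Fixed-0# 1)) (zeroˡ _))

    -- Transitivity of the trace: the e m conjugates over F_2 are grouped into m blocks of e, each
    -- block being `τ` of one conjugate over F_q.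
    t≡τ∘T : ∀ x → t x ≡ τ (T x)
    t≡τ∘T x = go m
      where
      go : ∀ j → ψ.Tr (e ℕ.* j) x ≡ τ (φ.Tr j x)
      go zero    = trans (cong (λ i → ψ.Tr i x) (ℕₚ.*-zeroʳ e)) (sym τ-0)
      go (suc j) = trans (cong (λ i → ψ.Tr i x) (trans (ℕₚ.*-suc e j) (ℕₚ.+-comm e (e ℕ.* j))))
        (trans (ψ.Tr-sum (e ℕ.* j) e x) (trans (cong₂ _+_ (go j) (cong τ (sym (φσ≡ψσ j x)))) (sym (ψ.Tr-+ e _ _))))

    T-fixed : ∀ x → φ.Fixed 1 (T x)
    T-fixed x = φ.Tr-fixed m x (φ-Fixed-m x)

    ψ-Fixed-em : ∀ x → ψ.Fixed (e ℕ.* m) x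
    ψ-Fixed-em x = subst (λ j → ψ.Fixed j x) suc-pred-em (ψW.Fixed-all x)

    t-artin-schreier : ∀ y → t (ψ.σ 1 y - y) ≡ 0#
    t-artin-schreier y = trans (ψ.Tr-+ (e ℕ.* m) _ _) (trans (cong (t (ψ.σ 1 y) +_) (ψ.Tr-neg (e ℕ.* m) y))
      (trans (ψ.Tr-telescope (e ℕ.* m) y) (x≡y⇒x-y≡0 (ψ-Fixed-em y))))

    artin-schreier : ∀ z → t z ≡ 0# → ∃ λ y → ψ.σ 1 y - y ≡ z
    artin-schreier z tz≡0 = ψW.hilbert90 z (trans (cong (λ j → ψ.Tr j z) suc-pred-em) tz≡0)

    ψσ1≡square : ∀ y → ψ.σ 1 y ≡ y * y
    ψσ1≡square y = cong (y *_) (*-identityʳ y)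

    -- The power with exponent 2^(em-1), inverse to squaring because K has 2^(em) elements.
    √ : Carrier → Carrier
    √ = ψ.σ (ℕ.pred (e ℕ.* m))

    √-square : ∀ x → √ x * √ x ≡ x
    √-square x = trans (sym (ψσ1≡square (√ x))) (trans (sym (ψ.σ-∘ (ℕ.pred (e ℕ.* m)) 1 x))
        (trans (cong (λ j → ψ.σ j x) (ℕₚ.+-comm (ℕ.pred (e ℕ.* m)) 1)) (ψW.Fixed-all x)))

    square-√ : ∀ x → √ (x * x) ≡ x
    square-√ x = trans (cong √ (sym (ψσ1≡square x))) (trans (sym (ψ.σ-∘ 1 (ℕ.pred (e ℕ.* m)) x)) (ψW.Fixed-all x))

    √-fixed : ∀ {x} → φ.Fixed 1 x → φ.Fixed 1 (√ x)
    √-fixed {x} fx = trans (sym (^-* x (2 ℕ.^ ℕ.pred (e ℕ.* m)) (q ℕ.^ 1)))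
        (trans (cong (x ^ᶠ_) (ℕₚ.*-comm (2 ℕ.^ ℕ.pred (e ℕ.* m)) (q ℕ.^ 1)))
      (trans (^-* x (q ℕ.^ 1) (2 ℕ.^ ℕ.pred (e ℕ.* m))) (cong √ fx)))

    root-b≡0 : ∀ λ′ → HasRoot λ′ 0#
    root-b≡0 λ′ = √ λ′ , trans (√-square λ′) (solve 2 (λ l x → l := l :* (con 1ℤ :+ con 0ℤ :* x)) refl λ′ (√ λ′))

    -- The substitution x = λby turns x² = λ(1 + bx) into y² - y = 1/(λb²).
    root⇒t≡0 : ∀ {λ′ b} → ¬ λ′ ≡ 0# → ¬ b ≡ 0# → HasRoot λ′ b → t (b ⁻¹ * b ⁻¹ * λ′ ⁻¹) ≡ 0#
    root⇒t≡0 {λ′} {b} λ≢0 b≢0 (x , eq) = trans (cong t (sym y²-y≡z)) (t-artin-schreier y)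
      where
      open ≡-Reasoning
      c = b ⁻¹
      μ = λ′ ⁻¹
      y = x * c * μ
      y²-y≡z : ψ.σ 1 y - y ≡ c * c * μ
      y²-y≡z = begin
        ψ.σ 1 y - y ≡⟨ cong (_- y) (ψσ1≡square y) ⟩
        y * y - y ≡⟨ solve 3 (λ x c μ → (x :* c :* μ) :* (x :* c :* μ) :- x :* c :* μ := c :* c :* μ :* μ :*
            (x :* x) :- x :* c :* μ) refl x c μ ⟩
        c * c * μ * μ * (x * x) - y ≡⟨ cong (λ z → c * c * μ * μ * z - y) eq ⟩
        c * c * μ * μ * (λ′ * (1# + b * x)) - y
          ≡⟨ solve 5 (λ x c μ l b → c :* c :* μ :* μ :* (l :* (con 1ℤ :+ b :* x)) :- x :* c :* μ :=
               c :* c :* μ :* (l :* μ) :+ x :* c :* μ :* ((b :* c) :* (l :* μ) :- con 1ℤ)) refl x c μ λ′ b ⟩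
        c * c * μ * (λ′ * μ) + x * c * μ * ((b * c) * (λ′ * μ) - 1#)
          ≡⟨ cong₂ (λ u v → c * c * μ * u + x * c * μ * (v * u - 1#)) (*-inverseʳ λ≢0) (*-inverseʳ b≢0) ⟩
        c * c * μ * 1# + x * c * μ * (1# * 1# - 1#)
          ≡⟨ solve 3 (λ x c μ → c :* c :* μ :* con 1ℤ :+ x :* c :* μ :* (con 1ℤ :* con 1ℤ :- con 1ℤ) := c :* c :* μ)
              refl x c μ ⟩
        c * c * μ ∎

    t≡0⇒root : ∀ {λ′ b} → ¬ λ′ ≡ 0# → ¬ b ≡ 0# → t (b ⁻¹ * b ⁻¹ * λ′ ⁻¹) ≡ 0# → HasRoot λ′ b
    t≡0⇒root {λ′} {b} λ≢0 b≢0 tz≡0 = from-y (artin-schreier _ tz≡0)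
      where
      open ≡-Reasoning
      c = b ⁻¹
      μ = λ′ ⁻¹
      from-y : (∃ λ y → ψ.σ 1 y - y ≡ c * c * μ) → HasRoot λ′ b
      from-y (y , eq) = λ′ * b * y , (begin
        λ′ * b * y * (λ′ * b * y)
          ≡⟨ solve 3 (λ l b y → l :* b :* y :* (l :* b :* y) := l :* l :* b :* b :* ((y :* y :- y) :+ y)) refl λ′ b
              y ⟩
        λ′ * λ′ * b * b * ((y * y - y) + y)
          ≡⟨ cong (λ z → λ′ * λ′ * b * b * (z + y)) (trans (cong (_- y) (sym (ψσ1≡square y))) eq) ⟩
        λ′ * λ′ * b * b * (c * c * μ + y)
          ≡⟨ solve 5 (λ l b y c μ → l :* l :* b :* b :* (c :* c :* μ :+ y) := l :*
              ((l :* μ) :* (b :* c) :* (b :* c) :+ b :* (l :* b :* y))) refl λ′ b y c μ ⟩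
        λ′ * ((λ′ * μ) * (b * c) * (b * c) + b * (λ′ * b * y))
          ≡⟨ cong₂ (λ u v → λ′ * (u * v * v + b * (λ′ * b * y))) (*-inverseʳ λ≢0) (*-inverseʳ b≢0) ⟩
        λ′ * (1# * 1# * 1# + b * (λ′ * b * y))
          ≡⟨ cong (λ z → λ′ * (z + b * (λ′ * b * y))) (solve 0 (con 1ℤ :* con 1ℤ :* con 1ℤ := con 1ℤ) refl) ⟩
        λ′ * (1# + b * (λ′ * b * y)) ∎)

    -- For `x` in the field of q^h elements with 2h = m, the conjugates that make up `T x` form two
    -- equal halves, which cancel in characteristic 2.
    trace-degree : ∀ {x} → ¬ T x ≡ 0# → Φ.DegreeAtLeast l x → φ.DegreeAtLeast m x
    trace-degree {x} Tx≢0 deg with degree-l⇒degree-m deg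
    ... | inj₁ deg′ = deg′
    ... | inj₂ (h , 2h≡m , fx) = contradiction (trans (cong (λ j → φ.Tr j x) (sym 2h≡m))
            (trans (φ.Tr-sum h h x) (trans (cong (λ z → φ.Tr h x + φ.Tr h z) fx) (char-2 (φ.Tr h x))))) Tx≢0

    -- The conjugates of `z` repeat after n steps, and of an odd number of equal blocks all but one
    -- cancel in pairs.
    Tr-odd-multiple : ∀ s {z} → φ.Fixed n z → φ.Tr (suc (s ℕ.+ s) ℕ.* n) z ≡ φ.Tr n z
    Tr-odd-multiple zero {z} fz = cong (λ j → φ.Tr j z) (ℕₚ.+-identityʳ n)
    Tr-odd-multiple (suc s) {z} fz = begin
      φ.Tr (n ℕ.+ (suc s ℕ.+ suc s) ℕ.* n) z              ≡⟨ step-n ((suc s ℕ.+ suc s) ℕ.* n) ⟩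
      φ.Tr n z + φ.Tr ((suc s ℕ.+ suc s) ℕ.* n) z         ≡⟨ cong (λ j → φ.Tr n z + φ.Tr (j ℕ.* n) z)
          (cong suc (ℕₚ.+-suc s s)) ⟩
      φ.Tr n z + φ.Tr (n ℕ.+ suc (s ℕ.+ s) ℕ.* n) z       ≡⟨ cong (φ.Tr n z +_) (step-n (suc (s ℕ.+ s) ℕ.* n)) ⟩
      φ.Tr n z + (φ.Tr n z + φ.Tr (suc (s ℕ.+ s) ℕ.* n) z) ≡⟨ +-assoc _ _ _ ⟨
      φ.Tr n z + φ.Tr n z + φ.Tr (suc (s ℕ.+ s) ℕ.* n) z  ≡⟨ cong (_+ φ.Tr (suc (s ℕ.+ s) ℕ.* n) z) (char-2 _) ⟩
      0# + φ.Tr (suc (s ℕ.+ s) ℕ.* n) z                   ≡⟨ +-identityˡ _ ⟩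
      φ.Tr (suc (s ℕ.+ s) ℕ.* n) z                        ≡⟨ Tr-odd-multiple s fz ⟩
      φ.Tr n z                                            ∎
      where
      open ≡-Reasoning
      step-n : ∀ j → φ.Tr (n ℕ.+ j) z ≡ φ.Tr n z + φ.Tr j z
      step-n j = trans (φ.Tr-sum n j z) (cong (λ y → φ.Tr n z + φ.Tr j y) fz)

    Φ-Fixed-1⇒φ-Fixed-n : ∀ {z} → Φ.Fixed 1 z → φ.Fixed n z
    Φ-Fixed-1⇒φ-Fixed-n {z} fz = trans (cong (λ j → φ.σ j z) (sym (ℕₚ.*-identityʳ n))) (trans (sym (Φσ≡φσ 1 z)) fz)

    abstract
      -- The trace from F_Q to F_q is a polynomial of degree q^(n-1) < Q, so it cannot vanish on all
      -- of F_Q. It agrees with `T` on F_Q because l is odd, and dividing by its value, which lies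
      -- in F_q, normalises it to 1.
      trace-1-in-F_Q : ∃ λ z → Φ.Fixed 1 z × T z ≡ 1#
      trace-1-in-F_Q = normalise (witness (λ z → Φ.Fixed? 1 z ×-dec ¬? (ker? z))
          (ℕₚ.n≢0⇒n>0 λ none → ℕₚ.<⇒≱ few (many none)))
        where
        ker? : Decidable (λ z → φ.Tr n z ≡ 0#)
        ker? z = φ.Tr n z ≟ 0#
        suc-pred-n : suc (ℕ.pred n) ≡ n
        suc-pred-n = ℕₚ.suc-pred n {{ℕ.>-nonZero 0<n}}
        few : # ker? ℕ.< Q
        few = ℕₚ.≤-<-trans (subst (λ j → # (λ z → φ.Tr j z ≟ 0#) ℕ.≤ q ℕ.^ ℕ.pred n) suc-pred-n
            (φ.#-fibre-Tr (ℕ.pred n) 0#))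
          (φ.q^-mono (ℕₚ.≤-reflexive suc-pred-n))
        many : # (λ z → Φ.Fixed? 1 z ×-dec ¬? (ker? z)) ≡ 0 → Q ℕ.≤ # ker?
        many none = begin
          Q ≡⟨ ΦW.#-Fixed ⟨
          # (Φ.Fixed? 1) ≡⟨ #-split (Φ.Fixed? 1) ker? ⟩
          # (λ z → Φ.Fixed? 1 z ×-dec ker? z) ℕ.+ # (λ z → Φ.Fixed? 1 z ×-dec ¬? (ker? z)) ≡⟨ cong
              (# (λ z → Φ.Fixed? 1 z ×-dec ker? z) ℕ.+_) none ⟩
          # (λ z → Φ.Fixed? 1 z ×-dec ker? z) ℕ.+ 0 ≡⟨ ℕₚ.+-identityʳ _ ⟩
          # (λ z → Φ.Fixed? 1 z ×-dec ker? z) ≤⟨ #-mono (λ z → Φ.Fixed? 1 z ×-dec ker? z) ker? (λ _ → proj₂) ⟩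
          # ker? ∎
          where open ℕₚ.≤-Reasoning
        normalise : (∃ λ z → Φ.Fixed 1 z × ¬ φ.Tr n z ≡ 0#) → ∃ λ z → Φ.Fixed 1 z × T z ≡ 1#
        normalise (z , fz , Trz≢0) = T z ⁻¹ * z
          , Φ.Fixed-* 1 (Φ.Fixed-⁻¹ 1 Tz≢0 (φ-Fixed-1⇒Φ-Fixed 1 (T-fixed z))) fz
          , trans (φ.Tr-* m z (φ.Fixed-⁻¹ 1 Tz≢0 (T-fixed z))) (*-inverseˡ Tz≢0)
          where
          Tz≡ : (∃ λ s → l ≡ suc (s ℕ.+ s)) → T z ≡ φ.Tr n z
          Tz≡ (s , l≡) = trans (cong (λ j → φ.Tr j z) (trans (cong (n ℕ.*_) l≡) (ℕₚ.*-comm n _)))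
              (Tr-odd-multiple s (Φ-Fixed-1⇒φ-Fixed-n fz))
          Tz≢0 : ¬ T z ≡ 0#
          Tz≢0 eq = Trz≢0 (trans (sym (Tz≡ (odd⇒1+2h l 2∤l))) eq)

    traceless? : Decidable (λ x → Φ.DegreeAtLeast l x × T x ≡ 0#)
    traceless? x = Φ.DegreeAtLeast? l x ×-dec (T x ≟ 0#)

    traceful? : Decidable (λ x → Φ.DegreeAtLeast l x × ¬ T x ≡ 0#)
    traceful? x = Φ.DegreeAtLeast? l x ×-dec ¬? (T x ≟ 0#)

    #Degree-l≡ : #Degree-l ≡ # traceless? ℕ.* q
    #Degree-l≡ = trans (#-bijection finite pairs (Φ.DegreeAtLeast? l)
        (λ a → traceless? (proj₁ a) ×-dec φ.Fixed? 1 (proj₂ a))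
        (λ x → x - T x * z₀ , T x) (λ { (x , c) → x + c * z₀ })
        (λ x deg → ((Φ.DegreeAtLeast-+ (Φ.Fixed-neg 1 (Φ.Fixed-* 1 (φ-Fixed-1⇒Φ-Fixed 1 (T-fixed x)) Fz₀)) deg)
                    , trans (Tr-sub-z₀ x) (-‿inverseʳ (T x))) , T-fixed x)
        (λ { (x , c) ((deg , _) , fc) → Φ.DegreeAtLeast-+ (Φ.Fixed-* 1 (φ-Fixed-1⇒Φ-Fixed 1 fc) Fz₀) deg })
        (λ x _ → solve 2 (λ x y → (x :- y) :+ y := x) refl x (T x * z₀))
        (λ { (x , c) ((_ , Tx≡0) , fc) → cong₂ _,_
               (trans (cong (λ s → x + c * z₀ - s * z₀) (T-shift Tx≡0 fc))
                   (solve 2 (λ x y → x :+ y :- y := x) refl x (c * z₀)))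
               (T-shift Tx≡0 fc) }))
      (trans (#-× finite finite traceless? (φ.Fixed? 1)) (cong (# traceless? ℕ.*_) φW.#-Fixed))
      where
      z₀ : Carrier
      z₀ = proj₁ trace-1-in-F_Q
      Fz₀ : Φ.Fixed 1 z₀
      Fz₀ = proj₁ (proj₂ trace-1-in-F_Q)
      Tcz₀ : ∀ {c} → φ.Fixed 1 c → T (c * z₀) ≡ c
      Tcz₀ {c} fc = trans (φ.Tr-* m z₀ fc) (trans (cong (c *_) (proj₂ (proj₂ trace-1-in-F_Q))) (*-identityʳ c))
      T-shift : ∀ {x c} → T x ≡ 0# → φ.Fixed 1 c → T (x + c * z₀) ≡ c
      T-shift {x} {c} Tx≡0 fc = trans (φ.Tr-+ m x (c * z₀)) (trans (cong₂ _+_ Tx≡0 (Tcz₀ fc)) (+-identityˡ c))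
      Tr-sub-z₀ : ∀ x → T (x - T x * z₀) ≡ T x - T x
      Tr-sub-z₀ x = trans (φ.Tr-+ m x _) (cong (T x +_) (trans (φ.Tr-neg m _) (cong -_ (Tcz₀ (T-fixed x)))))

    -- If a elements of degree l are traceless, there are a q in all, hence a (q - 1) with nonzero
    -- trace. The factor q on the left avoids a division.
    q*#traceful : q ℕ.* # traceful? ≡ (q ℕ.∸ 1) ℕ.* #Degree-l
    q*#traceful = from-equations q (# traceless?) (# traceful?)
        (trans (sym #Degree-l≡) (#-split (Φ.DegreeAtLeast? l) (λ x → T x ≟ 0#))) #Degree-l≡
      where
      from-equations : ∀ q a b → a ℕ.* q ≡ a ℕ.+ b → #Degree-l ≡ a ℕ.* q → q ℕ.* b ≡ (q ℕ.∸ 1) ℕ.* #Degree-l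
      from-equations zero a b eq eq′ = refl
      from-equations (suc q) a b eq eq′ = trans (cong (suc q ℕ.*_)
          (sym (ℕₚ.+-cancelˡ-≡ a _ _ (trans (sym (ℕₚ.*-suc a q)) eq))))
        (trans (ℕₚ.*-comm (suc q) (a ℕ.* q)) (trans (cong (ℕ._* suc q) (ℕₚ.*-comm a q))
            (trans (ℕₚ.*-assoc q a (suc q)) (cong (q ℕ.*_) (sym eq′)))))

    τ-nonzero? : Decidable (λ w → φ.Fixed 1 w × ¬ τ w ≡ 0#)
    τ-nonzero? w = φ.Fixed? 1 w ×-dec ¬? (τ w ≟ 0#)

    -- On F_q the trace `τ` takes only the values 0 and 1, each at most 2^(e-1) times. As q = 2^e,
    -- both bounds are attained.
    2*#τ-nonzero : 2 ℕ.* # τ-nonzero? ≡ q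
    2*#τ-nonzero = trans (cong (2 ℕ.*_) W≡) (trans (cong (2 ℕ.^_) suc-pred-e) (sym q≡2^e))
      where
      suc-pred-e : suc (ℕ.pred e) ≡ e
      suc-pred-e = ℕₚ.suc-pred e {{ℕ.>-nonZero 1≤e}}
      E : ℕ
      E = 2 ℕ.^ ℕ.pred e
      fibre-bound : ∀ c → # (λ w → τ w ≟ c) ℕ.≤ E
      fibre-bound c = subst (λ j → # (λ w → ψ.Tr j w ≟ c) ℕ.≤ E) suc-pred-e (ψ.#-fibre-Tr (ℕ.pred e) c)
      τ≡1 : ∀ w → φ.Fixed 1 w × ¬ τ w ≡ 0# → τ w ≡ 1#
      τ≡1 w (fw , τw≢0) = *-cancelˡ τw≢0 (trans (trans (sym (ψσ1≡square (τ w)))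
          (ψ.Tr-fixed e w (φ-Fixed-1⇒ψ-Fixed-e fw))) (sym (*-identityʳ _)))
      W≤ : # τ-nonzero? ℕ.≤ E
      W≤ = ℕₚ.≤-trans (#-mono τ-nonzero? (λ w → τ w ≟ 1#) τ≡1) (fibre-bound 1#)
      total : E ℕ.+ E ℕ.≤ E ℕ.+ # τ-nonzero?
      total = begin
        E ℕ.+ E                ≡⟨ cong (E ℕ.+_) (ℕₚ.+-identityʳ E) ⟨
        2 ℕ.^ suc (ℕ.pred e)   ≡⟨ cong (2 ℕ.^_) suc-pred-e ⟩
        2 ℕ.^ e                ≡⟨ q≡2^e ⟨
        q                      ≡⟨ φW.#-Fixed ⟨
        # (φ.Fixed? 1)         ≡⟨ #-split (φ.Fixed? 1) (λ w → τ w ≟ 0#) ⟩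
        # (λ w → φ.Fixed? 1 w ×-dec (τ w ≟ 0#)) ℕ.+ # τ-nonzero?
          ≤⟨ ℕₚ.+-monoˡ-≤ (# τ-nonzero?) (ℕₚ.≤-trans (#-mono (λ w → φ.Fixed? 1 w ×-dec (τ w ≟ 0#)) (λ w → τ w ≟ 0#)
              (λ _ → proj₂)) (fibre-bound 0#)) ⟩
        E ℕ.+ # τ-nonzero?     ∎
        where open ℕₚ.≤-Reasoning
      W≡ : # τ-nonzero? ≡ E
      W≡ = ℕₚ.≤-antisym W≤ (ℕₚ.+-cancelˡ-≤ E _ _ total)

    -- (λ , b) ↦ (μ , w) with μ = 1/λ and w = T μ / b², so that t (1/(λb²)) = τ w.
    #Good≡ : #Good ≡ # traceful? ℕ.* # τ-nonzero?
    #Good≡ = trans (#-bijection pairs pairs Good? target? to from into back from-to to-from)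
        (#-× finite finite traceful? τ-nonzero?)
      where
      Target : Carrier × Carrier → Set
      Target (μ , w) = (Φ.DegreeAtLeast l μ × ¬ T μ ≡ 0#) × (φ.Fixed 1 w × ¬ τ w ≡ 0#)
      target? : Decidable Target
      target? (μ , w) = traceful? μ ×-dec τ-nonzero? w
      to from : Carrier × Carrier → Carrier × Carrier
      to (λ′ , b) = λ′ ⁻¹ , (b ⁻¹ * b ⁻¹) * T (λ′ ⁻¹)
      -- From w = T μ / b^2 one gets (1/b)^2 = w / T μ, and `√` is the unique square root.
      from (μ , w) = μ ⁻¹ , √ (w * T μ ⁻¹) ⁻¹
      b≢0 : ∀ {λ′ b} → ¬ HasRoot λ′ b → ¬ b ≡ 0#
      b≢0 noRoot refl = noRoot (root-b≡0 _)
      t-scaled : ∀ {b} μ → φ.Fixed 1 b → ¬ b ≡ 0# → t (b ⁻¹ * b ⁻¹ * μ) ≡ τ (b ⁻¹ * b ⁻¹ * T μ)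
      t-scaled μ fb b≢0 = trans (t≡τ∘T _) (cong τ (φ.Tr-* m μ
          (φ.Fixed-* 1 (φ.Fixed-⁻¹ 1 b≢0 fb) (φ.Fixed-⁻¹ 1 b≢0 fb))))
      into : ∀ a → Good a → Target (to a)
      into (λ′ , b) (deg , fb , noRoot) =
        ((degree-m⇒degree-l (φ.DegreeAtLeast-⁻¹ λ≢0 deg)) , Tμ≢0)
        , φ.Fixed-* 1 (φ.Fixed-* 1 (φ.Fixed-⁻¹ 1 nz fb) (φ.Fixed-⁻¹ 1 nz fb)) (T-fixed _) , τw≢0
        where
        nz : ¬ b ≡ 0#
        nz = b≢0 noRoot
        λ≢0 : ¬ λ′ ≡ 0#
        λ≢0 = φ.DegreeAtLeast⇒nonzero 1<m deg
        τw≢0 : ¬ τ ((b ⁻¹ * b ⁻¹) * T (λ′ ⁻¹)) ≡ 0#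
        τw≢0 eq = noRoot (t≡0⇒root λ≢0 nz (trans (t-scaled (λ′ ⁻¹) fb nz) eq))
        Tμ≢0 : ¬ T (λ′ ⁻¹) ≡ 0#
        Tμ≢0 eq = τw≢0 (trans (cong τ (trans (cong ((b ⁻¹ * b ⁻¹) *_) eq) (zeroʳ _))) τ-0)
      module _ {μ w} (deg : Φ.DegreeAtLeast l μ) (Tμ≢0 : ¬ T μ ≡ 0#) (fw : φ.Fixed 1 w) (τw≢0 : ¬ τ w ≡ 0#) where
        deg-m : φ.DegreeAtLeast m μ
        deg-m = trace-degree Tμ≢0 deg
        μ≢0 : ¬ μ ≡ 0#
        μ≢0 = φ.DegreeAtLeast⇒nonzero 1<m deg-m
        w≢0 : ¬ w ≡ 0#
        w≢0 refl = τw≢0 τ-0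
        v = w * T μ ⁻¹
        v≢0 : ¬ v ≡ 0#
        v≢0 = *-nonzero w≢0 (⁻¹-nonzero Tμ≢0)
        √v≢0 : ¬ √ v ≡ 0#
        √v≢0 eq = v≢0 (trans (sym (√-square v)) (trans (cong (_* √ v) eq) (zeroˡ _)))
        fb : φ.Fixed 1 (√ v ⁻¹)
        fb = φ.Fixed-⁻¹ 1 √v≢0 (√-fixed (φ.Fixed-* 1 fw (φ.Fixed-⁻¹ 1 Tμ≢0 (T-fixed μ))))
        w-recovered : (√ v ⁻¹) ⁻¹ * (√ v ⁻¹) ⁻¹ * T ((μ ⁻¹) ⁻¹) ≡ w
        w-recovered = trans (cong₂ (λ s μ → s * s * T μ) (⁻¹-involutive √v≢0) (⁻¹-involutive μ≢0))
          (trans (cong (_* T μ) (√-square v)) (trans (*-assoc w _ _)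
              (trans (cong (w *_) (*-inverseˡ Tμ≢0)) (*-identityʳ w))))
        noRoot : ¬ HasRoot (μ ⁻¹) (√ v ⁻¹)
        noRoot root = τw≢0 (trans (cong τ (sym w-recovered)) (trans (sym (t-scaled ((μ ⁻¹) ⁻¹) fb (⁻¹-nonzero √v≢0)))
          (root⇒t≡0 (⁻¹-nonzero μ≢0) (⁻¹-nonzero √v≢0) root)))
        good : Good (from (μ , w))
        good = (φ.DegreeAtLeast-⁻¹ μ≢0 deg-m) , fb , noRoot
        recovered : to (from (μ , w)) ≡ (μ , w)
        recovered = cong₂ _,_ (⁻¹-involutive μ≢0) w-recovered
      back : ∀ a → Target a → Good (from a)
      back (μ , w) ((deg , Tμ≢0) , (fw , τw≢0)) = good deg Tμ≢0 fw τw≢0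
      to-from : ∀ a → Target a → to (from a) ≡ a
      to-from (μ , w) ((deg , Tμ≢0) , (fw , τw≢0)) = recovered deg Tμ≢0 fw τw≢0
      from-to : ∀ a → Good a → from (to a) ≡ a
      from-to (λ′ , b) good@(deg , fb , noRoot) = cong₂ _,_ (⁻¹-involutive (φ.DegreeAtLeast⇒nonzero 1<m deg))
        (trans (cong (λ v → √ v ⁻¹) (trans (*-assoc _ _ _) (trans
            (cong ((b ⁻¹ * b ⁻¹) *_) (*-inverseʳ (proj₂ (proj₁ (into (λ′ , b) good))))) (*-identityʳ _))))
          (trans (cong _⁻¹ (square-√ (b ⁻¹))) (⁻¹-involutive (b≢0 noRoot))))

    #Good-even : 2 ℕ.* #Good ≡ (q ℕ.∸ 1) ℕ.* #Degree-l
    #Good-even = begin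
      2 ℕ.* #Good                              ≡⟨ cong (2 ℕ.*_) #Good≡ ⟩
      2 ℕ.* (# traceful? ℕ.* # τ-nonzero?)     ≡⟨ cong (2 ℕ.*_) (ℕₚ.*-comm (# traceful?) _) ⟩
      2 ℕ.* (# τ-nonzero? ℕ.* # traceful?)     ≡⟨ ℕₚ.*-assoc 2 (# τ-nonzero?) (# traceful?) ⟨
      2 ℕ.* # τ-nonzero? ℕ.* # traceful?       ≡⟨ cong (ℕ._* # traceful?) 2*#τ-nonzero ⟩
      q ℕ.* # traceful?                        ≡⟨ q*#traceful ⟩
      (q ℕ.∸ 1) ℕ.* #Degree-l                  ∎
      where open ≡-Reasoning

-- The polynomial ring: ring laws, degree, evaluation

module Polynomials (F : FiniteField) where
  open Field F public

  -- A record around _≈ₚ_, so that unification can recover the polynomials.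
  infix 4 _≋_
  infixr 4 _,_
  record _≋_ (p q : Poly) : Set where
    constructor mk
    field at : p ≈ₚ q
  open _≋_ public

  ≋-refl : ∀ {p} → p ≋ p
  ≋-refl = mk λ _ → refl

  ≋-sym : ∀ {p q} → p ≋ q → q ≋ p
  ≋-sym (mk eq) = mk λ i → sym (eq i)

  ≋-trans : ∀ {p q r} → p ≋ q → q ≋ r → p ≋ r
  ≋-trans (mk eq) (mk eq′) = mk λ i → trans (eq i) (eq′ i)

  coeff-+ : ∀ p q i → coeff (p +ₚ q) i ≡ coeff p i + coeff q i
  coeff-+ [] q i                   = sym (+-identityˡ _)
  coeff-+ (a ∷ p) [] i             = sym (+-identityʳ _)
  coeff-+ (a ∷ p) (b ∷ q) zero     = refl
  coeff-+ (a ∷ p) (b ∷ q) (suc i)  = coeff-+ p q i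

  coeff-· : ∀ c p i → coeff (c ·ₚ p) i ≡ c * coeff p i
  coeff-· c [] i            = sym (zeroʳ c)
  coeff-· c (a ∷ p) zero    = refl
  coeff-· c (a ∷ p) (suc i) = coeff-· c p i

  coeff-neg : ∀ p i → coeff (-ₚ p) i ≡ - coeff p i
  coeff-neg [] i            = solve 0 (con 0ℤ := :- con 0ℤ) refl
  coeff-neg (a ∷ p) zero    = refl
  coeff-neg (a ∷ p) (suc i) = coeff-neg p i

  coeff-*-0 : ∀ a p q → coeff ((a ∷ p) *ₚ q) 0 ≡ a * coeff q 0
  coeff-*-0 a p q = trans (coeff-+ (a ·ₚ q) (0# ∷ (p *ₚ q)) 0) (trans (cong (_+ 0#) (coeff-· a q 0)) (+-identityʳ _))

  coeff-*-suc : ∀ a p q i → coeff ((a ∷ p) *ₚ q) (suc i) ≡ a * coeff q (suc i) + coeff (p *ₚ q) i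
  coeff-*-suc a p q i = trans (coeff-+ (a ·ₚ q) (0# ∷ (p *ₚ q)) (suc i))
      (cong (_+ coeff (p *ₚ q) i) (coeff-· a q (suc i)))

  +-cong : ∀ {p p′ q q′} → p ≋ p′ → q ≋ q′ → p +ₚ q ≋ p′ +ₚ q′
  +-cong {p} {p′} {q} {q′} (mk e) (mk e′) = mk λ i → trans (coeff-+ p q i)
      (trans (cong₂ _+_ (e i) (e′ i)) (sym (coeff-+ p′ q′ i)))

  ·-cong : ∀ {c d p q} → c ≡ d → p ≋ q → c ·ₚ p ≋ d ·ₚ q
  ·-cong {c} {d} {p} {q} refl (mk e) = mk λ i → trans (coeff-· c p i)
      (trans (cong (c *_) (e i)) (sym (coeff-· c q i)))

  ∷-cong : ∀ {a b p q} → a ≡ b → p ≋ q → a ∷ p ≋ b ∷ q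
  ∷-cong refl (mk e) = mk λ { zero → refl ; (suc i) → e i }

  neg-cong : ∀ {p q} → p ≋ q → -ₚ p ≋ -ₚ q
  neg-cong {p} {q} (mk e) = mk λ i → trans (coeff-neg p i) (trans (cong -_ (e i)) (sym (coeff-neg q i)))

  tail-≋ : ∀ {a b p q} → a ∷ p ≋ b ∷ q → p ≋ q
  tail-≋ (mk e) = mk λ i → e (suc i)

  0∷[]≋[] : ∀ {a p} → a ≡ 0# → p ≋ [] → a ∷ p ≋ []
  0∷[]≋[] a≡0 (mk e) = mk λ { zero → a≡0 ; (suc i) → e i }

  +ₚ-comm : ∀ p q → p +ₚ q ≋ q +ₚ p
  +ₚ-comm p q = mk λ i → trans (coeff-+ p q i) (trans (+-comm _ _) (sym (coeff-+ q p i)))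

  +ₚ-assoc : ∀ p q r → (p +ₚ q) +ₚ r ≋ p +ₚ (q +ₚ r)
  +ₚ-assoc p q r = mk λ i → trans (trans (coeff-+ (p +ₚ q) r i) (cong (_+ coeff r i) (coeff-+ p q i)))
    (trans (+-assoc _ _ _) (sym (trans (coeff-+ p (q +ₚ r) i) (cong (coeff p i +_) (coeff-+ q r i)))))

  +ₚ-identityʳ : ∀ p → p +ₚ [] ≋ p
  +ₚ-identityʳ p = mk λ i → trans (coeff-+ p [] i) (+-identityʳ _)

  +ₚ-inverseʳ : ∀ p → p +ₚ (-ₚ p) ≋ []
  +ₚ-inverseʳ p = mk λ i → trans (coeff-+ p (-ₚ p) i) (trans (cong (coeff p i +_) (coeff-neg p i)) (-‿inverseʳ _))

  +ₚ-interchange : ∀ p q r s → (p +ₚ q) +ₚ (r +ₚ s) ≋ (p +ₚ r) +ₚ (q +ₚ s)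
  +ₚ-interchange p q r s = mk λ i → trans (trans (coeff-+ (p +ₚ q) (r +ₚ s) i)
      (cong₂ _+_ (coeff-+ p q i) (coeff-+ r s i)))
    (trans (solve 4 (λ a b c d → (a :+ b) :+ (c :+ d) := (a :+ c) :+ (b :+ d)) refl _ _ _ _)
      (sym (trans (coeff-+ (p +ₚ r) (q +ₚ s) i) (cong₂ _+_ (coeff-+ p r i) (coeff-+ q s i)))))

  0∷-+ : ∀ p q → (0# ∷ (p +ₚ q)) ≋ (0# ∷ p) +ₚ (0# ∷ q)
  0∷-+ p q = ∷-cong (sym (+-identityˡ 0#)) ≋-refl

  ·-+ : ∀ c p q → c ·ₚ (p +ₚ q) ≋ (c ·ₚ p) +ₚ (c ·ₚ q)
  ·-+ c p q = mk λ i → trans (trans (coeff-· c (p +ₚ q) i) (cong (c *_) (coeff-+ p q i)))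
    (trans (distribˡ c _ _) (sym (trans (coeff-+ (c ·ₚ p) (c ·ₚ q) i) (cong₂ _+_ (coeff-· c p i) (coeff-· c q i)))))

  +-· : ∀ c d p → (c + d) ·ₚ p ≋ (c ·ₚ p) +ₚ (d ·ₚ p)
  +-· c d p = mk λ i → trans (coeff-· (c + d) p i)
    (trans (distribʳ _ c d) (sym (trans (coeff-+ (c ·ₚ p) (d ·ₚ p) i) (cong₂ _+_ (coeff-· c p i) (coeff-· d p i)))))

  ·-· : ∀ c d p → c ·ₚ (d ·ₚ p) ≋ (c * d) ·ₚ p
  ·-· c d p = mk λ i → trans (coeff-· c (d ·ₚ p) i) (trans (cong (c *_) (coeff-· d p i))
    (trans (sym (*-assoc c d _)) (sym (coeff-· (c * d) p i))))

  1·-identity : ∀ p → 1# ·ₚ p ≋ p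
  1·-identity p = mk λ i → trans (coeff-· 1# p i) (*-identityˡ _)

  0·-zero : ∀ p → 0# ·ₚ p ≋ []
  0·-zero p = mk λ i → trans (coeff-· 0# p i) (zeroˡ _)

  ·-0∷ : ∀ c p → c ·ₚ (0# ∷ p) ≋ 0# ∷ (c ·ₚ p)
  ·-0∷ c p = ∷-cong (zeroʳ c) ≋-refl

  *ₚ-zeroʳ : ∀ p → p *ₚ [] ≋ []
  *ₚ-zeroʳ []      = ≋-refl
  *ₚ-zeroʳ (a ∷ p) = 0∷[]≋[] refl (*ₚ-zeroʳ p)

  ≋[]⇒*≋[] : ∀ {p} q → p ≋ [] → p *ₚ q ≋ []
  ≋[]⇒*≋[] {[]} q _     = ≋-refl
  ≋[]⇒*≋[] {a ∷ p} q eq = ≋-trans (+-cong (≋-trans (·-cong (at eq 0) ≋-refl) (0·-zero q))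
      (0∷[]≋[] refl (≋[]⇒*≋[] {p} q (mk λ i → at eq (suc i))))) (mk λ _ → refl)

  *-congʳ : ∀ p {q q′} → q ≋ q′ → p *ₚ q ≋ p *ₚ q′
  *-congʳ [] eq      = ≋-refl
  *-congʳ (a ∷ p) eq = +-cong (·-cong refl eq) (∷-cong refl (*-congʳ p eq))

  *-congˡ : ∀ {p p′} q → p ≋ p′ → p *ₚ q ≋ p′ *ₚ q
  *-congˡ {[]} {p′} q eq           = ≋-sym (≋[]⇒*≋[] q (≋-sym eq))
  *-congˡ {a ∷ p} {[]} q eq        = ≋[]⇒*≋[] q eq
  *-congˡ {a ∷ p} {b ∷ p′} q eq    = +-cong (·-cong (at eq 0) ≋-refl) (∷-cong refl (*-congˡ q (tail-≋ eq)))

  *ₚ-distribʳ : ∀ r p q → (p +ₚ q) *ₚ r ≋ (p *ₚ r) +ₚ (q *ₚ r)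
  *ₚ-distribʳ r [] q            = ≋-refl
  *ₚ-distribʳ r (a ∷ p) []      = ≋-sym (+ₚ-identityʳ _)
  *ₚ-distribʳ r (a ∷ p) (b ∷ q) = ≋-trans (+-cong (+-· a b r)
      (≋-trans (∷-cong refl (*ₚ-distribʳ r p q)) (0∷-+ (p *ₚ r) (q *ₚ r))))
    (+ₚ-interchange (a ·ₚ r) (b ·ₚ r) (0# ∷ (p *ₚ r)) (0# ∷ (q *ₚ r)))

  ·-*-assoc : ∀ c p q → (c ·ₚ p) *ₚ q ≋ c ·ₚ (p *ₚ q)
  ·-*-assoc c [] q      = ≋-refl
  ·-*-assoc c (a ∷ p) q = ≋-trans (+-cong (≋-sym (·-· c a q))
      (≋-trans (∷-cong refl (·-*-assoc c p q)) (≋-sym (·-0∷ c (p *ₚ q))))) (≋-sym (·-+ c (a ·ₚ q) (0# ∷ (p *ₚ q))))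

  0∷-* : ∀ p q → (0# ∷ p) *ₚ q ≋ 0# ∷ (p *ₚ q)
  0∷-* p q = +-cong (0·-zero q) ≋-refl

  *-∷ : ∀ p b q → p *ₚ (b ∷ q) ≋ (b ·ₚ p) +ₚ (0# ∷ (p *ₚ q))
  *-∷ [] b q      = ≋-sym (0∷[]≋[] refl ≋-refl)
  *-∷ (a ∷ p) b q = ∷-cong (cong (_+ 0#) (*-comm a b)) (≋-trans (+-cong ≋-refl (*-∷ p b q))
    (≋-trans (≋-sym (+ₚ-assoc (a ·ₚ q) (b ·ₚ p) (0# ∷ (p *ₚ q))))
      (≋-trans (+-cong (+ₚ-comm (a ·ₚ q) (b ·ₚ p)) ≋-refl) (+ₚ-assoc (b ·ₚ p) (a ·ₚ q) (0# ∷ (p *ₚ q))))))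

  *ₚ-comm : ∀ p q → p *ₚ q ≋ q *ₚ p
  *ₚ-comm [] q      = ≋-sym (*ₚ-zeroʳ q)
  *ₚ-comm (a ∷ p) q = ≋-trans (+-cong ≋-refl (∷-cong refl (*ₚ-comm p q))) (≋-sym (*-∷ q a p))

  *ₚ-assoc : ∀ p q r → (p *ₚ q) *ₚ r ≋ p *ₚ (q *ₚ r)
  *ₚ-assoc [] q r      = ≋-refl
  *ₚ-assoc (a ∷ p) q r = ≋-trans (*ₚ-distribʳ r (a ·ₚ q) (0# ∷ (p *ₚ q)))
    (+-cong (·-*-assoc a q r) (≋-trans (0∷-* (p *ₚ q) r) (∷-cong refl (*ₚ-assoc p q r))))

  1ₚ : Poly
  1ₚ = 1# ∷ []

  *ₚ-identityˡ : ∀ p → 1ₚ *ₚ p ≋ p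
  *ₚ-identityˡ p = ≋-trans (+-cong (1·-identity p) (0∷[]≋[] refl ≋-refl)) (+ₚ-identityʳ p)

  polyRing : CommutativeRing 0ℓ 0ℓ
  polyRing = record
    { Carrier = Poly ; _≈_ = _≋_ ; _+_ = _+ₚ_ ; _*_ = _*ₚ_ ; -_ = -ₚ_ ; 0# = [] ; 1# = 1ₚ
    ; isCommutativeRing = record
      { isRing = record
        { +-isAbelianGroup = record
          { isGroup = record
            { isMonoid = record
              { isSemigroup = record
                { isMagma = record
                  { isEquivalence = record { refl = ≋-refl ; sym = ≋-sym ; trans = ≋-trans }
                  ; ∙-cong = +-cong }
                ; assoc = +ₚ-assoc }
              ; identity = (λ p → ≋-refl) , +ₚ-identityʳ }
            ; inverse = (λ p → ≋-trans (+ₚ-comm (-ₚ p) p) (+ₚ-inverseʳ p)) , +ₚ-inverseʳ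
            ; ⁻¹-cong = neg-cong }
          ; comm = +ₚ-comm }
        ; *-cong = *ₚ-cong
        ; *-assoc = *ₚ-assoc
        ; *-identity = *ₚ-identityˡ , (λ p → ≋-trans (*ₚ-comm p 1ₚ) (*ₚ-identityˡ p))
        ; distrib = (λ p q r → ≋-trans (*ₚ-comm p (q +ₚ r)) (≋-trans (*ₚ-distribʳ p q r)
            (+-cong (*ₚ-comm q p) (*ₚ-comm r p))))
                  , *ₚ-distribʳ }
      ; *-comm = *ₚ-comm } }
    where
    *ₚ-cong : ∀ {p p′ q q′} → p ≋ p′ → q ≋ q′ → p *ₚ q ≋ p′ *ₚ q′
    *ₚ-cong {p} {p′} {q} {q′} e e′ = ≋-trans (*-congˡ q e) (*-congʳ p′ e′)

  module P where
    open IntegerSolver polyRing public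
    open SetoidReasoning (CommutativeRing.setoid polyRing) public

  constant-* : ∀ c p → (c ∷ []) *ₚ p ≋ c ·ₚ p
  constant-* c p = ≋-trans (+-cong ≋-refl (0∷[]≋[] refl ≋-refl)) (+ₚ-identityʳ _)

  Below : ℕ → Poly → Set
  Below d p = ∀ i → d ℕ.≤ i → coeff p i ≡ 0#

  Below-cong : ∀ {d p q} → p ≋ q → Below d p → Below d q
  Below-cong (mk e) b i d≤i = trans (sym (e i)) (b i d≤i)

  ≋[]? : ∀ p → Dec (p ≋ [])
  ≋[]? [] = yes ≋-refl
  ≋[]? (a ∷ p) = map′ (λ { (a≡0 , p≋[]) → 0∷[]≋[] a≡0 p≋[] }) (λ e → at e 0 , mk λ i → at e (suc i))
      ((a ≟ 0#) ×-dec ≋[]? p)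

  _≋?_ : ∀ p q → Dec (p ≋ q)
  p ≋? q = map′ (λ e → mk λ i → x-y≡0⇒x≡y (trans (cong (coeff p i +_) (sym (coeff-neg q i)))
      (trans (sym (coeff-+ p (-ₚ q) i)) (at e i))))
                (λ e → ≋-trans (+-cong e ≋-refl) (+ₚ-inverseʳ q)) (≋[]? (p +ₚ (-ₚ q)))

  record Degree (d : ℕ) (p : Poly) : Set where
    constructor _,_
    field
      lead≢0 : ¬ coeff p d ≡ 0#
      below  : Below (suc d) p
  open Degree public

  degree : ∀ p → p ≋ [] ⊎ ∃ λ d → Degree d p
  degree [] = inj₁ ≋-refl
  degree (a ∷ p) with degree p
  ... | inj₂ (d , lead , below) = inj₂ (suc d , lead , λ { (suc i) (ℕ.s≤s d<i) → below i d<i })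
  ... | inj₁ p≋[] with a ≟ 0#
  ...   | yes a≡0 = inj₁ (0∷[]≋[] a≡0 p≋[])
  ...   | no a≢0  = inj₂ (0 , a≢0 , λ { (suc i) _ → at p≋[] i })

  product-degree : ∀ p q a b → Below (suc a) p → Below (suc b) q →
                   Below (suc (a ℕ.+ b)) (p *ₚ q) × coeff (p *ₚ q) (a ℕ.+ b) ≡ coeff p a * coeff q b
  product-degree [] q a b bp bq = (λ _ _ → refl) , sym (zeroˡ _)
  product-degree (x ∷ p) q zero b bp bq = bound , lead b
    where
    p≋[] : p ≋ []
    p≋[] = mk λ i → bp (suc i) (ℕ.s≤s ℕ.z≤n)
    x·q : ∀ i → coeff ((x ∷ p) *ₚ q) i ≡ x * coeff q i
    x·q zero    = coeff-*-0 x p q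
    x·q (suc i) = trans (coeff-*-suc x p q i) (trans (cong (x * coeff q (suc i) +_) (at (≋[]⇒*≋[] q p≋[]) i))
        (+-identityʳ _))
    bound : Below (suc b) ((x ∷ p) *ₚ q)
    bound i b<i = trans (x·q i) (trans (cong (x *_) (bq i b<i)) (zeroʳ x))
    lead : ∀ b → coeff ((x ∷ p) *ₚ q) b ≡ x * coeff q b
    lead = x·q
  product-degree (x ∷ p) q (suc a) b bp bq = bound , lead
    where
    ih = product-degree p q a b (λ i a<i → bp (suc i) (ℕ.s≤s a<i)) bq
    bound : Below (suc (suc a ℕ.+ b)) ((x ∷ p) *ₚ q)
    bound (suc i) (ℕ.s≤s ab<i) = trans (coeff-*-suc x p q i) (trans (cong₂ _+_
      (trans (cong (x *_) (bq (suc i) (ℕ.s≤s (ℕₚ.≤-trans (ℕₚ.m≤n+m b (suc a)) ab<i)))) (zeroʳ x)) (proj₁ ih i ab<i))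
          (+-identityˡ 0#))
    lead : coeff ((x ∷ p) *ₚ q) (suc a ℕ.+ b) ≡ coeff p a * coeff q b
    lead = trans (coeff-*-suc x p q (a ℕ.+ b)) (trans (cong₂ _+_
      (trans (cong (x *_) (bq (suc (a ℕ.+ b)) (ℕ.s≤s (ℕₚ.m≤n+m b a)))) (zeroʳ x)) (proj₂ ih)) (+-identityˡ _))

  eval : Poly → Carrier → Carrier
  eval [] x      = 0#
  eval (a ∷ p) x = a + x * eval p x

  eval-[] : ∀ {p} x → p ≋ [] → eval p x ≡ 0#
  eval-[] {[]} x _    = refl
  eval-[] {a ∷ p} x e = trans (cong₂ (λ a y → a + x * y) (at e 0) (eval-[] {p} x (mk λ i → at e (suc i))))
      (solve 1 (λ x → con 0ℤ :+ x :* con 0ℤ := con 0ℤ) refl x)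

  eval-cong : ∀ {p q} x → p ≋ q → eval p x ≡ eval q x
  eval-cong {[]} {q} x e          = sym (eval-[] x (≋-sym e))
  eval-cong {a ∷ p} {[]} x e      = eval-[] x e
  eval-cong {a ∷ p} {b ∷ q} x e   = cong₂ (λ a y → a + x * y) (at e 0) (eval-cong x (tail-≋ e))

  eval-+ : ∀ p q x → eval (p +ₚ q) x ≡ eval p x + eval q x
  eval-+ [] q x            = sym (+-identityˡ _)
  eval-+ (a ∷ p) [] x      = sym (+-identityʳ _)
  eval-+ (a ∷ p) (b ∷ q) x = trans (cong (λ y → (a + b) + x * y) (eval-+ p q x))
    (solve 5 (λ a b x p q → (a :+ b) :+ x :* (p :+ q) := (a :+ x :* p) :+ (b :+ x :* q)) refl a b x (eval p x)
        (eval q x))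

  eval-· : ∀ c p x → eval (c ·ₚ p) x ≡ c * eval p x
  eval-· c [] x      = sym (zeroʳ c)
  eval-· c (a ∷ p) x = trans (cong (λ y → c * a + x * y) (eval-· c p x))
    (solve 4 (λ c a x p → c :* a :+ x :* (c :* p) := c :* (a :+ x :* p)) refl c a x (eval p x))

  eval-* : ∀ p q x → eval (p *ₚ q) x ≡ eval p x * eval q x
  eval-* [] q x      = sym (zeroˡ _)
  eval-* (a ∷ p) q x = trans (eval-+ (a ·ₚ q) _ x) (trans (cong₂ (λ u v → u + (0# + x * v)) (eval-· a q x)
      (eval-* p q x))
    (solve 4 (λ a x p q → a :* q :+ (con 0ℤ :+ x :* (p :* q)) := (a :+ x :* p) :* q) refl a x (eval p x) (eval q x)))

-- Irreducibility of X^2 - λ(1 + bX)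

module Quadratics (K : FiniteField) where
  open Polynomials K

  quadratic : Carrier → Carrier → Poly
  quadratic λ′ b = (- λ′) ∷ (- (λ′ * b)) ∷ 1# ∷ []

  Below-3-quadratic : ∀ λ′ b → Below 3 (quadratic λ′ b)
  Below-3-quadratic λ′ b (suc (suc (suc i))) _ = refl
  Below-3-quadratic λ′ b (suc (suc zero)) (ℕ.s≤s (ℕ.s≤s ()))
  Below-3-quadratic λ′ b (suc zero) (ℕ.s≤s ())

  eval-quadratic : ∀ λ′ b x → eval (quadratic λ′ b) x ≡ x * x - λ′ * (1# + b * x)
  eval-quadratic λ′ b x = solve 3 (λ l b x → :- l :+ x :* (:- (l :* b) :+ x :* (con 1ℤ :+ x :* con 0ℤ)) := x :* x :- l
      :* (con 1ℤ :+ b :* x)) refl λ′ b x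

  irreducible⇒noRoot : ∀ {f} λ′ b → f ≋ quadratic λ′ b → Irreducible f → ¬ ∃ λ x → x * x ≡ λ′ * (1# + b * x)
  irreducible⇒noRoot {f} λ′ b f≋ (_ , irr) (x , eq) =
    [ (λ const → 0≢1 (sym (const 1 (ℕ.s≤s ℕ.z≤n)))) , (λ const → 0≢1 (sym (const 1 (ℕ.s≤s ℕ.z≤n)))) ]′
      -- The roots of X^2 - λbX - λ add up to λb, so the second root is λb - x.
      (irr (- x ∷ 1# ∷ []) ((x - λ′ * b) ∷ 1# ∷ []) (at (≋-trans f≋ factorised)))
    where
    factorised : quadratic λ′ b ≋ (- x ∷ 1# ∷ []) *ₚ ((x - λ′ * b) ∷ 1# ∷ [])
    factorised = mk λ
      { zero → sym (trans (solve 3 (λ x l b → (:- x) :* (x :- l :* b) :+ con 0ℤ :=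
          (l :* (con 1ℤ :+ b :* x) :- x :* x) :- l) refl x λ′ b)
          (trans (cong (_- λ′) (x≡y⇒x-y≡0 (sym eq))) (+-identityˡ _)))
      ; (suc zero) → solve 3 (λ x l b → :- (l :* b) := (:- x) :* con 1ℤ :+ (con 1ℤ :* (x :- l :* b) :+ con 0ℤ)) refl x
          λ′ b
      ; (suc (suc zero)) → sym (*-identityˡ 1#)
      ; (suc (suc (suc i))) → refl }

  -- Of two nonconstant factors the first is either linear, and then its root is a root of `f`, or
  -- of degree at least 2, and then the product has degree at least 3.
  noRoot⇒irreducible : ∀ {f} λ′ b → f ≋ quadratic λ′ b → ¬ (∃ λ x → x * x ≡ λ′ * (1# + b * x)) → Irreducible f
  noRoot⇒irreducible {f} λ′ b f≋ noRoot = (λ const → 0≢1 (trans (sym (const 2 (ℕ.s≤s ℕ.z≤n))) (at f≋ 2))) ,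
      factor-constant
    where
    linear-root : ∀ g → Below 2 g → ¬ coeff g 1 ≡ 0# → eval g (- (coeff g 1 ⁻¹ * coeff g 0)) ≡ 0#
    linear-root g bg g₁≢0 = trans (eval-cong {g} {coeff g 0 ∷ coeff g 1 ∷ []} _
        (mk λ { zero → refl ; (suc zero) → refl ; (suc (suc i)) → bg _ (ℕ.s≤s (ℕ.s≤s ℕ.z≤n)) }))
      (trans (solve 3 (λ a c i → a :+ (:- (i :* a)) :* (c :+ (:- (i :* a)) :* con 0ℤ) := a :* (con 1ℤ :- i :* c)) refl
          (coeff g 0) (coeff g 1) (coeff g 1 ⁻¹))
        (trans (cong (coeff g 0 *_) (x≡y⇒x-y≡0 (sym (*-inverseˡ g₁≢0)))) (zeroʳ _)))
    not-zero : ∀ {p} → p ≋ [] → ¬ f ≋ p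
    not-zero p≋[] f≋p = 0≢1 (trans (sym (at (≋-trans f≋p p≋[]) 2)) (at f≋ 2))
    factor-constant : ∀ g h → f ≈ₚ (g *ₚ h) → IsConstant g ⊎ IsConstant h
    factor-constant g h f≈gh with degree g | degree h
    ... | inj₁ g≋[] | _ = contradiction (mk f≈gh) (not-zero (≋[]⇒*≋[] h g≋[]))
    ... | inj₂ _ | inj₁ h≋[] = contradiction (mk f≈gh) (not-zero (≋-trans (*-congʳ g h≋[]) (*ₚ-zeroʳ g)))
    ... | inj₂ (zero , _ , bg) | inj₂ _ = inj₁ bg
    ... | inj₂ (suc _ , _) | inj₂ (zero , _ , bh) = inj₂ bh
    ... | inj₂ (suc zero , g₁≢0 , bg) | inj₂ (suc b′ , _ , _) = ⊥-elim
        (noRoot (x , x-y≡0⇒x≡y (trans (sym (eval-quadratic λ′ b x))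
          (trans (eval-cong {quadratic λ′ b} {g *ₚ h} x (≋-trans (≋-sym f≋) (mk f≈gh)))
              (trans (eval-* g h x) (trans (cong (_* eval h x) (linear-root g bg g₁≢0)) (zeroˡ _)))))))
      where
      x : Carrier
      x = - (coeff g 1 ⁻¹ * coeff g 0)
    ... | inj₂ (suc (suc a) , ga≢0 , bg) | inj₂ (suc b′ , hb≢0 , bh) = contradiction
        (trans (sym (proj₂ (product-degree g h (suc (suc a)) (suc b′) bg bh)))
          (trans (sym (f≈gh _)) (trans (at f≋ _) (Below-3-quadratic λ′ b _
              (ℕ.s≤s (ℕ.s≤s (ℕₚ.≤-trans (ℕ.s≤s ℕ.z≤n) (ℕₚ.m≤n+m (suc b′) a))))))))
          (*-nonzero ga≢0 hb≢0)

  module _ (q : ℕ) where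
    open OverFq q

    admissible-≋ : ∀ {f} λ′ g → Admissible-g g → f ≈ₚ (X² +ₚ (-ₚ (λ′ ·ₚ g))) → f ≋ quadratic λ′ (coeff g 1)
    admissible-≋ λ′ g (_ , g₀≡1 , g-rest) f≈ = mk λ i → trans (f≈ i) (trans (coeff-+ X² (-ₚ (λ′ ·ₚ g)) i)
        (trans (cong (coeff X² i +_) (trans (coeff-neg (λ′ ·ₚ g) i) (cong -_ (coeff-· λ′ g i)))) (compare i)))
      where
      compare : ∀ i → coeff X² i - λ′ * coeff g i ≡ coeff (quadratic λ′ (coeff g 1)) i
      compare zero = trans (cong (λ z → 0# - λ′ * z) g₀≡1) (solve 1 (λ l → con 0ℤ :- l :* con 1ℤ := :- l) refl λ′)
      compare (suc zero) = +-identityˡ _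
      compare (suc (suc zero)) = trans (cong (λ z → 1# - λ′ * z) (g-rest 2 (ℕ.s≤s (ℕ.s≤s ℕ.z≤n))))
          (solve 1 (λ l → con 1ℤ :- l :* con 0ℤ := con 1ℤ) refl λ′)
      compare (suc (suc (suc i))) = trans (cong (λ z → 0# - λ′ * z)
          (g-rest (suc (suc (suc i))) (ℕ.s≤s (ℕ.s≤s ℕ.z≤n))))
          (solve 1 (λ l → con 0ℤ :- l :* con 0ℤ := con 0ℤ) refl λ′)

-- From the polynomials counted by N to pairs (λ , b)

module CountN (p e k l : ℕ) (pp : Prime p) (1≤e : 1 ℕ.≤ e) (2∤l : ¬ 2 ∣ l) (1<m : 1 ℕ.< 2 ℕ.^ k ℕ.* l)
              (K : FiniteField) (card≡ : FiniteField.card K ≡ (p ℕ.^ e) ℕ.^ (2 ℕ.^ k ℕ.* l)) where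
  open Tower p e k l pp 1≤e 2∤l 1<m K card≡
  open OverFq q
  open Quadratics K
  open Polynomials K using (_≋_; mk; ≋-sym; ≋-trans; at; ≋-refl)
  open Generation K q 1<q (frobenius^ e) (ℕ.pred m) card≡q^

  -- `InNSet` only asserts that some λ and g exist, but the polynomial determines them: the constant
  -- term is -λ, and the linear coefficient -λb gives b because λ is nonzero.
  N≡#Good : ∀ {N} → NqEquals N → N ≡ #Good
  N≡#Good = HasSize-# pairs Good? code code-Good code-injective code-surjective
    where
    code : ∀ f → InNSet f → Carrier × Carrier
    code f (_ , λ′ , g , _) = λ′ , coeff g 1
    shape : ∀ f (f∈ : InNSet f) → f ≋ quadratic (proj₁ (code f f∈)) (proj₂ (code f f∈))
    shape f (_ , λ′ , g , _ , adm , f≈) = admissible-≋ q λ′ g adm f≈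
    coeff-InFq : ∀ {g} → All InFq g → ∀ i → InFq (coeff g i)
    coeff-InFq [] i             = 0^ q (ℕₚ.<-trans (ℕ.s≤s ℕ.z≤n) 1<q)
    coeff-InFq (a∈ ∷ g∈) zero    = a∈
    coeff-InFq (a∈ ∷ g∈) (suc i) = coeff-InFq g∈ i
    code-Good : ∀ f f∈ → Good (code f f∈)
    code-Good f f∈@(irr , λ′ , g , gen , (g∈ , adm) , f≈) =
      (λ i i<m → generates⇒degree λ′ gen i (subst (i ℕ.<_) (sym suc-pred-m) i<m))
      , trans (φ.σ-1 _) (coeff-InFq g∈ 1)
      , irreducible⇒noRoot λ′ (coeff g 1) (shape f f∈) irr
    code-injective : ∀ f f′ f∈ f′∈ → code f f∈ ≡ code f′ f′∈ → f ≈ₚ f′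
    code-injective f f′ f∈ f′∈ eq = at (≋-trans (shape f f∈) (≋-trans
      (mk λ i → cong (λ c → coeff (quadratic (proj₁ c) (proj₂ c)) i) eq) (≋-sym (shape f′ f′∈))))
    quadratic-injective : ∀ {λ′ b μ c} → ¬ λ′ ≡ 0# → quadratic λ′ b ≋ quadratic μ c → (μ , c) ≡ (λ′ , b)
    quadratic-injective {λ′} {b} {μ} {c} λ≢0 eq = cong₂ _,_ μ≡λ
        (*-cancelˡ λ≢0 (trans (cong (_* c) (sym μ≡λ)) (neg-injective (sym (at eq 1)))))
      where
      neg-injective : ∀ {x y} → - x ≡ - y → x ≡ y
      neg-injective {x} {y} e = trans (solve 1 (λ x → x := :- (:- x)) refl x)
          (trans (cong -_ e) (solve 1 (λ y → :- (:- y) := y) refl y))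
      μ≡λ : μ ≡ λ′
      μ≡λ = neg-injective (sym (at eq 0))
    code-surjective : ∀ a → Good a → ∃ λ f → InNSet f × (∀ f′ f′∈ → f ≈ₚ f′ → code f′ f′∈ ≡ a)
    code-surjective (λ′ , b) (deg , fb , noRoot) = f , f∈ , λ f′ f′∈ f≈f′ →
        quadratic-injective λ≢0 (≋-trans (≋-sym (shape f f∈)) (≋-trans (mk f≈f′) (shape f′ f′∈)))
      where
      λ≢0 : ¬ λ′ ≡ 0#
      λ≢0 = φ.DegreeAtLeast⇒nonzero 1<m deg
      g f : Poly
      g = 1# ∷ b ∷ []
      f = X² +ₚ (-ₚ (λ′ ·ₚ g))
      admissible : Admissible-g g
      admissible = (1^ q ∷ trans (sym (φ.σ-1 b)) fb ∷ []) , refl , λ { (suc (suc i)) _ → refl ; (suc zero)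
          (ℕ.s≤s ()) }
      f∈ : InNSet f
      f∈ = noRoot⇒irreducible {f} λ′ b (admissible-≋ q {f} λ′ g admissible (λ _ → refl)) noRoot
         , λ′ , g , degree⇒generates λ′ (λ i i<m → deg i (subst (i ℕ.<_) suc-pred-m i<m)) , admissible , λ _ → refl

-- Division, Euclid's lemma and prime powers in F[X]

module Factorization (F : FiniteField) where
  open Polynomials F public hiding (solve; Polynomial; con; _:+_; _:*_; _:-_; :-_; _:=_; _:^_; ⟦_⟧ℤ)

  infixr 4 _,_
  record IsMonic (n : ℕ) (f : Poly) : Set where
    constructor _,_
    field
      lead  : coeff f n ≡ 1#
      above : Below (suc n) f
  open IsMonic public

  -- The vector lists the n lower coefficients, so that the monic polynomials of degree n, one for
  -- each vector, form a finite type.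
  monic : ∀ {n} → Vec Carrier n → Poly
  monic []      = 1ₚ
  monic (a ∷ v) = a ∷ monic v

  monic-degree : ∀ {n} (v : Vec Carrier n) → IsMonic n (monic v)
  monic-degree []      = refl , λ { (suc i) _ → refl }
  monic-degree (a ∷ v) = lead (monic-degree v) , λ { (suc i) (ℕ.s≤s n<i) → above (monic-degree v) i n<i }

  toVec : ∀ n → (ℕ → Carrier) → Vec Carrier n
  toVec zero c    = []
  toVec (suc n) c = c 0 ∷ toVec n (c ∘ suc)

  toVec-cong : ∀ n {c d} → (∀ i → c i ≡ d i) → toVec n c ≡ toVec n d
  toVec-cong zero eq    = refl
  toVec-cong (suc n) eq = cong₂ _∷_ (eq 0) (toVec-cong n (eq ∘ suc))

  coeffs : ∀ n → Poly → Vec Carrier n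
  coeffs n f = toVec n (coeff f)

  coeffs-monic : ∀ {n} (v : Vec Carrier n) → coeffs n (monic v) ≡ v
  coeffs-monic []      = refl
  coeffs-monic (a ∷ v) = cong (a ∷_) (coeffs-monic v)

  coeffs-cong : ∀ n {f g} → f ≋ g → coeffs n f ≡ coeffs n g
  coeffs-cong n f≋g = toVec-cong n (at f≋g)

  monic-coeffs : ∀ {n f} → IsMonic n f → monic (coeffs n f) ≋ f
  monic-coeffs {n} {f} (lead , above) = mk (go n (coeff f) lead above)
    where
    go : ∀ n c → c n ≡ 1# → (∀ i → n ℕ.< i → c i ≡ 0#) → ∀ i → coeff (monic (toVec n c)) i ≡ c i
    go zero c lead above zero        = sym lead
    go zero c lead above (suc i)     = sym (above (suc i) (ℕ.s≤s ℕ.z≤n))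
    go (suc n) c lead above zero     = refl
    go (suc n) c lead above (suc i)  = go n (c ∘ suc) lead (λ i n<i → above (suc i) (ℕ.s≤s n<i)) i

  monic-injective : ∀ {n} {v w : Vec Carrier n} → monic v ≋ monic w → v ≡ w
  monic-injective {n} {v} {w} eq = trans (sym (coeffs-monic v)) (trans (coeffs-cong n eq) (coeffs-monic w))

  1≢0 : ¬ 1# ≡ 0#
  1≢0 eq = 0≢1 (sym eq)

  Monic⇒Degree : ∀ {n f} → IsMonic n f → Degree n f
  Monic⇒Degree (lead , above) = (λ eq → 1≢0 (trans (sym lead) eq)) , above

  Monic-≋ : ∀ {n f g} → f ≋ g → IsMonic n f → IsMonic n g
  Monic-≋ {n} f≋g (lead , above) = trans (sym (at f≋g n)) lead , λ i n<i → trans (sym (at f≋g i)) (above i n<i)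

  Degree-≋ : ∀ {n f g} → f ≋ g → Degree n f → Degree n g
  Degree-≋ {n} f≋g (lead , above) = (λ eq → lead (trans (at f≋g n) eq)) , Below-cong f≋g above

  Degree<Below : ∀ {a d p} → Degree a p → Below d p → a ℕ.< d
  Degree<Below {a} {d} (lead , _) below = ℕₚ.≰⇒> (λ d≤a → lead (below a d≤a))

  Degree-unique : ∀ {a b p} → Degree a p → Degree b p → a ≡ b
  Degree-unique da db = ℕₚ.≤-antisym (ℕₚ.≤-pred (Degree<Below da (below db))) (ℕₚ.≤-pred (Degree<Below db (below da)))

  Degree-≢[] : ∀ {a p} → Degree a p → ¬ p ≋ []
  Degree-≢[] {a} (lead , _) p≋[] = lead (at p≋[] a)

  Degree-* : ∀ {a b p q} → Degree a p → Degree b q → Degree (a ℕ.+ b) (p *ₚ q)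
  Degree-* {a} {b} {p} {q} (lp , bp) (lq , bq) =
    (λ eq → *-nonzero lp lq (trans (sym (proj₂ pd)) eq)) , proj₁ pd
    where pd = product-degree p q a b bp bq

  Monic-* : ∀ {a b p q} → IsMonic a p → IsMonic b q → IsMonic (a ℕ.+ b) (p *ₚ q)
  Monic-* {a} {b} {p} {q} (lp , bp) (lq , bq) = trans (proj₂ pd) (trans (cong₂ _*_ lp lq) (*-identityˡ 1#)) , proj₁ pd
    where pd = product-degree p q a b bp bq

  infix 4 _∣ₚ_
  _∣ₚ_ : Poly → Poly → Set
  D ∣ₚ f = ∃ λ q → f ≋ q *ₚ D

  ∣ₚ-cong : ∀ {D E f g} → D ≋ E → f ≋ g → D ∣ₚ f → E ∣ₚ g
  ∣ₚ-cong D≋E f≋g (q , f≋qD) = q , ≋-trans (≋-sym f≋g) (≋-trans f≋qD (*-congʳ q D≋E))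

  ∣ₚ-trans : ∀ {D E f} → D ∣ₚ E → E ∣ₚ f → D ∣ₚ f
  ∣ₚ-trans {D} (q , E≋qD) (s , f≋sE) = s *ₚ q , ≋-trans f≋sE (≋-trans (*-congʳ s E≋qD) (≋-sym (*ₚ-assoc s q D)))

  division : ∀ {d D} → IsMonic d D → ∀ f → ∃ λ q → ∃ λ r → Below d r × f ≋ (q *ₚ D) +ₚ r
  division mD [] = [] , [] , (λ _ _ → refl) , ≋-refl
  division {d} {D} mD (x ∷ f) with division mD f
  ... | q , r , below , f≋ = (c ∷ q) , r′ , below′ , (begin
      x ∷ f                              ≈⟨ ∷-cong refl f≋ ⟩
      x ∷ ((q *ₚ D) +ₚ r)                ≈⟨ ∷-cong (sym (+-identityˡ x)) ≋-refl ⟩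
      (0# ∷ (q *ₚ D)) +ₚ (x ∷ r)
        ≈⟨ solve 3 (λ a b c → b :+ c := (a :+ b) :+ (c :- a)) ≋-refl (c ·ₚ D) (0# ∷ (q *ₚ D)) (x ∷ r) ⟩
      ((c ·ₚ D) +ₚ (0# ∷ (q *ₚ D))) +ₚ r′ ∎)
    where
    open P
    c : Carrier
    -- Prefixing `x` lets the old remainder reach degree d; subtracting `c` times `D` removes the
    -- term of that degree.
    c = coeff (x ∷ r) d
    r′ : Poly
    r′ = (x ∷ r) +ₚ (-ₚ (c ·ₚ D))
    coeff-r′ : ∀ i → coeff r′ i ≡ coeff (x ∷ r) i - c * coeff D i
    coeff-r′ i = trans (coeff-+ (x ∷ r) (-ₚ (c ·ₚ D)) i) (cong (coeff (x ∷ r) i +_)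
        (trans (coeff-neg (c ·ₚ D) i) (cong -_ (coeff-· c D i))))
    below′ : Below d r′
    below′ i d≤i with ℕₚ.m≤n⇒m<n∨m≡n d≤i
    ... | inj₂ refl = trans (coeff-r′ d) (x≡y⇒x-y≡0 (sym (trans (cong (c *_) (lead mD)) (*-identityʳ c))))
    ... | inj₁ (ℕ.s≤s {n = i} d≤i) = trans (coeff-r′ (suc i))
        (trans (cong₂ (λ u v → u - c * v) (below i d≤i) (above mD (suc i) (ℕ.s≤s d≤i)))
            (x≡y⇒x-y≡0 (sym (zeroʳ c))))

  remainder-zero : ∀ {d D} → IsMonic d D → ∀ s {r} → Below d r → s *ₚ D ≋ r → s ≋ []
  remainder-zero {d} mD s below eq with degree s
  ... | inj₁ s≋[] = s≋[]
  ... | inj₂ (a , ds) = contradiction (Degree<Below (Degree-≋ eq (Degree-* ds (Monic⇒Degree mD))) below)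
      (ℕₚ.≤⇒≯ (ℕₚ.m≤n+m d a))

  cancel : ∀ {d D} → IsMonic d D → ∀ {p q} → p *ₚ D ≋ q *ₚ D → p ≋ q
  cancel {d} {D} mD {p} {q} eq = begin
    p                ≈⟨ solve 2 (λ p q → p := (p :- q) :+ q) ≋-refl p q ⟩
    (p +ₚ (-ₚ q)) +ₚ q ≈⟨ +-cong (remainder-zero mD (p +ₚ (-ₚ q)) {[]} (λ _ _ → refl) difference) ≋-refl ⟩
    q ∎
    where
    open P
    difference : (p +ₚ (-ₚ q)) *ₚ D ≋ []
    difference = begin
      (p +ₚ (-ₚ q)) *ₚ D         ≈⟨ solve 3 (λ p q D → (p :- q) :* D := p :* D :- q :* D) ≋-refl p q D ⟩
      (p *ₚ D) +ₚ (-ₚ (q *ₚ D))  ≈⟨ +-cong eq ≋-refl ⟩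
      (q *ₚ D) +ₚ (-ₚ (q *ₚ D))  ≈⟨ +ₚ-inverseʳ (q *ₚ D) ⟩
      [] ∎

  ∣ₚ? : ∀ {d D} → IsMonic d D → Decidable (D ∣ₚ_)
  ∣ₚ? {d} {D} mD f with division mD f
  ... | q , r , below , f≋ with ≋[]? r
  ...   | yes r≋[] = yes (q , ≋-trans f≋ (≋-trans (+-cong (≋-refl {q *ₚ D}) r≋[]) (+ₚ-identityʳ (q *ₚ D))))
  ...   | no r≢[] = no λ { (q′ , f≋q′D) → r≢[] (≋-trans (≋-sym (remainder q′ f≋q′D))
      (≋[]⇒*≋[] D (remainder-zero mD (q′ +ₚ (-ₚ q)) below (remainder q′ f≋q′D)))) }
    where
    open P
    remainder : ∀ q′ → f ≋ q′ *ₚ D → (q′ +ₚ (-ₚ q)) *ₚ D ≋ r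
    remainder q′ f≋q′D = begin
      (q′ +ₚ (-ₚ q)) *ₚ D                       ≈⟨ solve 3 (λ p q D → (p :- q) :* D := p :* D :- q :* D) ≋-refl q′ q
          D ⟩
      (q′ *ₚ D) +ₚ (-ₚ (q *ₚ D))                ≈⟨ +-cong (≋-trans (≋-sym f≋q′D) f≋) ≋-refl ⟩
      ((q *ₚ D) +ₚ r) +ₚ (-ₚ (q *ₚ D))          ≈⟨ solve 2 (λ a r → (a :+ r) :- a := r) ≋-refl (q *ₚ D) r ⟩
      r ∎

  cofactor : ∀ {n d f D} → IsMonic n f → IsMonic d D → ∀ {q} → f ≋ q *ₚ D → ∃ λ j → j ℕ.+ d ≡ n × IsMonic j q
  cofactor {n} {d} {f} {D} mf mD {q} f≋ with degree q
  ... | inj₁ q≋[] = contradiction (≋-trans f≋ (≋[]⇒*≋[] D q≋[])) (Degree-≢[] (Monic⇒Degree mf))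
  ... | inj₂ (j , dq) = j , j+d≡n , trans (sym (*-identityʳ _)) (trans (cong (coeff q j *_) (sym (lead mD)))
          (trans (sym (proj₂ (product-degree q D j d (below dq) (above mD))))
              (trans (sym (at f≋ (j ℕ.+ d))) (trans (cong (coeff f) j+d≡n) (lead mf)))))
          , below dq
    where
    j+d≡n : j ℕ.+ d ≡ n
    j+d≡n = Degree-unique (Degree-≋ (≋-sym f≋) (Degree-* dq (Monic⇒Degree mD))) (Monic⇒Degree mf)

  normalise : ∀ {a p} → Degree a p → ∃ λ c → ∃ λ c′ → ((c ∷ []) *ₚ (c′ ∷ []) ≋ 1ₚ) × IsMonic a ((c ∷ []) *ₚ p)
  normalise {a} {p} (lead , above) = coeff p a ⁻¹ , coeff p a
    , ∷-cong (trans (+-identityʳ _) (*-inverseˡ lead)) ≋-refl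
    , Monic-≋ (≋-sym (constant-* _ p)) (trans (coeff-· _ p a) (*-inverseˡ lead) , λ i a<i → trans (coeff-· _ p i)
        (trans (cong (coeff p a ⁻¹ *_) (above i a<i)) (zeroʳ _)))

  Irreducible-≋ : ∀ {f g} → f ≋ g → Irreducible f → Irreducible g
  Irreducible-≋ f≋g (nonconst , irr) = (λ const → nonconst (λ i 1≤i → trans (at f≋g i) (const i 1≤i)))
    , λ h k g≈hk → irr h k (at (≋-trans f≋g (mk {q = h *ₚ k} g≈hk)))

  -- Up to a constant, a factor is monic, and there are only finitely many monic polynomials of
  -- degree below n. This turns irreducibility, which quantifies over all factorisations, into a
  -- decidable property.
  ProperDivisor : ℕ → Poly → Set
  ProperDivisor n f = ∃ λ d → d ℕ.< n × 0 ℕ.< d × ∃ λ (w : Vec Carrier d) → monic w ∣ₚ f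

  Constant-monic : ∀ {d p} → IsMonic d p → IsConstant p → d ≡ 0
  Constant-monic {zero} _ _           = refl
  Constant-monic {suc d} (lead , _) const = contradiction (trans (sym lead) (const (suc d) (ℕ.s≤s ℕ.z≤n))) 1≢0

  no-divisor⇒irreducible : ∀ {n f} → 0 ℕ.< n → IsMonic n f → ¬ ProperDivisor n f → Irreducible f
  no-divisor⇒irreducible {n} {f} 0<n mf none = (λ const → ℕₚ.<⇒≢ 0<n (sym (Constant-monic mf const))) , split
    where
    split : ∀ g h → f ≈ₚ (g *ₚ h) → IsConstant g ⊎ IsConstant h
    split g h f≈gh with degree g | degree h
    ... | inj₁ g≋[] | _ = contradiction (≋-trans (mk f≈gh) (≋[]⇒*≋[] h g≋[])) (Degree-≢[] (Monic⇒Degree mf))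
    ... | inj₂ _ | inj₁ h≋[] = contradiction (≋-trans (mk f≈gh) (≋-trans (*-congʳ g h≋[]) (*ₚ-zeroʳ g)))
        (Degree-≢[] (Monic⇒Degree mf))
    ... | inj₂ (zero , _ , bg) | inj₂ _ = inj₁ bg
    ... | inj₂ (suc _ , _) | inj₂ (zero , _ , bh) = inj₂ bh
    ... | inj₂ (suc a , dg) | inj₂ (suc b , dh) with normalise dg
    -- Multiplication by `c` makes `g` a monic divisor, and `c′` undoes this in the cofactor.
    ...   | c , c′ , cc′≋1 , mcg = ⊥-elim (none (suc a , a<n , ℕ.s≤s ℕ.z≤n , coeffs (suc a) ((c ∷ []) *ₚ g) ,
              ∣ₚ-cong (≋-sym (monic-coeffs mcg)) ≋-refl ((c′ ∷ []) *ₚ h , f≋)))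
      where
      open P
      a<n : suc a ℕ.< n
      a<n = subst (suc a ℕ.<_) (Degree-unique (Degree-≋ (≋-sym (mk f≈gh)) (Degree-* dg dh)) (Monic⇒Degree mf))
          (ℕₚ.m<m+n (suc a) (ℕ.s≤s ℕ.z≤n))
      f≋ : f ≋ ((c′ ∷ []) *ₚ h) *ₚ ((c ∷ []) *ₚ g)
      f≋ = begin
        f                                             ≈⟨ mk f≈gh ⟩
        g *ₚ h                                        ≈⟨ *ₚ-identityˡ (g *ₚ h) ⟨
        1ₚ *ₚ (g *ₚ h)                                ≈⟨ *-congˡ (g *ₚ h) (≋-sym cc′≋1) ⟩
        ((c ∷ []) *ₚ (c′ ∷ [])) *ₚ (g *ₚ h)           ≈⟨ solve 4
            (λ c c′ g h → (c :* c′) :* (g :* h) := (c′ :* h) :* (c :* g)) ≋-refl (c ∷ []) (c′ ∷ []) g h ⟩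
        ((c′ ∷ []) *ₚ h) *ₚ ((c ∷ []) *ₚ g)           ∎

  irreducible⇒no-divisor : ∀ {n f d D} → IsMonic n f → Irreducible f → d ℕ.< n → 0 ℕ.< d → IsMonic d D → ¬ D ∣ₚ f
  irreducible⇒no-divisor {D = D} mf (_ , irr) d<n 0<d mD (q , f≋) with irr q D (at f≋) | cofactor mf mD {q} f≋
  ... | inj₂ constD | _ = ℕₚ.<⇒≢ 0<d (sym (Constant-monic mD constD))
  ... | inj₁ constq | j , j+d≡n , mq = ℕₚ.<⇒≢ d<n (trans (cong (ℕ._+ _) (sym (Constant-monic mq constq))) j+d≡n)

  ProperDivisor? : ∀ n f → Dec (ProperDivisor n f)
  ProperDivisor? n f = ℕₚ.anyUpTo? (λ d → (0 ℕₚ.<? d) ×-dec Finite.∃? (Vec-finite finite d)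
      (λ w → ∣ₚ? (monic-degree w) f)) n

  irreducible-degree : ∀ {n f} → IsMonic n f → Irreducible f → 0 ℕ.< n
  irreducible-degree {zero} (_ , above) (nonconst , _) = contradiction above nonconst
  irreducible-degree {suc n} _ _ = ℕ.s≤s ℕ.z≤n

  abstract
    irreducible? : ∀ {n} (v : Vec Carrier n) → Dec (Irreducible (monic v))
    irreducible? {zero} v  = no λ irr → ℕₚ.<-irrefl refl (irreducible-degree (monic-degree v) irr)
    irreducible? {suc n} v with ProperDivisor? (suc n) (monic v)
    ... | yes (d , d<n , 0<d , w , w∣v) = no λ irr → irreducible⇒no-divisor (monic-degree v) irr d<n 0<d
        (monic-degree w) w∣v
    ... | no none = yes (no-divisor⇒irreducible (ℕ.s≤s ℕ.z≤n) (monic-degree v) none)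

  -- A proper monic divisor has smaller degree, so the search ends at an irreducible one; `N` is
  -- fuel bounding the degree.
  irreducible-divisor : ∀ N {n f} → n ℕ.≤ N → 0 ℕ.< n → IsMonic n f →
                        ∃ λ r → ∃ λ R → IsMonic r R × Irreducible R × R ∣ₚ f
  irreducible-divisor zero n≤0 0<n mf = contradiction (ℕₚ.<-≤-trans 0<n n≤0) (ℕₚ.<-irrefl refl)
  irreducible-divisor (suc N) {n} {f} n≤N 0<n mf with ProperDivisor? n f
  ... | no none = n , f , mf , no-divisor⇒irreducible 0<n mf none , 1ₚ , ≋-sym (*ₚ-identityˡ f)
  ... | yes (d , d<n , 0<d , w , w∣f) with irreducible-divisor N (ℕₚ.≤-pred (ℕₚ.≤-trans d<n n≤N)) 0<d (monic-degree w)
  ...   | r , R , mR , irr , R∣w = r , R , mR , irr , ∣ₚ-trans R∣w w∣f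

  module _ {t p} (mP : IsMonic t p) (irrP : Irreducible p) where

    -- One step of the Euclidean algorithm on (x , y).
    ∣-remainder : ∀ {x y q r} c b → x ≋ (q *ₚ y) +ₚ r → p ∣ₚ x *ₚ b → p ∣ₚ y *ₚ b → p ∣ₚ (c *ₚ r) *ₚ b
    ∣-remainder {x} {y} {q} {r} c b x≋ (s , xb≋) (u , yb≋) = c *ₚ (s +ₚ (-ₚ (q *ₚ u))) , (begin
      (c *ₚ r) *ₚ b                                     ≈⟨ solve 4
          (λ c a r b → (c :* r) :* b := c :* (((a :+ r) :* b) :- a :* b)) ≋-refl c (q *ₚ y) r b ⟩
      c *ₚ ((((q *ₚ y) +ₚ r) *ₚ b) +ₚ (-ₚ ((q *ₚ y) *ₚ b)))  ≈⟨ *-congʳ c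
          (+-cong (*-congˡ b (≋-sym x≋)) (neg-cong (*ₚ-assoc q y b))) ⟩
      c *ₚ ((x *ₚ b) +ₚ (-ₚ (q *ₚ (y *ₚ b))))           ≈⟨ *-congʳ c (+-cong xb≋ (neg-cong (*-congʳ q yb≋))) ⟩
      c *ₚ ((s *ₚ p) +ₚ (-ₚ (q *ₚ (u *ₚ p))))           ≈⟨ solve 5
          (λ c s p q u → c :* (s :* p :- q :* (u :* p)) := (c :* (s :- q :* u)) :* p) ≋-refl c s p q u ⟩
      (c *ₚ (s +ₚ (-ₚ (q *ₚ u)))) *ₚ p ∎)
      where open P

    -- Euclid's algorithm carried out inside the divisibility: if p divides a b, it divides r b for
    -- the remainder r of p modulo a. This r is nonzero because p is irreducible, and it has smaller
    -- degree than a. Made monic, it replaces a, until a = 1.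
    euclid-small : ∀ N {k a} b → k ℕ.≤ N → k ℕ.< t → IsMonic k a → p ∣ₚ a *ₚ b → p ∣ₚ b
    euclid-small N {zero} {a} b k≤N k<t ma p∣ab = ∣ₚ-cong ≋-refl (≋-trans (*-congˡ b a≋1) (*ₚ-identityˡ b)) p∣ab
      where
      a≋1 : a ≋ 1ₚ
      a≋1 = ≋-sym (monic-coeffs ma)
    euclid-small (suc N) {suc k} {a} b (ℕ.s≤s k≤N) k<t ma p∣ab with division ma p
    ... | q , r , below , p≋ with degree r
    ...   | inj₁ r≋[] = contradiction (q , ≋-trans p≋ (≋-trans (+-cong (≋-refl {q *ₚ a}) r≋[])
        (+ₚ-identityʳ (q *ₚ a)))) (irreducible⇒no-divisor mP irrP k<t (ℕ.s≤s ℕ.z≤n) ma)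
    ...   | inj₂ (k′ , dr) with normalise dr
    ...     | c , _ , _ , mcr = euclid-small N b (ℕₚ.≤-trans (ℕₚ.≤-pred k′<k) k≤N) (ℕₚ.<-trans k′<k k<t) mcr
                (∣-remainder {q = q} {r} (c ∷ []) b p≋ (b , *ₚ-comm p b) p∣ab)
      where
      k′<k : k′ ℕ.< suc k
      k′<k = Degree<Below dr below

    -- `R` may be replaced by its remainder modulo `p`, which has degree below that of `p`. It is
    -- nonzero because a monic irreducible polynomial divides another one only if they are equal.
    euclid : ∀ {n R} b → IsMonic n R → Irreducible R → ¬ R ≋ p → p ∣ₚ R *ₚ b → p ∣ₚ b
    euclid {n} {R} b mR irrR R≢p p∣Rb with division mP R
    ... | q , r , below , R≋ with degree r
    ...   | inj₂ (k , dr) with normalise dr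
    ...     | c , _ , _ , mcr = euclid-small k b ℕₚ.≤-refl (Degree<Below dr below) mcr
                (∣-remainder {q = q} {r} (c ∷ []) b R≋ p∣Rb (b , *ₚ-comm p b))
    euclid {n} {R} b mR irrR R≢p p∣Rb | q , r , below , R≋ | inj₁ r≋[] with cofactor mR mP R≋qp
      where
      R≋qp : R ≋ q *ₚ p
      R≋qp = ≋-trans {R} R≋ (≋-trans (+-cong (≋-refl {q *ₚ p}) r≋[]) (+ₚ-identityʳ (q *ₚ p)))
    ... | suc j , j+t≡n , mq = contradiction (q , ≋-trans {R} R≋
        (≋-trans (+-cong (≋-refl {q *ₚ p}) r≋[]) (+ₚ-identityʳ (q *ₚ p))))
            (irreducible⇒no-divisor mR irrR (subst (t ℕ.<_) j+t≡n (ℕₚ.m<n+m t (ℕ.s≤s ℕ.z≤n)))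
                (irreducible-degree mP irrP) mP)
    ... | zero , _ , mq = contradiction (≋-trans {R} R≋ (≋-trans
        (+-cong (*-congˡ {q} {1ₚ} p (≋-sym (monic-coeffs mq))) r≋[])
            (≋-trans (+ₚ-identityʳ (1ₚ *ₚ p)) (*ₚ-identityˡ p)))) R≢p

  _^ₚ_ : Poly → ℕ → Poly
  p ^ₚ zero  = 1ₚ
  p ^ₚ suc j = p *ₚ (p ^ₚ j)

  Monic-^ₚ : ∀ {d p} j → IsMonic d p → IsMonic (j ℕ.* d) (p ^ₚ j)
  Monic-^ₚ zero mp    = refl , λ { (suc i) _ → refl }
  Monic-^ₚ (suc j) mp = Monic-* mp (Monic-^ₚ j mp)

  1∣ₚ : ∀ f → 1ₚ ∣ₚ f
  1∣ₚ f = f , ≋-sym (≋-trans (*ₚ-comm f 1ₚ) (*ₚ-identityˡ f))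

  -- Induction on j: write g = h p^j, cancel p^j from the divisibility of R g by p^(j+1), and
  -- `euclid` extracts one more factor p from h.
  power-coprime : ∀ {t p n R} → IsMonic t p → Irreducible p → IsMonic n R → Irreducible R → ¬ R ≋ p →
                  ∀ j g → p ^ₚ j ∣ₚ R *ₚ g → p ^ₚ j ∣ₚ g
  power-coprime mp irrp mR irrR R≢p zero g _ = 1∣ₚ g
  power-coprime {p = p} {R = R} mp irrp mR irrR R≢p (suc j) g (s , Rg≋) =
    combine (power-coprime mp irrp mR irrR R≢p j g (s *ₚ p , ≋-trans Rg≋ (≋-sym (*ₚ-assoc s p (p ^ₚ j)))))
    where
    combine : p ^ₚ j ∣ₚ g → p ^ₚ suc j ∣ₚ g
    combine (h , g≋) = lift-factor (euclid mp irrp h mR irrR R≢p (s , cancel (Monic-^ₚ j mp) (begin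
      (R *ₚ h) *ₚ (p ^ₚ j)     ≈⟨ *ₚ-assoc R h (p ^ₚ j) ⟩
      R *ₚ (h *ₚ (p ^ₚ j))     ≈⟨ *-congʳ R (≋-sym g≋) ⟩
      R *ₚ g                   ≈⟨ Rg≋ ⟩
      s *ₚ (p *ₚ (p ^ₚ j))     ≈⟨ *ₚ-assoc s p (p ^ₚ j) ⟨
      (s *ₚ p) *ₚ (p ^ₚ j)     ∎)))
      where
      open P
      lift-factor : p ∣ₚ h → p ^ₚ suc j ∣ₚ g
      lift-factor (u , h≋) = u , ≋-trans g≋ (≋-trans (*-congˡ (p ^ₚ j) h≋) (*ₚ-assoc u p (p ^ₚ j)))

  power-cancel : ∀ {t p} → IsMonic t p → ∀ j g → p ^ₚ suc j ∣ₚ p *ₚ g → p ^ₚ j ∣ₚ g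
  power-cancel {p = p} mp j g (s , pg≋) = s , cancel mp (begin
    g *ₚ p                    ≈⟨ *ₚ-comm g p ⟩
    p *ₚ g                    ≈⟨ pg≋ ⟩
    s *ₚ (p *ₚ (p ^ₚ j))      ≈⟨ solve 3 (λ s p x → s :* (p :* x) := (s :* x) :* p) ≋-refl s p (p ^ₚ j) ⟩
    (s *ₚ (p ^ₚ j)) *ₚ p      ∎)
    where open P

  power-multiply : ∀ p j g → p ^ₚ j ∣ₚ g → p ^ₚ suc j ∣ₚ p *ₚ g
  power-multiply p j g (s , g≋) = s , ≋-trans (*-congʳ p g≋)
      (solve 3 (λ s p x → p :* (s :* x) := s :* (p :* x)) ≋-refl s p (p ^ₚ j))
    where open P

-- Sums over initial segments and over divisors

range : ℕ → List ℕ
range zero    = []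
range (suc n) = range n ++ (n ∷ [])

∑-range-suc : ∀ n f → ∑ (range (suc n)) f ≡ ∑ (range n) f ℕ.+ f n
∑-range-suc n f = trans (∑-++ (range n) (n ∷ []) f) (cong (∑ (range n) f ℕ.+_) (ℕₚ.+-identityʳ (f n)))

∑-range-shift : ∀ n f → ∑ (range (suc n)) f ≡ f 0 ℕ.+ ∑ (range n) (f ∘ suc)
∑-range-shift zero f    = refl
∑-range-shift (suc n) f = begin
  ∑ (range (suc (suc n))) f                       ≡⟨ ∑-range-suc (suc n) f ⟩
  ∑ (range (suc n)) f ℕ.+ f (suc n)               ≡⟨ cong (ℕ._+ f (suc n)) (∑-range-shift n f) ⟩
  f 0 ℕ.+ ∑ (range n) (f ∘ suc) ℕ.+ f (suc n)     ≡⟨ ℕₚ.+-assoc (f 0) _ _ ⟩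
  f 0 ℕ.+ (∑ (range n) (f ∘ suc) ℕ.+ f (suc n))   ≡⟨ cong (f 0 ℕ.+_) (∑-range-suc n (f ∘ suc)) ⟨
  f 0 ℕ.+ ∑ (range (suc n)) (f ∘ suc)             ∎
  where open ≡-Reasoning

∑-range-cong : ∀ n {f g} → (∀ d → d ℕ.< n → f d ≡ g d) → ∑ (range n) f ≡ ∑ (range n) g
∑-range-cong zero eq            = refl
∑-range-cong (suc n) {f} {g} eq = trans (∑-range-suc n f) (trans
  (cong₂ ℕ._+_ (∑-range-cong n (λ d d<n → eq d (ℕₚ.<-trans d<n (ℕₚ.n<1+n n)))) (eq n (ℕₚ.n<1+n n)))
      (sym (∑-range-suc n g)))

∑-range-zero : ∀ n {f} → (∀ d → d ℕ.< n → f d ≡ 0) → ∑ (range n) f ≡ 0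
∑-range-zero n eq = trans (∑-range-cong n eq) (∑-zero (range n))

∑-range-pick : ∀ n r → r ℕ.< n → ∀ (f : ℕ → ℕ) → ∑ (range n) (λ d → 𝟙 (d ℕₚ.≟ r) ℕ.* f d) ≡ f r
∑-range-pick (suc n) r r<1+n f with ℕₚ.m≤n⇒m<n∨m≡n (ℕₚ.≤-pred r<1+n)
... | inj₁ r<n = trans (∑-range-suc n (λ d → 𝟙 (d ℕₚ.≟ r) ℕ.* f d)) (trans (cong₂ ℕ._+_ (∑-range-pick n r r<n f)
        (cong (ℕ._* f n) (𝟙-no (n ℕₚ.≟ r) (λ n≡r → ℕₚ.<-irrefl (sym n≡r) r<n)))) (ℕₚ.+-identityʳ (f r)))
... | inj₂ refl = trans (∑-range-suc r (λ d → 𝟙 (d ℕₚ.≟ r) ℕ.* f d)) (cong₂ ℕ._+_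
        (∑-range-zero r (λ d d<r → cong (ℕ._* f d) (𝟙-no (d ℕₚ.≟ r) (λ d≡r → ℕₚ.<-irrefl d≡r d<r))))
        (trans (cong (ℕ._* f r) (𝟙-yes (r ℕₚ.≟ r) refl)) (ℕₚ.*-identityˡ (f r))))

∑-range-none : ∀ n {P : ℕ → Set} (P? : Decidable P) → (∀ d → d ℕ.< n → ¬ P d) → ∑ (range n) (λ d → 𝟙 (P? d)) ≡ 0
∑-range-none n P? ¬p = ∑-range-zero n (λ d d<n → 𝟙-no (P? d) (¬p d d<n))

divisorSum : (ℕ → ℕ) → ℕ → ℕ
divisorSum A n = ∑ (range n) (λ d → 𝟙 (suc d ∣? n) ℕ.* A (suc d))

-- Möbius inversion as a strong induction. The hypothesis speaks of divisors of `l` because K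
-- contains the field of Q^n elements only when n divides `l`.
divisorSum-injective : ∀ A B l → (∀ n → suc n ∣ l → divisorSum A (suc n) ≡ divisorSum B (suc n)) →
                       ∀ n → suc n ∣ l → A (suc n) ≡ B (suc n)
divisorSum-injective A B l sums = <-rec (λ n → suc n ∣ l → A (suc n) ≡ B (suc n)) induct
  where
  term : (ℕ → ℕ) → ℕ → ℕ → ℕ
  term C n d = 𝟙 (suc d ∣? suc n) ℕ.* C (suc d)
  last-term : ∀ C n → term C n n ≡ C (suc n)
  last-term C n = trans (cong (ℕ._* C (suc n)) (𝟙-yes (suc n ∣? suc n) ∣-refl)) (ℕₚ.*-identityˡ _)
  induct : ∀ n → (∀ {d} → d ℕ.< n → suc d ∣ l → A (suc d) ≡ B (suc d)) → suc n ∣ l → A (suc n) ≡ B (suc n)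
  induct n ih n∣l = trans (sym (last-term A n)) (trans (ℕₚ.+-cancelˡ-≡ (∑ (range n) (term A n)) _ _ (begin
    ∑ (range n) (term A n) ℕ.+ term A n n   ≡⟨ ∑-range-suc n (term A n) ⟨
    divisorSum A (suc n)                    ≡⟨ sums n n∣l ⟩
    divisorSum B (suc n)                    ≡⟨ ∑-range-suc n (term B n) ⟩
    ∑ (range n) (term B n) ℕ.+ term B n n   ≡⟨ cong (ℕ._+ term B n n) (∑-range-cong n smaller) ⟨
    ∑ (range n) (term A n) ℕ.+ term B n n   ∎)) (last-term B n))
    where
    open ≡-Reasoning
    smaller : ∀ d → d ℕ.< n → term A n d ≡ term B n d
    smaller d d<n = by-cases (suc d ∣? suc n)
      where
      by-cases : (dec : Dec (suc d ∣ suc n)) → 𝟙 dec ℕ.* A (suc d) ≡ 𝟙 dec ℕ.* B (suc d)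
      by-cases (yes d∣n) = cong (1 ℕ.*_) (ih d<n (∣-trans d∣n n∣l))
      by-cases (no _)    = refl

-- Counting monic irreducible polynomials

module GaussFormula (F : FiniteField) where
  open Factorization F

  vecs : ∀ n → Finite (Vec Carrier n)
  vecs n = Vec-finite finite n

  allVecs : ∀ n → List (Vec Carrier n)
  allVecs n = Finite.elements (vecs n)

  #Irreducible : ℕ → ℕ
  #Irreducible n = Finite.# (vecs n) irreducible?

  power-∣? : ∀ {d} (v : Vec Carrier d) j → Decidable (monic v ^ₚ j ∣ₚ_)
  power-∣? v j = ∣ₚ? (Monic-^ₚ j (monic-degree v))

  -- For `B` large enough, the exponent of P = `monic v` in `f`, as the number of j from 1 to `B`
  -- with P^j dividing `f`. In this form it can be summed over `f` for each fixed j.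
  multiplicity : ∀ {d} → ℕ → Vec Carrier d → Poly → ℕ
  multiplicity B v f = ∑ (range B) (λ j → 𝟙 (power-∣? v (suc j) f))

  -- Σ deg P over the pairs (P , j) with P^j ∣ f; the bound B only has to be at least deg f.
  degreeSum : ℕ → Poly → ℕ
  degreeSum B f = ∑ (range B) (λ d → ∑ (allVecs (suc d)) (λ v → 𝟙 (irreducible? v) ℕ.*
      (suc d ℕ.* multiplicity B v f)))

  power-degree-bound : ∀ {d n f} (v : Vec Carrier (suc d)) j → IsMonic n f → monic v ^ₚ j ∣ₚ f → j ℕ.≤ n
  power-degree-bound {d} v j mf (q , f≋) with cofactor mf (Monic-^ₚ j (monic-degree v)) {q} f≋
  ... | i , i+jd≡n , _ = ℕₚ.≤-trans (ℕₚ.m≤m*n j (suc d)) (ℕₚ.≤-trans (ℕₚ.m≤n+m _ i) (ℕₚ.≤-reflexive i+jd≡n))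

  module _ {r R} (mR : IsMonic r R) (irrR : Irreducible R) where

    -- If P differs from R, the same powers of P divide R g and g. If P = R, then P^(j+1) divides R
    -- g exactly when P^j divides g, which shifts the range by one: j = 0 is gained, and j = B costs
    -- nothing because the degree of g is less than B.
    multiplicity-step : ∀ B {d} (v : Vec Carrier (suc d)) → Irreducible
        (monic v) → ∀ {n f g} → IsMonic n g → n ℕ.< B →
                        f ≋ R *ₚ g → multiplicity B v f ≡ multiplicity B v g ℕ.+ 𝟙 (monic v ≋? R)
    multiplicity-step B v irrv {n} {f} {g} mg n<B f≋ = by-cases (monic v ≋? R)
      where
      open ≡-Reasoning
      a : ℕ → ℕ
      a j = 𝟙 (power-∣? v j g)
      by-cases : (dec : Dec (monic v ≋ R)) → multiplicity B v f ≡ multiplicity B v g ℕ.+ 𝟙 dec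
      by-cases (no v≢R) = trans (∑-cong (range B) (λ j → 𝟙-cong (power-∣? v (suc j) f) (power-∣? v (suc j) g)
            (λ pj∣f → power-coprime (monic-degree v) irrv mR irrR (v≢R ∘ ≋-sym) (suc j) g (∣ₚ-cong ≋-refl f≋ pj∣f))
            (λ { (s , g≋) → R *ₚ s , ≋-trans f≋ (≋-trans (*-congʳ R g≋) (≋-sym (*ₚ-assoc R s (monic v ^ₚ suc j))))
                })))
          (sym (ℕₚ.+-identityʳ _))
      by-cases (yes v≋R) = begin
        multiplicity B v f
          ≡⟨ ∑-cong (range B) (λ j → 𝟙-cong (power-∣? v (suc j) f) (power-∣? v j g)
               (λ pj∣f → power-cancel (monic-degree v) j g (∣ₚ-cong ≋-refl f≋vg pj∣f))
               (λ pj∣g → ∣ₚ-cong ≋-refl (≋-sym f≋vg) (power-multiply (monic v) j g pj∣g))) ⟩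
        ∑ (range B) a                     ≡⟨ ℕₚ.+-identityʳ _ ⟨
        ∑ (range B) a ℕ.+ 0               ≡⟨ cong (∑ (range B) a ℕ.+_)
            (𝟙-no (power-∣? v B g) (λ pB∣g → ℕₚ.<⇒≱ n<B (power-degree-bound v B mg pB∣g))) ⟨
        ∑ (range B) a ℕ.+ a B             ≡⟨ ∑-range-suc B a ⟨
        ∑ (range (suc B)) a               ≡⟨ ∑-range-shift B a ⟩
        a 0 ℕ.+ ∑ (range B) (a ∘ suc)     ≡⟨ cong (ℕ._+ ∑ (range B) (a ∘ suc)) (𝟙-yes (power-∣? v 0 g) (1∣ₚ g)) ⟩
        1 ℕ.+ multiplicity B v g          ≡⟨ ℕₚ.+-comm 1 _ ⟩
        multiplicity B v g ℕ.+ 1          ∎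
        where
        f≋vg : f ≋ monic v *ₚ g
        f≋vg = ≋-trans f≋ (*-congˡ g (≋-sym v≋R))

    matching : ∀ d → ∑ (allVecs (suc d)) (λ v → 𝟙 (irreducible? v) ℕ.* 𝟙 (monic v ≋? R)) ≡ 𝟙 (suc d ℕₚ.≟ r)
    matching d = trans (∑-cong (allVecs (suc d)) (λ v → sym (𝟙-× (irreducible? v) (monic v ≋? R))))
        (count (suc d ℕₚ.≟ r))
      where
      match? : Decidable (λ (v : Vec Carrier (suc d)) → Irreducible (monic v) × monic v ≋ R)
      match? v = irreducible? v ×-dec (monic v ≋? R)
      count : (dec : Dec (suc d ≡ r)) → Finite.# (vecs (suc d)) match? ≡ 𝟙 dec
      count (no d≢r) = Finite.#-none (vecs (suc d)) match? (λ
          { v (_ , v≋R) → d≢r (Degree-unique (Degree-≋ v≋R (Monic⇒Degree (monic-degree v))) (Monic⇒Degree mR)) })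
      count (yes refl) = ℕₚ.≤-antisym
        (Finite.#-unique (vecs (suc d)) match? (λ { v w (_ , v≋R) (_ , w≋R) → monic-injective
            (≋-trans v≋R (≋-sym w≋R)) }))
        (Finite.#-positive (vecs (suc d)) match? (coeffs (suc d) R , Irreducible-≋
            (≋-sym (monic-coeffs mR)) irrR , monic-coeffs mR))

    degreeSum-step : ∀ B {n f g} → r ℕ.≤ B → IsMonic n g → n ℕ.< B → f ≋ R *ₚ g → degreeSum B f ≡ degreeSum B g ℕ.+ r
    degreeSum-step B {n} {f} {g} r≤B mg n<B f≋ = begin
      degreeSum B f
        ≡⟨ ∑-cong (range B) (λ d → trans (∑-cong (allVecs (suc d)) (λ v → step-term d v))
            (∑-+ (allVecs (suc d)) _ _)) ⟩
      ∑ (range B) (λ d → old d ℕ.+ new d)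
        ≡⟨ ∑-+ (range B) old new ⟩
      degreeSum B g ℕ.+ ∑ (range B) new
        ≡⟨ cong (degreeSum B g ℕ.+_) (new-total r r≤B (irreducible-degree mR irrR) refl) ⟩
      degreeSum B g ℕ.+ r ∎
      where
      open ≡-Reasoning
      old new : ℕ → ℕ
      old d = ∑ (allVecs (suc d)) (λ v → 𝟙 (irreducible? v) ℕ.* (suc d ℕ.* multiplicity B v g))
      new d = ∑ (allVecs (suc d)) (λ v → suc d ℕ.* (𝟙 (irreducible? v) ℕ.* 𝟙 (monic v ≋? R)))
      step-term : ∀ d (v : Vec Carrier (suc d)) → 𝟙 (irreducible? v) ℕ.* (suc d ℕ.* multiplicity B v f) ≡
        𝟙 (irreducible? v) ℕ.* (suc d ℕ.* multiplicity B v g) ℕ.+ suc d ℕ.* (𝟙 (irreducible? v) ℕ.* 𝟙 (monic v ≋? R))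
      step-term d v with irreducible? v
      ... | no _     = sym (ℕₚ.*-zeroʳ (suc d))
      ... | yes irrv = trans (cong (λ x → 1 ℕ.* (suc d ℕ.* x)) (multiplicity-step B v irrv mg n<B f≋))
              (identity (suc d) (multiplicity B v g) (𝟙 (monic v ≋? R)))
        where
        identity : ∀ a x y → 1 ℕ.* (a ℕ.* (x ℕ.+ y)) ≡ 1 ℕ.* (a ℕ.* x) ℕ.+ a ℕ.* (1 ℕ.* y)
        identity = nat.solve 3 (λ a x y → nat.con 1 nat.:* (a nat.:* (x nat.:+ y)) nat.:= nat.con 1 nat.:*
            (a nat.:* x) nat.:+ a nat.:* (nat.con 1 nat.:* y)) refl
          where module nat = ℕSolver.+-*-Solver
      new-total : ∀ s → s ℕ.≤ B → 0 ℕ.< s → s ≡ r → ∑ (range B) new ≡ s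
      new-total (suc s) s<B _ s≡r = trans (∑-cong (range B) (λ d → trans (∑-*ˡ (allVecs (suc d)) (suc d) _)
          (trans (cong (suc d ℕ.*_) (trans (matching d) (𝟙-cong (suc d ℕₚ.≟ r) (d ℕₚ.≟ s)
             (λ d≡r → ℕₚ.suc-injective (trans d≡r (sym s≡r))) (λ d≡s → trans (cong suc d≡s) s≡r))))
            (ℕₚ.*-comm (suc d) _))))
        (∑-range-pick B s s<B suc)

  -- Both sides drop by r when an irreducible factor of degree r is removed; `N` is fuel for this
  -- recursion.
  degreeSum≡degree : ∀ N B {n f} → n ℕ.≤ N → n ℕ.≤ B → IsMonic n f → degreeSum B f ≡ n
  degreeSum≡degree N B {zero} {f} n≤N n≤B mf = trans (∑-cong (range B) (λ d → trans (∑-cong (allVecs (suc d)) (λ v →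
      trans (cong (λ x → 𝟙 (irreducible? v) ℕ.* (suc d ℕ.* x))
          (∑-range-none B (λ j → power-∣? v (suc j) f) (λ j _ pj∣f → ℕₚ.<⇒≱ (ℕ.s≤s ℕ.z≤n)
          (power-degree-bound v (suc j) mf pj∣f))))
        (trans (cong (𝟙 (irreducible? v) ℕ.*_) (ℕₚ.*-zeroʳ (suc d))) (ℕₚ.*-zeroʳ (𝟙 (irreducible? v))))))
      (∑-zero (allVecs (suc d))))) (∑-zero (range B))
  degreeSum≡degree (suc N) B {suc n} {f} (ℕ.s≤s n≤N) n≤B mf with irreducible-divisor (suc n) ℕₚ.≤-refl
      (ℕ.s≤s ℕ.z≤n) mf
  ... | r , R , mR , irrR , g , f≋ with cofactor mf mR {g} f≋
  ...   | j , j+r≡n , mg = trans (degreeSum-step mR irrR B r≤B mg (ℕₚ.<-≤-trans j<1+n n≤B) (≋-trans f≋ (*ₚ-comm g R)))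
            (trans (cong (ℕ._+ r) (degreeSum≡degree N B (ℕₚ.≤-trans (ℕₚ.≤-pred j<1+n) n≤N)
                (ℕₚ.≤-trans (ℕₚ.<⇒≤ j<1+n) n≤B) mg)) j+r≡n)
    where
    0<r : 0 ℕ.< r
    0<r = irreducible-degree mR irrR
    r≤B : r ℕ.≤ B
    r≤B = ℕₚ.≤-trans (ℕₚ.m≤n+m r j) (ℕₚ.≤-trans (ℕₚ.≤-reflexive j+r≡n) n≤B)
    j<1+n : j ℕ.< suc n
    j<1+n = subst (j ℕ.<_) j+r≡n (ℕₚ.m<m+n j 0<r)

  -- The number of monic multiples of degree n of a monic polynomial of degree d. The indicator
  -- corrects truncated subtraction, which would give 1 for d > n.
  multiples : ℕ → ℕ → ℕ
  multiples n d = 𝟙 (d ℕₚ.≤? n) ℕ.* card ℕ.^ (n ℕ.∸ d)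

  #-vecs : ∀ n → Finite.size (vecs n) ≡ card ℕ.^ n
  #-vecs n = trans (Vec-size finite n) (cong (ℕ._^ n) size≡card)

  #-multiples : ∀ n {d D} (mD : IsMonic d D) → Finite.# (vecs n) (λ v → ∣ₚ? mD (monic v)) ≡ multiples n d
  #-multiples n {d} {D} mD = by-cases (d ℕₚ.≤? n)
   where
   by-cases : (dec : Dec (d ℕ.≤ n)) → Finite.# (vecs n) (λ v → ∣ₚ? mD (monic v)) ≡ 𝟙 dec ℕ.* card ℕ.^ (n ℕ.∸ d)
   by-cases (no d≰n) = Finite.#-none (vecs n) (λ v → ∣ₚ? mD (monic v))
       (λ { v (q , v≋) → d≰n (small v (cofactor (monic-degree v) mD {q} v≋)) })
       where
       small : ∀ {q} (v : Vec Carrier n) → (∃ λ j → j ℕ.+ d ≡ n × IsMonic j q) → d ℕ.≤ n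
       small v (j , j+d≡n , _) = subst (d ℕ.≤_) j+d≡n (ℕₚ.m≤n+m d j)
   by-cases (yes d≤n) = trans (#-bijection (vecs n) (vecs j) (λ v → ∣ₚ? mD (monic v))
       (λ w → Finite._≟_ (vecs j) w w) to from
         (λ _ _ → refl) (λ w _ → monic w , monic-coeffs (product w)) from-to to-from)
         (trans (Finite.#-all (vecs j) (λ w → Finite._≟_ (vecs j) w w) (λ _ → refl))
             (trans (#-vecs j) (sym (ℕₚ.*-identityˡ _))))
       where
       j : ℕ
       j = n ℕ.∸ d
       j+d≡n : j ℕ.+ d ≡ n
       j+d≡n = ℕₚ.m∸n+n≡m d≤n
       quotient : Vec Carrier n → Poly
       quotient v = proj₁ (division mD (monic v))
       to : Vec Carrier n → Vec Carrier j
       to v = coeffs j (quotient v)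
       from : Vec Carrier j → Vec Carrier n
       from w = coeffs n (monic w *ₚ D)
       product : ∀ w → IsMonic n (monic w *ₚ D)
       product w = subst (λ i → IsMonic i (monic w *ₚ D)) j+d≡n (Monic-* (monic-degree w) mD)
       quotient-unique : ∀ v {q} → monic v ≋ q *ₚ D → quotient v ≋ q
       quotient-unique v {q} v≋ = P-cancel
         where
         r : Poly
         r = proj₁ (proj₂ (division mD (monic v)))
         v≋′ : monic v ≋ (quotient v *ₚ D) +ₚ r
         v≋′ = proj₂ (proj₂ (proj₂ (division mD (monic v))))
         difference : (q +ₚ (-ₚ quotient v)) *ₚ D ≋ r
         difference = begin
           (q +ₚ (-ₚ quotient v)) *ₚ D                         ≈⟨ solve 3
               (λ p q D → (p :- q) :* D := p :* D :- q :* D) ≋-refl q (quotient v) D ⟩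
           (q *ₚ D) +ₚ (-ₚ (quotient v *ₚ D))                  ≈⟨ +-cong (≋-trans (≋-sym v≋) v≋′) ≋-refl ⟩
           ((quotient v *ₚ D) +ₚ r) +ₚ (-ₚ (quotient v *ₚ D))  ≈⟨ solve 2 (λ a r → (a :+ r) :- a := r) ≋-refl
               (quotient v *ₚ D) r ⟩
           r ∎
           where open P
         P-cancel : quotient v ≋ q
         P-cancel = begin
           quotient v                              ≈⟨ ≋-refl ⟩
           [] +ₚ quotient v                        ≈⟨ +-cong
               (remainder-zero mD (q +ₚ (-ₚ quotient v)) (proj₁ (proj₂ (proj₂ (division mD (monic v))))) difference)
               ≋-refl ⟨
           (q +ₚ (-ₚ quotient v)) +ₚ quotient v    ≈⟨ solve 2 (λ p q → (p :- q) :+ q := p) ≋-refl q (quotient v) ⟩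
           q ∎
           where open P
       from-to : ∀ v → D ∣ₚ monic v → from (to v) ≡ v
       from-to v (q , v≋) = trans (coeffs-cong n (≋-trans (*-congˡ D
           (≋-trans (monic-coeffs (Monic-≋ (≋-sym q≋) monic-q)) q≋)) (≋-sym v≋))) (coeffs-monic v)
         where
         q≋ : quotient v ≋ q
         q≋ = quotient-unique v {q} v≋
         monic-q : IsMonic j q
         monic-q = from-cofactor (cofactor (monic-degree v) mD {q} v≋)
           where
           from-cofactor : (∃ λ i → i ℕ.+ d ≡ n × IsMonic i q) → IsMonic j q
           from-cofactor (i , i+d≡n , mq) = subst (λ i → IsMonic i q) (ℕₚ.+-cancelʳ-≡ d i j (trans i+d≡n (sym j+d≡n)))
               mq
       to-from : ∀ w → w ≡ w → to (from w) ≡ w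
       to-from w _ = trans (coeffs-cong j (quotient-unique (from w) {monic w} (monic-coeffs (product w))))
           (coeffs-monic w)

  -- Raising n by one multiplies the count by `card`, except that for s = n + 1 the first multiple
  -- appears. This exceptional term is what survives the subtraction in `gauss`.
  multiples-suc : ∀ n s → multiples (suc n) s ≡ card ℕ.* multiples n s ℕ.+ 𝟙 (s ℕₚ.≟ suc n)
  multiples-suc n s with ℕₚ.<-cmp s (suc n)
  ... | tri< s<1+n s≢ _ = begin
    𝟙 (s ℕₚ.≤? suc n) ℕ.* card ℕ.^ (suc n ℕ.∸ s)
      ≡⟨ cong₂ ℕ._*_ (𝟙-yes (s ℕₚ.≤? suc n) (ℕₚ.<⇒≤ s<1+n)) (cong (card ℕ.^_) (ℕₚ.+-∸-assoc 1 (ℕₚ.≤-pred s<1+n))) ⟩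
    1 ℕ.* (card ℕ.* card ℕ.^ (n ℕ.∸ s))  ≡⟨ ℕₚ.*-identityˡ _ ⟩
    card ℕ.* card ℕ.^ (n ℕ.∸ s)          ≡⟨ cong (card ℕ.*_)
        (trans (cong (ℕ._* card ℕ.^ (n ℕ.∸ s)) (𝟙-yes (s ℕₚ.≤? n) (ℕₚ.≤-pred s<1+n))) (ℕₚ.*-identityˡ _)) ⟨
    card ℕ.* multiples n s               ≡⟨ ℕₚ.+-identityʳ _ ⟨
    card ℕ.* multiples n s ℕ.+ 0         ≡⟨ cong (card ℕ.* multiples n s ℕ.+_) (𝟙-no (s ℕₚ.≟ suc n) s≢) ⟨
    card ℕ.* multiples n s ℕ.+ 𝟙 (s ℕₚ.≟ suc n) ∎
    where open ≡-Reasoning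
  ... | tri≈ _ refl _ = trans (cong₂ ℕ._*_ (𝟙-yes (suc n ℕₚ.≤? suc n) ℕₚ.≤-refl) (cong (card ℕ.^_) (ℕₚ.n∸n≡0 n)))
      (sym (trans (cong₂ (λ x y → card ℕ.* (x ℕ.* card ℕ.^ (n ℕ.∸ suc n)) ℕ.+ y)
          (𝟙-no (suc n ℕₚ.≤? n) (ℕₚ.<-irrefl refl)) (𝟙-yes (suc n ℕₚ.≟ suc n) refl))
        (cong (ℕ._+ 1) (ℕₚ.*-zeroʳ card))))
  ... | tri> _ s≢ n<s = trans (cong (ℕ._* card ℕ.^ (suc n ℕ.∸ s)) (𝟙-no (s ℕₚ.≤? suc n) (ℕₚ.<⇒≱ n<s)))
      (sym (trans (cong₂ (λ x y → card ℕ.* (x ℕ.* card ℕ.^ (n ℕ.∸ s)) ℕ.+ y)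
          (𝟙-no (s ℕₚ.≤? n) (ℕₚ.<⇒≱ (ℕₚ.<-trans (ℕₚ.n<1+n n) n<s))) (𝟙-no (s ℕₚ.≟ suc n) s≢))
        (cong (ℕ._+ 0) (ℕₚ.*-zeroʳ card))))

  private
    weight : ℕ → ℕ
    weight d = suc d ℕ.* #Irreducible (suc d)

    -- Summing degreeSum over the monic polynomials of degree n, in two ways.
    total : ∀ n B → n ℕ.≤ B → card ℕ.^ n ℕ.* n ≡ ∑ (range B)
        (λ d → weight d ℕ.* ∑ (range B) (λ j → multiples n (suc j ℕ.* suc d)))
    total n B n≤B = begin
      card ℕ.^ n ℕ.* n
        ≡⟨ cong (ℕ._* n) (#-vecs n) ⟨
      ∑ fs (λ _ → 1) ℕ.* n
        ≡⟨ ∑-*ʳ fs n (λ _ → 1) ⟨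
      ∑ fs (λ _ → 1 ℕ.* n)
        ≡⟨ ∑-cong fs (λ f → trans (ℕₚ.*-identityˡ n) (sym (degreeSum≡degree n B ℕₚ.≤-refl n≤B (monic-degree f)))) ⟩
      ∑ fs (λ f → degreeSum B (monic f))
        ≡⟨ ∑-swap fs (range B) _ ⟩
      ∑ (range B) (λ d → ∑ fs (λ f → ∑ (allVecs (suc d)) (λ v → 𝟙 (irreducible? v) ℕ.*
          (suc d ℕ.* multiplicity B v (monic f)))))
        ≡⟨ ∑-cong (range B) (λ d → trans (∑-swap fs (allVecs (suc d)) _)
            (trans (∑-cong (allVecs (suc d)) (per-divisor d))
             (trans (∑-*ʳ (allVecs (suc d)) (suc d ℕ.* ∑ (range B) (λ j → multiples n (suc j ℕ.* suc d)))
                 (λ v → 𝟙 (irreducible? v)))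
               (rearrange (#Irreducible (suc d)) (suc d) _)))) ⟩
      ∑ (range B) (λ d → weight d ℕ.* ∑ (range B) (λ j → multiples n (suc j ℕ.* suc d))) ∎
      where
      open ≡-Reasoning
      fs : List (Vec Carrier n)
      fs = allVecs n
      rearrange : ∀ a b c → a ℕ.* (b ℕ.* c) ≡ b ℕ.* a ℕ.* c
      rearrange a b c = trans (sym (ℕₚ.*-assoc a b c)) (cong (ℕ._* c) (ℕₚ.*-comm a b))
      per-divisor : ∀ d (v : Vec Carrier (suc d)) → ∑ fs (λ f → 𝟙 (irreducible? v) ℕ.*
          (suc d ℕ.* multiplicity B v (monic f)))
                    ≡ 𝟙 (irreducible? v) ℕ.* (suc d ℕ.* ∑ (range B) (λ j → multiples n (suc j ℕ.* suc d)))
      per-divisor d v = trans (∑-*ˡ fs (𝟙 (irreducible? v)) _)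
          (cong (𝟙 (irreducible? v) ℕ.*_) (trans (∑-*ˡ fs (suc d) _) (cong (suc d ℕ.*_)
        (trans (∑-swap fs (range B) _) (∑-cong (range B) (λ j → #-multiples n
            (Monic-^ₚ (suc j) (monic-degree v))))))))

  gauss : ∀ n → divisorSum (λ d → d ℕ.* #Irreducible d) (suc n) ≡ card ℕ.^ suc n
  gauss n = ℕₚ.+-cancelˡ-≡ (card ℕ.* (card ℕ.^ n ℕ.* n)) _ _ (sym (begin
    card ℕ.* (card ℕ.^ n ℕ.* n) ℕ.+ card ℕ.^ suc n
      ≡⟨ identity card (card ℕ.^ n) n ⟨
    card ℕ.^ suc n ℕ.* suc n
      ≡⟨ total (suc n) B ℕₚ.≤-refl ⟩
    ∑ (range B) (λ d → weight d ℕ.* ∑ (range B) (λ j → multiples (suc n) (suc j ℕ.* suc d)))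
      ≡⟨ ∑-cong (range B) (λ d → trans (cong (weight d ℕ.*_) (split d))
          (distribute (weight d) card (S d) (𝟙 (suc d ∣? suc n)))) ⟩
    ∑ (range B) (λ d → card ℕ.* (weight d ℕ.* S d) ℕ.+ 𝟙 (suc d ∣? suc n) ℕ.* weight d)
      ≡⟨ ∑-+ (range B) _ _ ⟩
    ∑ (range B) (λ d → card ℕ.* (weight d ℕ.* S d)) ℕ.+ divisorSum (λ d → d ℕ.* #Irreducible d) (suc n)
      ≡⟨ cong (ℕ._+ divisorSum (λ d → d ℕ.* #Irreducible d) (suc n))
          (trans (∑-*ˡ (range B) card (λ d → weight d ℕ.* S d)) (cong (card ℕ.*_) (sym (total n B (ℕₚ.n≤1+n n))))) ⟩
    card ℕ.* (card ℕ.^ n ℕ.* n) ℕ.+ divisorSum (λ d → d ℕ.* #Irreducible d) (suc n) ∎))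
    where
    open ≡-Reasoning
    B : ℕ
    -- One bound serves both n and n + 1, so that the two totals run over the same pairs.
    B = suc n
    S : ℕ → ℕ
    S d = ∑ (range B) (λ j → multiples n (suc j ℕ.* suc d))
    module nat = ℕSolver.+-*-Solver
    identity : ∀ c x n → (c ℕ.* x) ℕ.* suc n ≡ c ℕ.* (x ℕ.* n) ℕ.+ c ℕ.* x
    identity = nat.solve 3 (λ c x n → (c nat.:* x) nat.:* (nat.con 1 nat.:+ n) nat.:= c nat.:*
        (x nat.:* n) nat.:+ c nat.:* x) refl
    distribute : ∀ w c s i → w ℕ.* (c ℕ.* s ℕ.+ i) ≡ c ℕ.* (w ℕ.* s) ℕ.+ i ℕ.* w
    distribute = nat.solve 4 (λ w c s i → w nat.:* (c nat.:* s nat.:+ i) nat.:= c nat.:*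
        (w nat.:* s) nat.:+ i nat.:* w) refl
    divisor-indicator : ∀ d → ∑ (range B) (λ j → 𝟙 (suc j ℕ.* suc d ℕₚ.≟ suc n)) ≡ 𝟙 (suc d ∣? suc n)
    divisor-indicator d = by-cases (suc d ∣? suc n)
     where
     by-cases : (dec : Dec (suc d ∣ suc n)) → ∑ (range B) (λ j → 𝟙 (suc j ℕ.* suc d ℕₚ.≟ suc n)) ≡ 𝟙 dec
     by-cases (no d∤n) = ∑-range-none B (λ j → suc j ℕ.* suc d ℕₚ.≟ suc n) (λ j _ eq → d∤n (divides (suc j) (sym eq)))
     by-cases (yes (divides (suc j₀) n≡)) = trans (∑-cong (range B)
         (λ j → trans (𝟙-cong (suc j ℕ.* suc d ℕₚ.≟ suc n) (j ℕₚ.≟ j₀)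
            (λ eq → ℕₚ.suc-injective (ℕₚ.*-cancelʳ-≡ (suc j) (suc j₀) (suc d) (trans eq n≡))) (λ { refl → sym n≡ }))
                (sym (ℕₚ.*-identityʳ _))))
          (∑-range-pick B j₀ (subst (suc j₀ ℕ.≤_) (sym n≡) (ℕₚ.m≤m*n (suc j₀) (suc d))) (λ _ → 1))
    split : ∀ d → ∑ (range B) (λ j → multiples (suc n) (suc j ℕ.* suc d)) ≡ card ℕ.* S d ℕ.+ 𝟙 (suc d ∣? suc n)
    split d = trans (∑-cong (range B) (λ j → multiples-suc n (suc j ℕ.* suc d)))
      (trans (∑-+ (range B) _ _) (cong₂ ℕ._+_ (∑-*ˡ (range B) card _) (divisor-indicator d)))

  NumIrred≡#Irreducible : ∀ r {I} → NumIrred r I → I ≡ #Irreducible r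
  NumIrred≡#Irreducible r = HasSize-# (vecs r) irreducible? (λ f _ → coeffs r f) irreducible-coeffs injective
      surjective
    where
    fromDefs : ∀ {f} → MonicOfDegree r f → IsMonic r f
    fromDefs (lead , above) = lead , above
    irreducible-coeffs : ∀ f → MonicIrreducible r f → Irreducible (monic (coeffs r f))
    irreducible-coeffs f (mf , irr) = Irreducible-≋ {f} (≋-sym (monic-coeffs (fromDefs {f} mf))) irr
    injective : ∀ f g → MonicIrreducible r f → MonicIrreducible r g → coeffs r f ≡ coeffs r g → f ≈ₚ g
    injective f g (mf , _) (mg , _) eq = at (≋-trans (≋-sym (monic-coeffs (fromDefs {f} mf)))
      (≋-trans (mk {monic (coeffs r f)} {monic (coeffs r g)} λ i → cong (λ v → coeff (monic v) i) eq)
          (monic-coeffs (fromDefs {g} mg))))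
    surjective : ∀ v → Irreducible (monic v) → ∃ λ f → MonicIrreducible r f ×
        (∀ g → MonicIrreducible r g → f ≈ₚ g → coeffs r g ≡ v)
    surjective v irr = monic v , ((lead (monic-degree v) , above (monic-degree v)) , irr)
      , λ g _ v≈g → trans (coeffs-cong r (≋-sym (mk {monic v} {g} v≈g))) (coeffs-monic v)

open import Data.Nat using (_+_; _*_; _∸_; _^_; _<_; _≤_)

-- Counting the elements of K by degree

module GaussDegrees (K : FiniteField) (q : ℕ) (1<q : 1 < q) (^q-+ : AdditivePower K q)
                    (r : ℕ) (card≡ : FiniteField.card K ≡ q ^ suc r) where
  open Field K hiding (_+_; _*_)
  open FrobeniusPower K q 1<q ^q-+
  open Whole r card≡

  degree? : ∀ d → Decidable (λ x → Fixed d x × DegreeAtLeast d x)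
  degree? d x = Fixed? d x ×-dec DegreeAtLeast? d x

  #Degree : ℕ → ℕ
  #Degree d = # (degree? d)

  #-Fixed-∣ : ∀ n → suc n ∣ suc r → # (Fixed? (suc n)) ≡ q ^ suc n
  #-Fixed-∣ n (divides (suc c) r≡) = trans (#-cong (Fixed? (suc n)) (Θ.Fixed? 1)
      (λ x fx → trans (Θ.σ-1 x) fx) (λ x fx → trans (sym (Θ.σ-1 x)) fx)) ΘW.#-Fixed
    where
    -- K is also an extension of degree c + 1 of the field of q^(n+1) elements, so the exact count
    -- of the fixed field applies with q^(n+1) in place of q.
    module Θ = FrobeniusPower K (q ^ suc n) (q^-mono {0} {suc n} (ℕ.s≤s ℕ.z≤n)) (σ-+ (suc n))
    module ΘW = Θ.Whole c (trans card≡ (trans (cong (q ^_) (trans r≡ (ℕₚ.*-comm (suc c) (suc n))))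
        (sym (ℕₚ.^-*-assoc q (suc n) (suc c)))))

  -- Every element of the field of q^(n+1) elements is counted once, at its period, which divides n
  -- + 1.
  gauss-degrees : ∀ n → suc n ∣ suc r → divisorSum #Degree (suc n) ≡ q ^ suc n
  gauss-degrees n n∣r = trans (trans
      (∑-cong (range (suc n)) (λ d → sym (∑-*ˡ elements (𝟙 (suc d ∣? suc n)) (λ x → 𝟙 (degree? (suc d) x)))))
      (trans (∑-swap (range (suc n)) elements _) (∑-cong elements (λ x → by-cases x (Fixed? (suc n) x)))))
    (#-Fixed-∣ n n∣r)
    where
    term : Carrier → ℕ → ℕ
    term x d = 𝟙 (suc d ∣? suc n) * 𝟙 (degree? (suc d) x)
    by-cases : ∀ x (dec : Dec (Fixed (suc n) x)) → ∑ (range (suc n)) (term x) ≡ 𝟙 dec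
    by-cases x (no ¬fx) = ∑-range-zero (suc n) (λ d _ → trans (sym (𝟙-× (suc d ∣? suc n) (degree? (suc d) x)))
      (𝟙-no ((suc d ∣? suc n) ×-dec degree? (suc d) x) (λ { (d∣n , fd , _) → ¬fx (Fixed-∣ d∣n fd) })))
    by-cases x (yes fx) = at-period (period (suc n) x (ℕ.s≤s ℕ.z≤n) fx)
      where
      at-period : ∃ (Period x) → ∑ (range (suc n)) (term x) ≡ 1
      at-period (zero , per) = contradiction (positive per) (ℕₚ.<-irrefl refl)
      at-period (suc d₀ , per) = trans (∑-cong (range (suc n))
          (λ d → trans (sym (𝟙-× (suc d ∣? suc n) (degree? (suc d) x)))
          (trans (𝟙-cong ((suc d ∣? suc n) ×-dec degree? (suc d) x) (d ℕₚ.≟ d₀)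
              (λ { (_ , fd , deg) → only-period d fd deg })
            (λ { refl → divides-all per (suc n) fx , fixed per , λ i i<d 0<i → minimal per i 0<i i<d }))
                (sym (ℕₚ.*-identityʳ _)))))
        (∑-range-pick (suc n) d₀ (∣⇒≤ (divides-all per (suc n) fx)) (λ _ → 1))
        where
        only-period : ∀ d → Fixed (suc d) x → DegreeAtLeast (suc d) x → d ≡ d₀
        only-period d fd deg = ℕₚ.suc-injective (ℕₚ.≤-antisym
          (ℕₚ.≮⇒≥ (λ d₀<d → deg (suc d₀) d₀<d (ℕ.s≤s ℕ.z≤n) (fixed per))) (∣⇒≤ (divides-all per (suc d) fd)))

theorem5p2 : (p e q : ℕ) → Prime p → 1 ≤ e → q ≡ p ^ e →
    (m : ℕ) → 1 < m → (k l : ℕ) → ¬ (2 ∣ l) → m ≡ 2 ^ k * l →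
    (K : FiniteField) → FiniteField.card K ≡ q ^ m →
    (N : ℕ) → FieldDefs.OverFq.NqEquals K q N →
    ((l ≡ 1 →
    ((2 ∣ q) → 2 * N ≡ (q ∸ 1) * q ^ m)
    × (¬ (2 ∣ q) → 2 * N ≡ q * (q ^ m ∸ 1)))
    × (1 < l → (F : FiniteField) → FiniteField.card F ≡ q ^ (2 ^ k) →
    (I : ℕ) → FieldDefs.NumIrred F l I →
    ((2 ∣ q) → 2 * N ≡ l * I * (q ∸ 1))
    × (¬ (2 ∣ q) → 2 * N ≡ l * I * q)))
theorem5p2 p e q pp 1≤e refl m 1<m k l 2∤l refl K card≡ N N-size = part-1 , part-2
  where
  open CountN p e k l pp 1≤e 2∤l 1<m K card≡
  module T = Tower p e k l pp 1≤e 2∤l 1<m K card≡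
  open T using (finite; #Good; #Degree-l; #Degree-l*; module Φ; card≡Q^; 1<Q; suc-pred-l)
  open Finite finite using (#; #-cong; #-all; _≟_)
  module D = GaussDegrees K T.Q 1<Q (T.φ.σ-+ T.n) (ℕ.pred l) card≡Q^

  even : 2 ∣ q → 2 * N ≡ (q ∸ 1) * #Degree-l
  even 2∣q = trans (cong (2 *_) (N≡#Good N-size)) (T.Even.#Good-even 2∣q)

  odd : ¬ 2 ∣ q → 2 * N ≡ #Degree-l* * q
  odd 2∤q = trans (cong (2 *_) (N≡#Good N-size)) (T.Odd.#Good-odd 2∤q)

  part-1 : l ≡ 1 → (2 ∣ q → 2 * N ≡ (q ∸ 1) * q ^ (2 ^ k * l)) × (¬ 2 ∣ q → 2 * N ≡ q * (q ^ (2 ^ k * l) ∸ 1))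
  part-1 l≡1 = (λ 2∣q → trans (even 2∣q) (cong ((q ∸ 1) *_) #all))
             , (λ 2∤q → trans (odd 2∤q) (trans (cong (_* q) #nonzero) (ℕₚ.*-comm (q ^ (2 ^ k * l) ∸ 1) q)))
    where
    -- For l = 1 the field F_Q is K itself, and no i satisfies 0 < i < l.
    vacuous : ∀ x → Φ.DegreeAtLeast l x
    vacuous x i i<l 0<i = contradiction (ℕₚ.<-≤-trans i<l (ℕₚ.≤-trans (ℕₚ.≤-reflexive l≡1) 0<i)) (ℕₚ.<-irrefl refl)
    #all : #Degree-l ≡ q ^ (2 ^ k * l)
    #all = trans (#-all (Φ.DegreeAtLeast? l) vacuous) (trans T.size≡card card≡)
    #nonzero : #Degree-l* ≡ q ^ (2 ^ k * l) ∸ 1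
    #nonzero = trans (#-cong (λ x → Φ.DegreeAtLeast? l x ×-dec ¬? (x ≟ T.0#)) (λ x → ¬? (x ≟ T.0#)) (λ _ → proj₂)
        (λ x x≢0 → (vacuous x) , x≢0))
      (trans (cong ℕ.pred (sym T.card≡1+nonzero)) (cong (_∸ 1) card≡))

  part-2 : 1 < l → (F : FiniteField) → FiniteField.card F ≡ q ^ (2 ^ k) → (I : ℕ) → FieldDefs.NumIrred F l I →
           (2 ∣ q → 2 * N ≡ l * I * (q ∸ 1)) × (¬ 2 ∣ q → 2 * N ≡ l * I * q)
  part-2 1<l F cardF I I-size =
      (λ 2∣q → trans (even 2∣q) (trans (ℕₚ.*-comm (q ∸ 1) #Degree-l) (cong (_* (q ∸ 1)) #≡lI)))
    , (λ 2∤q → trans (odd 2∤q) (cong (_* q) (trans nonzero-automatic #≡lI)))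
    where
    module G = GaussFormula F
    #≡lI : #Degree-l ≡ l * I
    #≡lI = begin
      #Degree-l
        ≡⟨ #-cong (Φ.DegreeAtLeast? l) (D.degree? l) (λ x deg → T.Φ-Fixed-l x , deg)
            (λ x fixed×deg → proj₂ fixed×deg) ⟩
      D.#Degree l
        ≡⟨ cong D.#Degree suc-pred-l ⟨
      D.#Degree (suc (ℕ.pred l))
        ≡⟨ divisorSum-injective D.#Degree (λ d → d * G.#Irreducible d) (suc (ℕ.pred l))
             (λ n n∣l → trans (D.gauss-degrees n n∣l) (sym (trans (G.gauss n) (cong (_^ suc n) cardF))))
                 (ℕ.pred l) ∣-refl ⟩
      suc (ℕ.pred l) * G.#Irreducible (suc (ℕ.pred l))
        ≡⟨ cong (λ d → d * G.#Irreducible d) suc-pred-l ⟩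
      l * G.#Irreducible l
        ≡⟨ cong (l *_) (G.NumIrred≡#Irreducible l I-size) ⟨
      l * I ∎
      where open ≡-Reasoning
    -- For l > 1 the element 0, being of degree 1, is excluded already by the degree condition.
    nonzero-automatic : #Degree-l* ≡ #Degree-l
    nonzero-automatic = #-cong (λ x → Φ.DegreeAtLeast? l x ×-dec ¬? (x ≟ T.0#)) (Φ.DegreeAtLeast? l)
        (λ x deg×x≢0 → proj₁ deg×x≢0)
      (λ x deg → deg , Φ.DegreeAtLeast⇒nonzero 1<l deg)
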